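{- Let $a,b,c,d,e,m$ be nonnegative integers and let $\pi=\Lambda(a,b,c,d,e,m)=\lambda/b^a$ be the skew shape defined in the context, with $n=|\pi|$. Then the number of standard Young tableaux of shape $\pi$ is \[ f^{\pi}=n!\cdot\frac{\Phi(a+b+c)\,\Phi(a)\,\Phi(b)\,\Phi(c)}{\Phi(a+b)\,\Phi(b+c)\,\Phi(a+c)\,\Psi^{(m)}(a+c)\,\Psi^{(m)}(b+c)}\;\prod_{i=0}^{a+c-1}\frac{(i(m+1))!}{(d+i(m+1))!}\;\prod_{i=0}^{b+c-1}\frac{(i(m+1))!}{(e+i(m+1))!}\;\frac{\prod_{i=0}^{b-1}\prod_{j=0}^{a-1}\bigl(1+d+e+(c+i+j)(m+1)\bigr)}{\prod_{i=0}^{b+c-1}\prod_{j=0}^{a+c-1}\bigl(1+d+e+(i+j)(m+1)\bigr)}. \]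
   Context: Young diagrams are in English notation, cells $(i,j)$ with row $i$ and column $j$. For a skew shape $\lambda/\mu$, $f^{\lambda/\mu}$ is the number of standard Young tableaux of shape $\lambda/\mu$. Superfactorial: $\Phi(n)=\prod_{k=1}^{n-1}k!$ (so $\Phi(0)=\Phi(1)=1$). Falling factorial $(k)_m=k(k-1)\cdots(k-m+1)$, $(k)_0=1$, and $\Psi^{(m)}(n)=\prod_{i=1}^{n-1}\prod_{j=1}^{i}(jm+j-1)_m$. The shape $\Lambda(a,b,c,d,e,m)$: set $\nu_i=d+(a+c-i)m$ for $1\le i\le a+c$ and $\theta_j=e+(b+c-j)m$ for $1\le j\le b+c$; let $\lambda$ be the partition whose Young diagram consists of the cells $(i,j)$ with either ($i\le a+c$ and $j\le b+c+\nu_i$) or ($j\le b+c$ and $i\le a+c+\theta_j$) (i.e. the $(a+c)\times(b+c)$ rectangle with the rows of $\nu$ attached to its right and the columns of lengths $\theta_j$ attached below it); then $\Lambda(a,b,c,d,e,m)=\lambda/b^a$ where $b^a=(b,\dots,b)$ ($a$ parts). For example $\Lambda(a,b,c,d,e,0)=(b+c+d)^{a+c}(b+c)^e/b^a$ and $\Lambda(a,b,c,0,0,1)=\delta_{a+b+2c}/b^a$ with $\delta_N=(N-1,N-2,\dots,1)$. -}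

module Defs where

open import Data.Nat using (ℕ; zero; suc; _+_; _*_; _∸_; _≤_; _<_; _≤?_; _<?_; _!)
open import Relation.Binary.PropositionalEquality using (_≡_)
open import Data.Nat.Properties using (_≟_)
open import Data.Product using (_×_; _,_)
open import Data.Sum using (_⊎_)
open import Data.Unit using (⊤)
open import Data.List using (List; []; _∷_; length; filter; concatMap; map; upTo)
open import Data.List.Relation.Unary.All using (All; all?)
open import Relation.Nullary using (¬_; Dec; yes; no)
open import Relation.Nullary.Decidable using (_×-dec_; _⊎-dec_; ¬?)
open import Relation.Unary using (Decidable)

prod : ℕ → (ℕ → ℕ) → ℕ
prod zero    f = 1
prod (suc n) f = prod n f * f n

Φ : ℕ → ℕ
Φ zero    = 1
Φ (suc n) = Φ n * (n !)

fall : ℕ → ℕ → ℕ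
fall k zero    = 1
fall k (suc m) = fall k m * (k ∸ m)

Ψ : ℕ → ℕ → ℕ
Ψ m n = prod (n ∸ 1) (λ i′ → prod (suc i′) (λ j′ →
          let j = suc j′ in fall (j * m + j ∸ 1) m))

-- Cells (i , j) : row i, column j (1-based, English notation)

Cell : Set
Cell = ℕ × ℕ

ν : (a c d m : ℕ) → ℕ → ℕ
ν a c d m i = d + (a + c ∸ i) * m

θ : (b c e m : ℕ) → ℕ → ℕ
θ b c e m j = e + (b + c ∸ j) * m

InΛ : (a b c d e m : ℕ) → Cell → Set
InΛ a b c d e m (i , j) =
  (1 ≤ i × 1 ≤ j) ×
  (((i ≤ a + c × j ≤ b + c + ν a c d m i) ⊎ (j ≤ b + c × i ≤ a + c + θ b c e m j))
   × ¬ (i ≤ a × j ≤ b))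

InΛ? : (a b c d e m : ℕ) → Decidable (InΛ a b c d e m)
InΛ? a b c d e m (i , j) =
  ((1 ≤? i) ×-dec (1 ≤? j)) ×-dec
  ((((i ≤? a + c) ×-dec (j ≤? b + c + ν a c d m i)) ⊎-dec
    ((j ≤? b + c) ×-dec (i ≤? a + c + θ b c e m j)))
   ×-dec ¬? ((i ≤? a) ×-dec (j ≤? b)))

grid : ℕ → ℕ → List Cell
grid R C = concatMap (λ i → map (λ j → (i , j)) (upTo C)) (upTo R)

-- The list of cells of Λ(a,b,c,d,e,m).  Every cell of λ satisfies
-- i ≤ a+c+θ_1 ≤ a+c+e+(b+c)m and j ≤ b+c+ν_1 ≤ b+c+d+(a+c)m, so the
-- grid below contains all of them.
cellsΛ : (a b c d e m : ℕ) → List Cell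
cellsΛ a b c d e m =
  filter (InΛ? a b c d e m)
    (grid (suc (a + c + e + (b + c) * m)) (suc (b + c + d + (a + c) * m)))

-- Standard Young tableaux of a skew shape with cell list `cells`.
-- A filling T of the n cells with 1..n bijectively is encoded by the list
-- w of cells ordered by their entries (w ! k = T⁻¹(k+1)); this is a
-- permutation of the cell list.  T is standard iff entries strictly
-- increase along rows and down columns, i.e. no cell comes (in w) after
-- a cell lying strictly to its right in the same row or strictly below
-- it in the same column.

StrictlyBefore : Cell → Cell → Set
StrictlyBefore (i′ , j′) (i , j) = (i′ ≡ i × j′ < j) ⊎ (j′ ≡ j × i′ < i)

StrictlyBefore? : (y x : Cell) → Dec (StrictlyBefore y x)
StrictlyBefore? (i′ , j′) (i , j) =
  ((i′ ≟ i) ×-dec (j′ <? j)) ⊎-dec ((j′ ≟ j) ×-dec (i′ <? i))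

Standard : List Cell → Set
Standard []      = ⊤
Standard (x ∷ w) = All (λ y → ¬ StrictlyBefore y x) w × Standard w

Standard? : Decidable Standard
Standard? []      = yes _
Standard? (x ∷ w) = all? (λ y → ¬? (StrictlyBefore? y x)) w ×-dec Standard? w

insertions : {A : Set} → A → List A → List (List A)
insertions x []       = (x ∷ []) ∷ []
insertions x (y ∷ ys) = (x ∷ y ∷ ys) ∷ map (y ∷_) (insertions x ys)

perms : {A : Set} → List A → List (List A)
perms []       = [] ∷ []
perms (x ∷ xs) = concatMap (insertions x) (perms xs)

numSYT : List Cell → ℕ
numSYT cells = length (filter Standard? (perms cells))

{-# OPTIONS --safe #-}
module Submission where

-- Let A = a + c and B = b + c.  A partition λ containing the A × B rectangle but not the
-- cell (A+1 , B+1) is encoded by the strictly increasing sequences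
-- x_p = λ_{A-p} - B + p and y_q = λ'_{B-q} - A + q.  Then f^{λ/b^a} / n! is, up to the sign
-- (-1)^{ab}, the determinant of the block matrix
--   [ 1 / (x_i! y_j! (x_i + y_j + 1))   (x_i)_k / x_i! ]
--   [ (y_j)_k / y_j!                     0              ]
-- with a extra columns and b extra rows.  Indeed, deleting the largest entry of a tableau
-- lowers one x_p or y_q by 1, or drops x_0 = y_0 = 0 together, and each Leibniz term of the
-- determinant is multiplied by n under the sum of these moves.
-- For Λ the x_p and y_q are arithmetic progressions with common difference m + 1; taking
-- differences of consecutive rows and columns removes the border and leaves a c × c Hankel
-- determinant with entries proportional to 1 / (t_n t_{n+1} ⋯ t_{n+a+b}), n = i + j, where
-- t_n = 1 + d + e + n(m+1), and Gaussian elimination stays within this family.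

open import Defs
open import Data.Bool using (true; false; if_then_else_)
open import Data.Empty using (⊥; ⊥-elim)
open import Data.Product using (_×_; _,_; ∃; proj₁; proj₂; swap)
open import Data.Sum using (_⊎_; inj₁; inj₂) renaming (swap to ⊎-swap)
open import Function using (_∘_; flip; mk⇔)
open import Relation.Nullary using (¬_; Dec; yes; no; does)
open import Relation.Binary.PropositionalEquality using (_≡_; _≢_; refl; sym; trans; cong; cong₂; subst; subst₂; module ≡-Reasoning)

-- The induction cannot stay inside the family of shapes Λ, because removing a cell spoils the
-- arithmetic progressions. The determinant is therefore attached to arbitrary strict sequences,
-- where it satisfies the removal recurrence, and is evaluated only on progressions. The parameter
-- `c` varies as well, since dropping `x_0 = y_0 = 0` lowers it; for `c = 0` the inner corner is not
-- a cell of the shape, and the corresponding minor vanishes. The recurrence is obtained by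
-- differentiating the determinant. The sum over all moves is a directional derivative whose
-- direction is, entry by entry, the removal recurrence of one hook, row or column; homogeneity for
-- a grading by numbers of cells then produces the factor n. The derivative also contains illegal
-- moves, which lower a part onto its neighbour, but these create two equal rows or columns. The
-- base case comes from the evaluation itself: the empty shape has `x_p = p` and `y_q = q`, again
-- progressions, and this is where the sign `(-1)^{ab}` is settled.

module Shapes where
  open import Data.Nat using (ℕ; zero; suc; s≤s; z≤n; _+_; _∸_; _≤_; _<_; _≡ᵇ_; _<?_; _≟_)
  open import Data.Nat.Properties

  -- Strict sequences and the skew shapes they encode

  ≡ᵇ-refl : ∀ i → (i ≡ᵇ i) ≡ true
  ≡ᵇ-refl zero    = refl
  ≡ᵇ-refl (suc i) = ≡ᵇ-refl i

  Strict : (ℕ → ℕ) → Set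
  Strict x = ∀ p → x p < x (suc p)

  -- The truncation at 0 does no harm: shapes lower only positive parts, and in the determinant
  -- recurrence each term carries the factor `isPos`.
  dec : ℕ → (ℕ → ℕ) → ℕ → ℕ
  dec p x n = if n ≡ᵇ p then x p ∸ 1 else x n

  -- Rows are counted upwards from row `A` and lengths are compared additively. No subtraction
  -- enters, and shrinking the rectangle by one row and one column becomes the plain shift
  -- `x ∘ suc`.
  Row : (A B : ℕ) (x : ℕ → ℕ) (i j : ℕ) → Set
  Row A B x i j = ∃ λ p → i + p ≡ A × j + p ≤ B + x p

  -- The cells of λ/b^a, where row A - p of λ has length B + x p - p and column B - q has length A + y q - q.
  In : (a b A B : ℕ) (x y : ℕ → ℕ) → Cell → Set
  In a b A B x y (i , j) = (1 ≤ i × 1 ≤ j) × ((Row A B x i j ⊎ Row B A y j i) × ¬ (i ≤ a × j ≤ b))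

  In-transpose : ∀ {a b A B x y} i j → In a b A B x y (i , j) → In b a B A y x (j , i)
  In-transpose i j (pos , r , n) = swap pos , ⊎-swap r , n ∘ swap

  At : (A B : ℕ) (x : ℕ → ℕ) (p i j : ℕ) → Set
  At A B x p i j = i + p ≡ A × j + p ≡ B + x p

  -- Part p of x can be lowered while keeping x strict and nonnegative.
  OK : (ℕ → ℕ) → ℕ → Set
  OK x zero    = 0 < x 0
  OK x (suc p) = suc (x p) < x (suc p)

  OK? : ∀ x p → Dec (OK x p)
  OK? x zero    = 0 <? x 0
  OK? x (suc p) = suc (x p) <? x (suc p)

  strict-≥ : ∀ {x} → Strict x → ∀ p → p ≤ x p
  strict-≥ s zero    = z≤n
  strict-≥ s (suc p) = ≤-<-trans (strict-≥ s p) (s p)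

  OK-< : ∀ {x} → Strict x → ∀ p → OK x p → p < x p
  OK-< s zero    ok = ok
  OK-< s (suc p) ok = ≤-<-trans (s≤s (strict-≥ s p)) ok

  strict-dec : ∀ {x} p → Strict x → OK x p → Strict (dec p x)
  strict-dec {x} zero    s ok zero    = ≤-<-trans (m∸n≤m (x 0) 1) (s 0)
  strict-dec     zero    s ok (suc q) = s (suc q)
  strict-dec {x} (suc zero) s ok zero with x 1 | ok
  ... | suc _ | s≤s lt = lt
  strict-dec     (suc (suc p)) s ok zero = s 0
  strict-dec {x} (suc p) s ok (suc q) = strict-dec {x ∘ suc} p (s ∘ suc) (OK-suc p ok) q
    where
    OK-suc : ∀ p → OK x (suc p) → OK (x ∘ suc) p
    OK-suc zero    ok = ≤-<-trans z≤n ok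
    OK-suc (suc p) ok = ok

  dec-hit : ∀ p x → dec p x p ≡ x p ∸ 1
  dec-hit p x = cong (λ b → if b then x p ∸ 1 else x p) (≡ᵇ-refl p)

  dec-miss : ∀ p x q → q ≢ p → dec p x q ≡ x q
  dec-miss p x q = go p q x
    where
    go : ∀ {v} p q (f : ℕ → ℕ) → q ≢ p → (if q ≡ᵇ p then v else f q) ≡ f q
    go zero    zero    f q≢p = ⊥-elim (q≢p refl)
    go zero    (suc q) f q≢p = refl
    go (suc p) zero    f q≢p = refl
    go (suc p) (suc q) f q≢p = go p q (f ∘ suc) (q≢p ∘ cong suc)

  -- Row `A - p` has length `B + x p - p`, which is weakly increasing in `p` because `x` is strict:
  -- this is the partition condition.
  row-mono : ∀ {x} → Strict x → ∀ B j {p q} → p ≤ q → j + p ≤ B + x p → j + q ≤ B + x q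
  row-mono {x} s B j {p} {q} p≤q le with m≤n⇒m<n∨m≡n p≤q
  ... | inj₂ refl = le
  ... | inj₁ (s≤s {n = q′} p≤q′) = begin
    j + suc q′      ≡⟨ +-suc j q′ ⟩
    suc (j + q′)    ≤⟨ s≤s (row-mono s B j p≤q′ le) ⟩
    suc (B + x q′)  ≡⟨ +-suc B (x q′) ⟨
    B + suc (x q′)  ≤⟨ +-monoʳ-≤ B (s q′) ⟩
    B + x (suc q′)  ∎
    where open ≤-Reasoning

  Row-≤ : ∀ {A B x i j} → Row A B x i j → i ≤ A
  Row-≤ {i = i} (p , eq , _) = ≤-trans (m≤m+n i p) (≤-reflexive eq)

  -- The last cell of a row

  module _ {a b A B : ℕ} {x y : ℕ → ℕ} (b≤B : b ≤ B) (sx : Strict x) where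

    At-> : ∀ {p i j} → p < x p → At A B x p i j → B < j
    At-> {p} {i} {j} lt (_ , eq) = +-cancelʳ-< p B j (≤-trans (+-monoʳ-< B lt) (≤-reflexive (sym eq)))

    At-In : ∀ {p i j} → p < A → p < x p → At A B x p i j → In a b A B x y (i , j)
    At-In {p} {i} {j} p<A p<xp at@(eqi , eqj) =
      (pos i eqi , ≤-trans (s≤s z≤n) B<j) , inj₁ (p , eqi , ≤-reflexive eqj) , λ (_ , j≤b) → <⇒≱ B<j (≤-trans j≤b b≤B)
      where
      B<j = At-> {p} {i} {j} p<xp at
      pos : ∀ i → i + p ≡ A → 1 ≤ i
      pos zero    eq = ⊥-elim (<-irrefl eq p<A)
      pos (suc i) eq = s≤s z≤n

    -- Cells to the right of or below `(i , j)` also lie beyond column `B`, so they can only come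
    -- from rows governed by `x`. The row of `(i , j)` has ended, and `OK` makes the rows below it
    -- end before column `j`.
    At-maximal : ∀ {p i j} → OK x p → At A B x p i j → ∀ w → In a b A B x y w → ¬ StrictlyBefore (i , j) w
    At-maximal {p} {i} {j} ok at@(eqi , eqj) (i′ , j′) (_ , inj₁ (p′ , eqi′ , le) , _) (inj₁ (refl , j<j′)) =
      <⇒≱ j<j′ (+-cancelʳ-≤ p j′ j (≤-trans (subst (λ u → j′ + u ≤ B + x u) (+-cancelˡ-≡ i p′ p (trans eqi′ (sym eqi))) le) (≤-reflexive (sym eqj))))
    At-maximal {p} {i} {j} ok at (i′ , j′) (_ , inj₂ row , _) (inj₁ (refl , j<j′)) =
      <⇒≱ (<-trans (At-> {p} {i} {j} (OK-< sx p ok) at) j<j′) (Row-≤ {B} {A} {y} row)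
    At-maximal {zero} {i} {j} ok at@(eqi , eqj) (i′ , j′) (_ , inj₁ (p′ , eqi′ , le) , _) (inj₂ (refl , i<i′)) =
      <⇒≱ i<i′ (≤-trans (m≤m+n i′ p′) (≤-reflexive (trans eqi′ (trans (sym eqi) (+-identityʳ i)))))
    At-maximal {suc p} {i} {j} ok at@(eqi , eqj) (i′ , j′) (_ , inj₁ (p′ , eqi′ , le) , _) (inj₂ (refl , i<i′)) = <-irrefl eqj (begin-strict
      j + suc p       ≡⟨ +-suc j p ⟩
      suc (j + p)     ≤⟨ s≤s (row-mono sx B j p′≤p le) ⟩
      suc (B + x p)   ≡⟨ +-suc B (x p) ⟨
      B + suc (x p)   <⟨ +-monoʳ-< B ok ⟩
      B + x (suc p)   ∎)
      where
      open ≤-Reasoning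
      p′≤p : p′ ≤ p
      p′≤p = +-cancelˡ-≤ (suc i) p′ p (≤-trans (+-monoˡ-≤ p′ i<i′) (≤-reflexive (trans eqi′ (trans (sym eqi) (+-suc i p)))))
    At-maximal {p} {i} {j} ok at (i′ , j′) (_ , inj₂ row , _) (inj₂ (refl , i<i′)) =
      <⇒≱ (At-> {p} {i} {j} (OK-< sx p ok) at) (Row-≤ {B} {A} {y} row)

    -- With `dec⁻`: lowering one part deletes exactly one cell. The columns governed by `y` are not
    -- affected, because that cell lies beyond column `B`.
    dec⁺ : ∀ {p i j} → p < x p → At A B x p i j → ∀ w → In a b A B x y w → (i , j) ≢ w → In a b A B (dec p x) y w
    dec⁺ {p} {i} {j} lt (eqi , eqj) (i′ , j′) (pos , inj₂ r , n) z≢w = pos , inj₂ r , n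
    dec⁺ {p} {i} {j} lt (eqi , eqj) (i′ , j′) (pos , inj₁ (p′ , eqi′ , le) , n) z≢w with p′ ≟ p
    ... | no p′≢p = pos , inj₁ (p′ , eqi′ , subst (λ u → j′ + p′ ≤ B + u) (sym (dec-miss p x p′ p′≢p)) le) , n
    ... | yes refl = pos , inj₁ (p , eqi′ , subst (λ u → j′ + p ≤ B + u) (sym (dec-hit p x)) (drop (x p) lt
            (≤∧≢⇒< le λ eqj′ → z≢w (cong₂ _,_ (+-cancelʳ-≡ p i i′ (trans eqi (sym eqi′))) (+-cancelʳ-≡ p j j′ (trans eqj (sym eqj′))))))) , n
      where
      drop : ∀ k → p < k → j′ + p < B + k → j′ + p ≤ B + (k ∸ 1)
      drop (suc k) _ lt = ≤-pred (≤-trans lt (≤-reflexive (+-suc B k)))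

    dec⁻ : ∀ {p i j} → p < x p → At A B x p i j → ∀ w → In a b A B (dec p x) y w → In a b A B x y w × (i , j) ≢ w
    dec⁻ {p} {i} {j} lt at@(eqi , eqj) (i′ , j′) (pos , inj₂ r , n) =
      (pos , inj₂ r , n) , λ { refl → <⇒≱ (At-> {p} {i} {j} lt at) (Row-≤ {B} {A} {y} r) }
    dec⁻ {p} {i} {j} lt (eqi , eqj) (i′ , j′) (pos , inj₁ (p′ , eqi′ , le) , n) with p′ ≟ p
    ... | no p′≢p = (pos , inj₁ (p′ , eqi′ , subst (λ u → j′ + p′ ≤ B + u) (dec-miss p x p′ p′≢p) le) , n) ,
            λ { refl → p′≢p (+-cancelˡ-≡ i p′ p (trans eqi′ (sym eqi))) }
    ... | yes refl = (pos , inj₁ (p , eqi′ , ≤-trans le′ (+-monoʳ-≤ B (m∸n≤m (x p) 1))) , n) ,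
            λ { refl → <⇒≱ (strictly (x p) lt) (≤-trans (≤-reflexive (sym eqj)) le′) }
      where
      le′ : j′ + p ≤ B + (x p ∸ 1)
      le′ = subst (λ u → j′ + p ≤ B + u) (dec-hit p x) le
      strictly : ∀ k → p < k → B + (k ∸ 1) < B + k
      strictly (suc k) _ = +-monoʳ-< B (n<1+n k)

    -- A maximal cell lies at the end of its row, and is the inner corner (A , B) unless the row sticks out of the A × B rectangle.
    maximal-row : ∀ {i j} → In a b A B x y (i , j) → Row A B x i j → (∀ w → In a b A B x y w → ¬ StrictlyBefore (i , j) w) →
      (∃ λ p → p < A × OK x p × At A B x p i j) ⊎ ((i ≡ A × j ≡ B) × (x 0 ≡ 0 × y 0 ≡ 0))
    maximal-row {i} {j} inz@((1≤i , 1≤j) , _ , n) (p , eqi , le) max with m≤n⇒m<n∨m≡n le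
    ... | inj₁ lt = ⊥-elim (max (i , suc j) ((1≤i , s≤s z≤n) , inj₁ (p , eqi , lt) , λ (i≤a , j<b) → n (i≤a , <⇒≤ j<b)) (inj₁ (refl , n<1+n j)))
    ... | inj₂ eqj with p <? x p
    ...   | yes p<xp = inj₁ (p , p<A , ok p eqi eqj p<xp , eqi , eqj)
      where
      p<A : p < A
      p<A = ≤-trans (+-monoˡ-≤ p 1≤i) (≤-reflexive eqi)
      ok : ∀ p → i + p ≡ A → j + p ≡ B + x p → p < x p → OK x p
      ok zero    _   _   lt = lt
      ok (suc p) eqi eqj lt with suc (x p) <? x (suc p)
      ... | yes ok = ok
      -- Otherwise the row below is at least as long, and the cell beneath `(i , j)` contradicts
      -- maximality.
      ... | no ¬ok = ⊥-elim (max (suc i , j) ((s≤s z≤n , 1≤j) , inj₁ (p , trans (sym (+-suc i p)) eqi ,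
              ≤-pred (≤-trans (≤-reflexive (trans (sym (+-suc j p)) eqj)) (≤-trans (+-monoʳ-≤ B (≮⇒≥ ¬ok)) (≤-reflexive (+-suc B (x p)))))) ,
              λ (i<a , j≤b) → n (<⇒≤ i<a , j≤b)) (inj₂ (refl , n<1+n i)))
    -- Strictness forces `x p ≡ p`, so this row stops at column `B`. By maximality column `B` stops
    -- at row `i`, and since it has length `A + y 0` this gives `i ≡ A`, `p ≡ 0` and `y 0 ≡ 0`.
    ...   | no p≮xp = inj₂ ((i≡A , j≡B) , trans (cong x (sym p≡0)) (trans xp≡p p≡0) , y0≡0)
      where
      xp≡p : x p ≡ p
      xp≡p = ≤-antisym (≮⇒≥ p≮xp) (strict-≥ sx p)
      j≡B : j ≡ B
      j≡B = +-cancelʳ-≡ p j B (trans eqj (cong (B +_) xp≡p))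
      below : ¬ (i < A + y 0)
      below lt = max (suc i , j) ((s≤s z≤n , 1≤j) , inj₂ (0 , trans (+-identityʳ j) j≡B , ≤-trans (≤-reflexive (+-identityʳ (suc i))) lt) ,
        λ (i<a , j≤b) → n (<⇒≤ i<a , j≤b)) (inj₂ (refl , n<1+n i))
      i≡A : i ≡ A
      i≡A = ≤-antisym (≤-trans (m≤m+n i p) (≤-reflexive eqi)) (≤-trans (m≤m+n A (y 0)) (≮⇒≥ below))
      p≡0 : p ≡ 0
      p≡0 = +-cancelˡ-≡ i p 0 (trans eqi (trans (sym i≡A) (sym (+-identityʳ i))))
      y0≡0 : y 0 ≡ 0
      y0≡0 = n≤0⇒n≡0 (+-cancelˡ-≤ A (y 0) 0 (≤-trans (≮⇒≥ below) (≤-reflexive (trans i≡A (sym (+-identityʳ A))))))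

  -- Removing the inner corner of the rectangle

  module _ {a b A B : ℕ} {x y : ℕ → ℕ} (x₀ : x 0 ≡ 0) (y₀ : y 0 ≡ 0) where

    corner-In : ¬ (suc A ≤ a × suc B ≤ b) → In a b (suc A) (suc B) x y (suc A , suc B)
    corner-In n = (s≤s z≤n , s≤s z≤n) , inj₁ (0 , +-identityʳ (suc A) , +-monoʳ-≤ (suc B) z≤n) , n

    private
      corner-row : ∀ {A B : ℕ} {x y : ℕ → ℕ} → x 0 ≡ 0 → ∀ {j′} → suc B < j′ → ¬ (Row (suc A) (suc B) x (suc A) j′ ⊎ Row (suc B) (suc A) y j′ (suc A))
      corner-row {A} {B} {x} {y} x₀ {j′} lt (inj₁ (p , eq , le)) = <⇒≱ lt (≤-trans (m≤m+n j′ p) (≤-trans le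
        (≤-reflexive (trans (cong (λ u → suc B + x u) (+-cancelˡ-≡ (suc A) p 0 (trans eq (sym (+-identityʳ (suc A)))))) (trans (cong (suc B +_) x₀) (+-identityʳ (suc B)))))))
      corner-row {A} {B} {x} {y} x₀ lt (inj₂ row) = <⇒≱ lt (Row-≤ {suc B} {suc A} {y} row)

    corner-maximal : ∀ w → In a b (suc A) (suc B) x y w → ¬ StrictlyBefore (suc A , suc B) w
    corner-maximal (i′ , j′) (_ , r , _) (inj₁ (refl , lt)) = corner-row {x = x} {y = y} x₀ lt r
    corner-maximal (i′ , j′) (_ , r , _) (inj₂ (refl , lt)) = corner-row {x = y} {y = x} y₀ lt (⊎-swap r)

    private
      -- Row `suc A` is lost as a row of the smaller rectangle. Since `x 0 ≡ 0` it ends at column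
      -- `suc B`, so its cells other than the corner lie in columns still described by `y ∘ suc`,
      -- and these reach row `suc A` because `suc q ≤ y (suc q)`.
      shrink-row : ∀ {A B : ℕ} {x y : ℕ → ℕ} → x 0 ≡ 0 → Strict y → ∀ i j → 1 ≤ j → (suc A , suc B) ≢ (i , j) →
        Row (suc A) (suc B) x i j → Row A B (x ∘ suc) i j ⊎ Row B A (y ∘ suc) j i
      shrink-row {A} {B} {x} {y} x₀ sy i j 1≤j z≢w (suc p , eq , le) =
        inj₁ (p , suc-injective (trans (sym (+-suc i p)) eq) , ≤-pred (≤-trans (≤-reflexive (sym (+-suc j p))) le))
      shrink-row {A} {B} {x} {y} x₀ sy i j 1≤j z≢w (zero , eq , le) = inj₂ (q , jq , (begin
        i + q            ≡⟨ cong (_+ q) i≡ ⟩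
        suc (A + q)      ≡⟨ +-suc A q ⟨
        A + suc q        ≤⟨ +-monoʳ-≤ A (strict-≥ sy (suc q)) ⟩
        A + y (suc q)    ∎))
        where
        open ≤-Reasoning
        i≡ : i ≡ suc A
        i≡ = trans (sym (+-identityʳ i)) eq
        j≤ : j ≤ suc B
        j≤ = ≤-trans (≤-reflexive (sym (+-identityʳ j))) (≤-trans le (≤-reflexive (trans (cong (suc B +_) x₀) (+-identityʳ (suc B)))))
        j<  : j < suc B
        j< = ≤∧≢⇒< j≤ (λ j≡ → z≢w (cong₂ _,_ (sym i≡) (sym j≡)))
        q = B ∸ j
        jq : j + q ≡ B
        jq = m+[n∸m]≡n (≤-pred j<)

      grow-row : ∀ {A B : ℕ} {x : ℕ → ℕ} → ∀ i j → Row A B (x ∘ suc) i j → Row (suc A) (suc B) x i j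
      grow-row i j (p , eq , le) = suc p , trans (+-suc i p) (cong suc eq) , ≤-trans (≤-reflexive (+-suc j p)) (s≤s le)

    shrink⁺ : Strict x → Strict y → ∀ w → In a b (suc A) (suc B) x y w → (suc A , suc B) ≢ w → In a b A B (x ∘ suc) (y ∘ suc) w
    shrink⁺ sx sy (i , j) (pos , inj₁ r , n) ne = pos , shrink-row {x = x} {y = y} x₀ sy i j (proj₂ pos) ne r , n
    shrink⁺ sx sy (i , j) (pos , inj₂ r , n) ne = pos , ⊎-swap (shrink-row {x = y} {y = x} y₀ sx j i (proj₁ pos) (λ eq → ne (cong swap eq)) r) , n

    shrink⁻ : Strict x → Strict y → ∀ w → In a b A B (x ∘ suc) (y ∘ suc) w → In a b (suc A) (suc B) x y w × (suc A , suc B) ≢ w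
    shrink⁻ sx sy (i , j) (pos , inj₁ r , n) = (pos , inj₁ (grow-row {x = x} i j r) , n) , λ { refl → <⇒≱ (n<1+n A) (Row-≤ {A} {B} {x ∘ suc} r) }
    shrink⁻ sx sy (i , j) (pos , inj₂ r , n) = (pos , inj₂ (grow-row {x = y} j i r) , n) , λ { refl → <⇒≱ (n<1+n B) (Row-≤ {B} {A} {y ∘ suc} r) }

module Tableaux where
  open import Data.Nat as ℕ using (ℕ; zero; suc; s≤s; z≤n; _≡ᵇ_; _!; _^_)
  import Data.Nat.Properties as ℕ
  import Data.Nat.Tactic.RingSolver as ℕ-Solver
  open import Data.Rational using (ℚ; 0ℚ; 1ℚ; _+_; _*_; -_; _-_; 1/_; Positive; NonNegative; NonZero; positive)
  open import Data.Rational.Properties using (+-comm; +-assoc; +-identityˡ; +-identityʳ; +-inverseʳ; *-comm; *-assoc; *-identityˡ; *-identityʳ; *-zeroˡ; *-zeroʳ; *-distribˡ-+; *-inverseʳ; +-mono-<-≤; positive⁻¹; nonNegative⁻¹; pos⇒nonNeg; pos⇒nonZero; <-irrefl)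
  open import Data.Rational.Solver using (module +-*-Solver)
  open import Data.List using (List; []; _∷_; _++_; _∷ʳ_; map; concatMap; filter; length; upTo; applyUpTo)
  open import Data.List.Extrema.Nat using (argmax; argmax-sel; f[xs]≤f[argmax]; f[⊥]≤f[argmax])
  open import Data.List.Membership.Propositional using (_∈_; find; lose)
  open import Data.List.Membership.Propositional.Properties using (∈-map⁺; ∈-map⁻; ∈-filter⁺; ∈-filter⁻; ∈-++⁺ˡ; ∈-++⁺ʳ; ∈-++⁻; ∈-upTo⁺; ∈-upTo⁻; ∈-concatMap⁺; ∈-concatMap⁻)
  open import Data.List.Membership.Propositional.Properties.WithK using (unique∧set⇒bag)
  open import Data.List.Properties using (filter-all; filter-accept; filter-reject)
  open import Data.List.Relation.Binary.BagAndSetEquality using (∼bag⇒↭)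
  open import Data.List.Relation.Binary.Permutation.Propositional as ↭ using (_↭_; ↭-refl; ↭-prep; ↭-trans; ↭-sym)
  open import Data.List.Relation.Binary.Permutation.Propositional.Properties using (All-resp-↭)
  open import Data.List.Relation.Unary.All as All using (All; []; _∷_; all?)
  open import Data.List.Relation.Unary.AllPairs using ([]; _∷_)
  import Data.List.Relation.Unary.AllPairs.Properties as AllPairs
  open import Data.List.Relation.Unary.Any using (here; there)
  open import Data.List.Relation.Unary.Unique.Propositional using (Unique)
  import Data.List.Relation.Unary.Unique.Propositional.Properties as Unique
  open import Data.Product.Properties using (≡-dec)
  open import Relation.Nullary.Decidable using (¬?; dec-true; dec-false)
  open import Relation.Unary using (Decidable)
  open +-*-Solver using (solve; _:=_; _:+_; _:*_; :-_; _:-_; con)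
  open Shapes

  -- Natural numbers inside ℚ, finite sums and products

  opaque
    ι : ℕ → ℚ
    ι zero    = 0ℚ
    ι (suc n) = 1ℚ + ι n

    ι-nonNeg : ∀ n → NonNegative (ι n)
    ι-pos : ∀ n → Positive (ι (suc n))
    ι-nonNeg zero    = _
    ι-nonNeg (suc n) = pos⇒nonNeg (ι (suc n)) {{ι-pos n}}
    ι-pos n = positive (+-mono-<-≤ (positive⁻¹ 1ℚ) (nonNegative⁻¹ (ι n) {{ι-nonNeg n}}))

    ι-nonZero : ∀ n → NonZero (ι (suc n))
    ι-nonZero n = pos⇒nonZero (ι (suc n)) {{ι-pos n}}

    ι-+ : ∀ m n → ι (m ℕ.+ n) ≡ ι m + ι n
    ι-+ zero    n = sym (+-identityˡ (ι n))
    ι-+ (suc m) n = trans (cong (1ℚ +_) (ι-+ m n)) (sym (+-assoc 1ℚ (ι m) (ι n)))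

    ι-* : ∀ m n → ι (m ℕ.* n) ≡ ι m * ι n
    ι-* zero    n = sym (*-zeroˡ (ι n))
    ι-* (suc m) n = trans (ι-+ n (m ℕ.* n)) (trans (cong (ι n +_) (ι-* m n))
      (solve 2 (λ x y → y :+ x :* y := (con 1ℚ :+ x) :* y) refl (ι m) (ι n)))

    ι-injective : ∀ m n → ι m ≡ ι n → m ≡ n
    ι-injective zero    zero    eq = refl
    ι-injective zero    (suc n) eq = ⊥-elim (<-irrefl eq (positive⁻¹ (ι (suc n)) {{ι-pos n}}))
    ι-injective (suc m) zero    eq = ⊥-elim (<-irrefl (sym eq) (positive⁻¹ (ι (suc m)) {{ι-pos m}}))
    ι-injective (suc m) (suc n) eq = cong suc (ι-injective m n (trans (lem (ι m)) (trans (cong (_- 1ℚ) eq) (sym (lem (ι n))))))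
      where
      lem : ∀ q → q ≡ (1ℚ + q) - 1ℚ
      lem = solve 1 (λ q → q := (con 1ℚ :+ q) :- con 1ℚ) refl

    -- The junk value inv 0 = 0 is never used.
    inv : ℕ → ℚ
    inv zero    = 0ℚ
    inv (suc n) = (1/ ι (suc n)) {{ι-nonZero n}}

    ι*inv : ∀ n .{{_ : ℕ.NonZero n}} → ι n * inv n ≡ 1ℚ
    ι*inv (suc n) = *-inverseʳ (ι (suc n)) {{ι-nonZero n}}

    ι-zero : ι 0 ≡ 0ℚ
    ι-zero = refl

    ι-suc : ∀ n → ι (suc n) ≡ 1ℚ + ι n
    ι-suc n = refl

  inv-unique : ∀ n .{{_ : ℕ.NonZero n}} q → ι n * q ≡ 1ℚ → inv n ≡ q
  inv-unique n q eq = begin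
    inv n             ≡⟨ *-identityʳ (inv n) ⟨
    inv n * 1ℚ        ≡⟨ cong (inv n *_) eq ⟨
    inv n * (ι n * q) ≡⟨ solve 3 (λ u v w → u :* (v :* w) := (v :* u) :* w) refl (inv n) (ι n) q ⟩
    (ι n * inv n) * q ≡⟨ cong (_* q) (ι*inv n) ⟩
    1ℚ * q            ≡⟨ *-identityˡ q ⟩
    q                 ∎
    where open ≡-Reasoning

  opaque
    ∑ : ℕ → (ℕ → ℚ) → ℚ
    ∑ zero    f = 0ℚ
    ∑ (suc n) f = f 0 + ∑ n (f ∘ suc)

    ∏ : ℕ → (ℕ → ℚ) → ℚ
    ∏ zero    f = 1ℚ
    ∏ (suc n) f = f 0 * ∏ n (f ∘ suc)

    ∑-cong : ∀ n {f g : ℕ → ℚ} → (∀ i → f i ≡ g i) → ∑ n f ≡ ∑ n g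
    ∑-cong zero    eq = refl
    ∑-cong (suc n) eq = cong₂ _+_ (eq 0) (∑-cong n (eq ∘ suc))

    ∑-cong< : ∀ n {f g : ℕ → ℚ} → (∀ i → i ℕ.< n → f i ≡ g i) → ∑ n f ≡ ∑ n g
    ∑-cong< zero    eq = refl
    ∑-cong< (suc n) eq = cong₂ _+_ (eq 0 (s≤s z≤n)) (∑-cong< n (λ i i< → eq (suc i) (s≤s i<)))

    ∏-cong : ∀ n {f g : ℕ → ℚ} → (∀ i → f i ≡ g i) → ∏ n f ≡ ∏ n g
    ∏-cong zero    eq = refl
    ∏-cong (suc n) eq = cong₂ _*_ (eq 0) (∏-cong n (eq ∘ suc))

    ∑-zero : ∀ n (f : ℕ → ℚ) → (∀ i → f i ≡ 0ℚ) → ∑ n f ≡ 0ℚ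
    ∑-zero zero    f eq = refl
    ∑-zero (suc n) f eq = cong₂ _+_ (eq 0) (∑-zero n (f ∘ suc) (eq ∘ suc))

    ∑-+ : ∀ n f g → ∑ n (λ i → f i + g i) ≡ ∑ n f + ∑ n g
    ∑-+ zero    f g = refl
    ∑-+ (suc n) f g = trans (cong ((f 0 + g 0) +_) (∑-+ n (f ∘ suc) (g ∘ suc)))
      (solve 4 (λ x y u v → (x :+ y) :+ (u :+ v) := (x :+ u) :+ (y :+ v)) refl
        (f 0) (g 0) (∑ n (f ∘ suc)) (∑ n (g ∘ suc)))

    ∑-*ˡ : ∀ n k f → ∑ n (λ i → k * f i) ≡ k * ∑ n f
    ∑-*ˡ zero    k f = sym (*-zeroʳ k)
    ∑-*ˡ (suc n) k f = trans (cong (k * f 0 +_) (∑-*ˡ n k (f ∘ suc))) (sym (*-distribˡ-+ k (f 0) (∑ n (f ∘ suc))))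

    ∑-swap : ∀ m n (f : ℕ → ℕ → ℚ) → ∑ m (λ i → ∑ n (f i)) ≡ ∑ n (λ j → ∑ m (λ i → f i j))
    ∑-swap zero    n f = sym (∑-zero n (λ _ → 0ℚ) (λ _ → refl))
    ∑-swap (suc m) n f = trans (cong (∑ n (f 0) +_) (∑-swap m n (f ∘ suc)))
      (sym (∑-+ n (f 0) (λ j → ∑ m (λ i → f (suc i) j))))

    ∏-* : ∀ n f g → ∏ n (λ i → f i * g i) ≡ ∏ n f * ∏ n g
    ∏-* zero    f g = refl
    ∏-* (suc n) f g = trans (cong ((f 0 * g 0) *_) (∏-* n (f ∘ suc) (g ∘ suc)))
      (solve 4 (λ x y u v → (x :* y) :* (u :* v) := (x :* u) :* (y :* v)) refl
        (f 0) (g 0) (∏ n (f ∘ suc)) (∏ n (g ∘ suc)))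

    ∏-suc : ∀ n f → ∏ (suc n) f ≡ ∏ n f * f n
    ∏-suc zero    f = *-comm (f 0) 1ℚ
    ∏-suc (suc n) f = trans (cong (f 0 *_) (∏-suc n (f ∘ suc))) (sym (*-assoc (f 0) _ _))

    ∏-one : ∀ n (f : ℕ → ℚ) → (∀ i → f i ≡ 1ℚ) → ∏ n f ≡ 1ℚ
    ∏-one zero    f eq = refl
    ∏-one (suc n) f eq = cong₂ _*_ (eq 0) (∏-one n (f ∘ suc) (eq ∘ suc))

    ∑-suc : ∀ n f → ∑ (suc n) f ≡ f 0 + ∑ n (f ∘ suc)
    ∑-suc n f = refl

    ∏-head : ∀ n f → ∏ (suc n) f ≡ f 0 * ∏ n (f ∘ suc)
    ∏-head n f = refl

    ∑-empty : ∀ f → ∑ 0 f ≡ 0ℚ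
    ∑-empty f = refl

    ∏-empty : ∀ f → ∏ 0 f ≡ 1ℚ
    ∏-empty f = refl

  opaque
    sg : ℕ → ℚ
    sg zero    = 1ℚ
    sg (suc n) = - sg n

    sg-zero : sg 0 ≡ 1ℚ
    sg-zero = refl

    sg-suc : ∀ n → sg (suc n) ≡ - sg n
    sg-suc n = refl

  -- The coface map: the increasing enumeration of the indices other than `i`. It names the
  -- surviving rows of a minor and also splits one term off a sum or product.
  skip : ℕ → ℕ → ℕ
  skip zero    p       = suc p
  skip (suc i) zero    = zero
  skip (suc i) (suc p) = suc (skip i p)

  opaque
    unfolding ∑ ∏

    ∑-skip : ∀ n f i → i ℕ.< suc n → ∑ (suc n) f ≡ f i + ∑ n (f ∘ skip i)
    ∑-skip n       f zero    _         = refl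
    ∑-skip (suc n) f (suc i) (s≤s i<) = trans (cong (f 0 +_) (∑-skip n (f ∘ suc) i i<))
      (solve 3 (λ x y z → x :+ (y :+ z) := y :+ (x :+ z)) refl (f 0) (f (suc i)) _)

    ∏-skip : ∀ n f i → i ℕ.< suc n → ∏ (suc n) f ≡ f i * ∏ n (f ∘ skip i)
    ∏-skip n       f zero    _         = refl
    ∏-skip (suc n) f (suc i) (s≤s i<) = trans (cong (f 0 *_) (∏-skip n (f ∘ suc) i i<))
      (solve 3 (λ x y z → x :* (y :* z) := y :* (x :* z)) refl (f 0) (f (suc i)) _)

  -- Determinants: matrices are indexed by all of ℕ × ℕ, and det n reads the leading n × n block

  Mat : Set
  Mat = ℕ → ℕ → ℚ

  _≗₂_ : Mat → Mat → Set
  M ≗₂ N = ∀ i j → M i j ≡ N i j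

  minor : ℕ → Mat → Mat
  minor i M p q = M (skip i p) (suc q)

  opaque
    det : ℕ → Mat → ℚ
    det zero    M = 1ℚ
    det (suc n) M = ∑ (suc n) (λ i → sg i * M i 0 * det n (minor i M))

    det-empty : ∀ M → det 0 M ≡ 1ℚ
    det-empty M = refl

    det-col : ∀ n M → det (suc n) M ≡ ∑ (suc n) (λ i → sg i * M i 0 * det n (minor i M))
    det-col n M = refl

  det-cong : ∀ n {M N} → M ≗₂ N → det n M ≡ det n N
  det-cong zero    {M} {N} eq = trans (det-empty M) (sym (det-empty N))
  det-cong (suc n) {M} {N} eq = trans (det-col n M) (trans (∑-cong (suc n) λ i →
    cong₂ _*_ (cong (sg i *_) (eq i 0)) (det-cong n (λ p q → eq (skip i p) (suc q)))) (sym (det-col n N)))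

  -- Expanding along the first column and then along the first row gives an expression symmetric under transposition.
  private
    Transposable : ℕ → Set
    Transposable n = ∀ M → det n M ≡ det n (flip M)

    minor₂ : ℕ → ℕ → Mat → Mat
    minor₂ i j M p q = M (suc (skip i p)) (suc (skip j q))

    expand₂ : ℕ → Mat → ℚ
    expand₂ n M = M 0 0 * det (suc n) (minor 0 M) +
      ∑ (suc n) (λ i → ∑ (suc n) (λ j → - (sg i * sg j * M (suc i) 0 * M 0 (suc j)) * det n (minor₂ i j M)))

    det-expand₂ : ∀ n M → Transposable (suc n) → Transposable n → det (suc (suc n)) M ≡ expand₂ n M
    det-expand₂ n M tr₁ tr₀ = trans (det-col (suc n) M) (trans (∑-suc (suc n) _) (cong₂ _+_
      (cong (_* det (suc n) (minor 0 M)) (trans (cong (_* M 0 0) sg-zero) (*-identityˡ (M 0 0))))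
      (∑-cong (suc n) λ i → begin
        sg (suc i) * M (suc i) 0 * det (suc n) (minor (suc i) M)
          ≡⟨ cong₂ (λ u v → u * M (suc i) 0 * v) (sg-suc i) (trans (tr₁ (minor (suc i) M)) (det-col n _)) ⟩
        - sg i * M (suc i) 0 * ∑ (suc n) (λ j → sg j * M 0 (suc j) * det n (flip (minor₂ i j M)))
          ≡⟨ ∑-*ˡ (suc n) (- sg i * M (suc i) 0) _ ⟨
        ∑ (suc n) (λ j → (- sg i * M (suc i) 0) * (sg j * M 0 (suc j) * det n (flip (minor₂ i j M))))
          ≡⟨ ∑-cong (suc n) (λ j → trans
               (solve 5 (λ s x t y d → (:- s :* x) :* (t :* y :* d) := :- (s :* t :* x :* y) :* d) refl
                 (sg i) (M (suc i) 0) (sg j) (M 0 (suc j)) (det n (flip (minor₂ i j M))))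
               (cong (- (sg i * sg j * M (suc i) 0 * M 0 (suc j)) *_) (sym (tr₀ (minor₂ i j M))))) ⟩
        ∑ (suc n) (λ j → - (sg i * sg j * M (suc i) 0 * M 0 (suc j)) * det n (minor₂ i j M)) ∎)))
      where open ≡-Reasoning

  det-transpose : ∀ n M → det n M ≡ det n (flip M)
  det-transpose zero          M = trans (det-empty M) (sym (det-empty (flip M)))
  det-transpose (suc zero)    M = trans (lem M) (sym (lem (flip M)))
    where
    lem : ∀ N → det 1 N ≡ N 0 0
    lem N = begin
      det 1 N                                        ≡⟨ trans (det-col 0 N) (trans (∑-suc 0 _) (cong (sg 0 * N 0 0 * det 0 (minor 0 N) +_) (∑-empty _))) ⟩
      sg 0 * N 0 0 * det 0 (minor 0 N) + 0ℚ          ≡⟨ cong₂ (λ u v → u * N 0 0 * v + 0ℚ) sg-zero (det-empty (minor 0 N)) ⟩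
      1ℚ * N 0 0 * 1ℚ + 0ℚ                           ≡⟨ solve 1 (λ x → con 1ℚ :* x :* con 1ℚ :+ con 0ℚ := x) refl (N 0 0) ⟩
      N 0 0                                          ∎
      where open ≡-Reasoning
  det-transpose (suc (suc n)) M = begin
    det (suc (suc n)) M        ≡⟨ det-expand₂ n M (det-transpose (suc n)) (det-transpose n) ⟩
    expand₂ n M                ≡⟨ cong₂ _+_ (cong (M 0 0 *_) (det-transpose (suc n) (minor 0 M)))
         (trans (∑-swap (suc n) (suc n) (λ i j → - (sg i * sg j * M (suc i) 0 * M 0 (suc j)) * det n (minor₂ i j M)))
           (∑-cong (suc n) λ j → ∑-cong (suc n) λ i → cong₂ _*_
            (solve 4 (λ s x t y → :- (s :* t :* x :* y) := :- (t :* s :* y :* x)) refl (sg i) (M (suc i) 0) (sg j) (M 0 (suc j)))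
            (det-transpose n (minor₂ i j M)))) ⟩
    expand₂ n (flip M)         ≡⟨ det-expand₂ n (flip M) (det-transpose (suc n)) (det-transpose n) ⟨
    det (suc (suc n)) (flip M) ∎
    where open ≡-Reasoning

  rowMinor : ℕ → Mat → Mat
  rowMinor j M p q = M (suc p) (skip j q)

  det-row : ∀ n M → det (suc n) M ≡ ∑ (suc n) (λ j → sg j * M 0 j * det n (rowMinor j M))
  det-row n M = trans (det-transpose (suc n) M) (trans (det-col n (flip M))
    (∑-cong (suc n) λ j → cong (sg j * M 0 j *_) (sym (det-transpose n (rowMinor j M)))))

  private
    -- The first two terms of the expansion cancel, since their minors coincide and their signs are
    -- opposite. The later minors still begin with two equal rows, so their sum is left to the
    -- induction in `det-equal-rows₀`.
    det-equal-rows₀-step : ∀ n M → (∀ j → M 0 j ≡ M 1 j) →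
      ∑ n (λ i → sg (suc (suc i)) * M (suc (suc i)) 0 * det (suc n) (minor (suc (suc i)) M)) ≡ 0ℚ → det (suc (suc n)) M ≡ 0ℚ
    det-equal-rows₀-step n M eq rest≡0 = begin
      det (suc (suc n)) M
        ≡⟨ trans (det-col (suc n) M) (trans (∑-suc (suc n) _) (cong (sg 0 * M 0 0 * D (minor 0 M) +_) (trans (∑-suc n _)
             (cong (sg 1 * M 1 0 * D (minor 1 M) +_) rest≡0)))) ⟩
      sg 0 * M 0 0 * D (minor 0 M) + (sg 1 * M 1 0 * D (minor 1 M) + 0ℚ)
        ≡⟨ cong₂ (λ u v → u + (v * M 1 0 * D (minor 1 M) + 0ℚ))
             (cong₂ (λ u v → sg 0 * u * v) (eq 0) (det-cong (suc n) same)) (sg-suc 0) ⟩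
      sg 0 * M 1 0 * D (minor 1 M) + (- sg 0 * M 1 0 * D (minor 1 M) + 0ℚ)
        ≡⟨ solve 3 (λ s x d → s :* x :* d :+ (:- s :* x :* d :+ con 0ℚ) := con 0ℚ) refl (sg 0) (M 1 0) (D (minor 1 M)) ⟩
      0ℚ ∎
      where
      open ≡-Reasoning
      D = det (suc n)
      same : minor 0 M ≗₂ minor 1 M
      same zero    q = sym (eq (suc q))
      same (suc p) q = refl

    det-equal-rows₀ : ∀ n M → (∀ j → M 0 j ≡ M 1 j) → det (suc (suc n)) M ≡ 0ℚ
    det-equal-rows₀ zero    M eq = det-equal-rows₀-step zero M eq (∑-empty _)
    det-equal-rows₀ (suc n) M eq = det-equal-rows₀-step (suc n) M eq (∑-zero (suc n) _ λ i →
      trans (cong (sg (suc (suc i)) * M (suc (suc i)) 0 *_) (det-equal-rows₀ n (minor (suc (suc i)) M) (λ j → eq (suc j))))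
        (*-zeroʳ (sg (suc (suc i)) * M (suc (suc i)) 0)))

  -- Expanding along row 0 brings the pair to the top. Adjacent rows are enough both for the
  -- eliminations below and for the vanishing of illegal moves.
  det-equal-rows : ∀ n M r → suc r ℕ.< n → (∀ j → M r j ≡ M (suc r) j) → det n M ≡ 0ℚ
  det-equal-rows (suc (suc n)) M zero    _        eq = det-equal-rows₀ n M eq
  det-equal-rows (suc n) M (suc r) (s≤s r<) eq = trans (det-row n M) (∑-zero (suc n) _ λ j →
    trans (cong (sg j * M 0 j *_) (det-equal-rows n (rowMinor j M) r r< (λ q → eq (skip j q)))) (*-zeroʳ (sg j * M 0 j)))

  det-equal-cols : ∀ n M c → suc c ℕ.< n → (∀ i → M i c ≡ M i (suc c)) → det n M ≡ 0ℚ
  det-equal-cols n M c c< eq = trans (det-transpose n M) (det-equal-rows n (flip M) c c< eq)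

  det-scale : ∀ n (r s : ℕ → ℚ) M → det n (λ i j → r i * s j * M i j) ≡ ∏ n r * ∏ n s * det n M
  det-scale zero    r s M = begin
    det 0 (λ i j → r i * s j * M i j) ≡⟨ det-empty _ ⟩
    1ℚ * 1ℚ * 1ℚ ≡⟨ cong₂ _*_ (cong₂ _*_ (∏-empty r) (∏-empty s)) (det-empty M) ⟨
    ∏ 0 r * ∏ 0 s * det 0 M ∎
    where open ≡-Reasoning
  det-scale (suc n) r s M = trans (det-col n _) (trans (∑-cong< (suc n) λ i i< → begin
    sg i * (r i * s 0 * M i 0) * det n (λ p q → r (skip i p) * s (suc q) * M (skip i p) (suc q))
      ≡⟨ cong (sg i * (r i * s 0 * M i 0) *_) (det-scale n (r ∘ skip i) (s ∘ suc) (minor i M)) ⟩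
    sg i * (r i * s 0 * M i 0) * (∏ n (r ∘ skip i) * ∏ n (s ∘ suc) * det n (minor i M))
      ≡⟨ solve 7 (λ g r s m R S d → g :* (r :* s :* m) :* (R :* S :* d) := (r :* R) :* (s :* S) :* (g :* m :* d)) refl
           (sg i) (r i) (s 0) (M i 0) (∏ n (r ∘ skip i)) (∏ n (s ∘ suc)) (det n (minor i M)) ⟩
    (r i * ∏ n (r ∘ skip i)) * (s 0 * ∏ n (s ∘ suc)) * (sg i * M i 0 * det n (minor i M))
      ≡⟨ cong₂ (λ u v → u * v * (sg i * M i 0 * det n (minor i M))) (∏-skip n r i i<) (∏-head n s) ⟨
    ∏ (suc n) r * ∏ (suc n) s * (sg i * M i 0 * det n (minor i M)) ∎)
    (trans (∑-*ˡ (suc n) (∏ (suc n) r * ∏ (suc n) s) _) (cong (∏ (suc n) r * ∏ (suc n) s *_) (sym (det-col n M)))))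
    where open ≡-Reasoning

  setRow : ℕ → (ℕ → ℚ) → Mat → Mat
  setRow r v M i j = if i ≡ᵇ r then v j else M i j

  setCol : ℕ → (ℕ → ℚ) → Mat → Mat
  setCol c v M i j = if j ≡ᵇ c then v i else M i j

  det-setRow-linear : ∀ n M r q u v → r ℕ.< n →
    det n (setRow r (λ j → u j + q * v j) M) ≡ det n (setRow r u M) + q * det n (setRow r v M)
  det-setRow-linear (suc n) M zero q u v _ = begin
    det (suc n) (setRow 0 (λ j → u j + q * v j) M) ≡⟨ det-row n _ ⟩
    ∑ (suc n) (λ j → sg j * (u j + q * v j) * d j)
      ≡⟨ ∑-cong (suc n) (λ j → solve 5 (λ s u q v d → s :* (u :+ q :* v) :* d := s :* u :* d :+ q :* (s :* v :* d)) refl (sg j) (u j) q (v j) (d j)) ⟩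
    ∑ (suc n) (λ j → sg j * u j * d j + q * (sg j * v j * d j))
      ≡⟨ trans (∑-+ (suc n) _ _) (cong (∑ (suc n) (λ j → sg j * u j * d j) +_) (∑-*ˡ (suc n) q _)) ⟩
    ∑ (suc n) (λ j → sg j * u j * d j) + q * ∑ (suc n) (λ j → sg j * v j * d j)
      ≡⟨ cong₂ (λ s t → s + q * t) (det-row n (setRow 0 u M)) (det-row n (setRow 0 v M)) ⟨
    det (suc n) (setRow 0 u M) + q * det (suc n) (setRow 0 v M) ∎
    where
    open ≡-Reasoning
    d : ℕ → ℚ
    d j = det n (rowMinor j M)
  det-setRow-linear (suc n) M (suc r) q u v (s≤s r<) = begin
    det (suc n) (setRow (suc r) (λ j → u j + q * v j) M) ≡⟨ det-row n _ ⟩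
    ∑ (suc n) (λ j → sg j * M 0 j * d j (λ j → u j + q * v j))
      ≡⟨ ∑-cong (suc n) (λ j → trans
           (cong (sg j * M 0 j *_) (det-setRow-linear n (rowMinor j M) r q (u ∘ skip j) (v ∘ skip j) r<))
           (solve 4 (λ s u q v → s :* (u :+ q :* v) := s :* u :+ q :* (s :* v)) refl (sg j * M 0 j) (d j u) q (d j v))) ⟩
    ∑ (suc n) (λ j → sg j * M 0 j * d j u + q * (sg j * M 0 j * d j v))
      ≡⟨ trans (∑-+ (suc n) _ _) (cong (∑ (suc n) (λ j → sg j * M 0 j * d j u) +_) (∑-*ˡ (suc n) q _)) ⟩
    ∑ (suc n) (λ j → sg j * M 0 j * d j u) + q * ∑ (suc n) (λ j → sg j * M 0 j * d j v)
      ≡⟨ cong₂ (λ s t → s + q * t) (det-row n (setRow (suc r) u M)) (det-row n (setRow (suc r) v M)) ⟨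
    det (suc n) (setRow (suc r) u M) + q * det (suc n) (setRow (suc r) v M) ∎
    where
    open ≡-Reasoning
    d : ℕ → (ℕ → ℚ) → ℚ
    d j w = det n (setRow r (w ∘ skip j) (rowMinor j M))

  -- ∂ n M P is the derivative of det n at M in the direction P.
  opaque
    ∂ : ℕ → Mat → Mat → ℚ
    ∂ zero    M P = 0ℚ
    ∂ (suc n) M P = ∑ (suc n) (λ i → sg i * P i 0 * det n (minor i M) + sg i * M i 0 * ∂ n (minor i M) (minor i P))

    ∂-empty : ∀ M P → ∂ 0 M P ≡ 0ℚ
    ∂-empty M P = refl

    ∂-suc : ∀ n M P → ∂ (suc n) M P ≡ ∑ (suc n) (λ i → sg i * P i 0 * det n (minor i M) + sg i * M i 0 * ∂ n (minor i M) (minor i P))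
    ∂-suc n M P = refl

  -- Together with `∂-row` this reads one derivative either as column replacements or as row
  -- replacements, which is how moves of `y` and moves of `x` meet in a single identity.
  ∂-col : ∀ n M P → ∂ n M P ≡ ∑ n (λ c → det n (setCol c (λ i → P i c) M))
  ∂-col zero    M P = trans (∂-empty M P) (sym (∑-empty _))
  ∂-col (suc n) M P = begin
    ∂ (suc n) M P ≡⟨ ∂-suc n M P ⟩
    ∑ (suc n) (λ i → sg i * P i 0 * det n (minor i M) + sg i * M i 0 * ∂ n (minor i M) (minor i P))
      ≡⟨ ∑-+ (suc n) _ _ ⟩
    D₀ + ∑ (suc n) (λ i → sg i * M i 0 * ∂ n (minor i M) (minor i P))
      ≡⟨ cong (D₀ +_) (∑-cong (suc n) λ i → trans
           (cong (sg i * M i 0 *_) (∂-col n (minor i M) (minor i P)))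
           (sym (∑-*ˡ n (sg i * M i 0) _))) ⟩
    D₀ + ∑ (suc n) (λ i → ∑ n (λ c → sg i * M i 0 * det n (setCol c (λ p → P (skip i p) (suc c)) (minor i M))))
      ≡⟨ cong₂ _+_ (sym (det-col n (setCol 0 (λ i → P i 0) M)))
           (trans (∑-swap (suc n) n (λ i c → sg i * M i 0 * det n (setCol c (λ p → P (skip i p) (suc c)) (minor i M))))
           (∑-cong n (λ c → sym (det-col n (setCol (suc c) (λ i → P i (suc c)) M))))) ⟩
    det (suc n) (setCol 0 (λ i → P i 0) M) + ∑ n (λ c → det (suc n) (setCol (suc c) (λ i → P i (suc c)) M))
      ≡⟨ ∑-suc n _ ⟨
    ∑ (suc n) (λ c → det (suc n) (setCol c (λ i → P i c) M)) ∎
    where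
    open ≡-Reasoning
    D₀ = ∑ (suc n) (λ i → sg i * P i 0 * det n (minor i M))

  skip-≡ᵇ : ∀ i p r → (skip i p ≡ᵇ skip i r) ≡ (p ≡ᵇ r)
  skip-≡ᵇ zero    p       r       = refl
  skip-≡ᵇ (suc i) zero    zero    = refl
  skip-≡ᵇ (suc i) zero    (suc r) = refl
  skip-≡ᵇ (suc i) (suc p) zero    = refl
  skip-≡ᵇ (suc i) (suc p) (suc r) = skip-≡ᵇ i p r

  skip-≢ᵇ : ∀ i p → (skip i p ≡ᵇ i) ≡ false
  skip-≢ᵇ zero    p       = refl
  skip-≢ᵇ (suc i) zero    = refl
  skip-≢ᵇ (suc i) (suc p) = skip-≢ᵇ i p

  ≢ᵇ-skip : ∀ i p → (i ≡ᵇ skip i p) ≡ false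
  ≢ᵇ-skip zero    p       = refl
  ≢ᵇ-skip (suc i) zero    = refl
  ≢ᵇ-skip (suc i) (suc p) = ≢ᵇ-skip i p

  -- The definition expands along a column, so rows need a double sum: in the term with expansion
  -- row `i`, the replaced row is either `i` itself, which changes the entry, or `skip i r`, which
  -- changes row `r` of the minor.
  ∂-row : ∀ n M P → ∂ n M P ≡ ∑ n (λ r → det n (setRow r (P r) M))
  ∂-row zero    M P = trans (∂-empty M P) (sym (∑-empty _))
  ∂-row (suc n) M P = begin
    ∂ (suc n) M P ≡⟨ ∂-suc n M P ⟩
    ∑ (suc n) (λ i → sg i * P i 0 * det n (minor i M) + sg i * M i 0 * ∂ n (minor i M) (minor i P))
      ≡⟨ ∑-cong< (suc n) (λ i i< → begin
           sg i * P i 0 * det n (minor i M) + sg i * M i 0 * ∂ n (minor i M) (minor i P)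
             ≡⟨ cong₂ _+_ (diag i) (trans (cong (sg i * M i 0 *_) (∂-row n (minor i M) (minor i P)))
                  (trans (sym (∑-*ˡ n (sg i * M i 0) _)) (∑-cong n (off i)))) ⟩
           T i i + ∑ n (λ r → T i (skip i r))
             ≡⟨ ∑-skip n (T i) i i< ⟨
           ∑ (suc n) (T i) ∎) ⟩
    ∑ (suc n) (λ i → ∑ (suc n) (T i)) ≡⟨ trans (∑-swap (suc n) (suc n) T)
      (∑-cong (suc n) λ r → sym (det-col n (setRow r (P r) M))) ⟩
    ∑ (suc n) (λ r → det (suc n) (setRow r (P r) M)) ∎
    where
    open ≡-Reasoning
    T : ℕ → ℕ → ℚ
    T i r = sg i * setRow r (P r) M i 0 * det n (minor i (setRow r (P r) M))
    diag : ∀ i → sg i * P i 0 * det n (minor i M) ≡ T i i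
    diag i = cong₂ (λ u v → sg i * u * v)
      (cong (λ b → if b then P i 0 else M i 0) (sym (≡ᵇ-refl i)))
      (det-cong n λ p q → cong (λ b → if b then P i (suc q) else M (skip i p) (suc q)) (sym (skip-≢ᵇ i p)))
    off : ∀ i r → sg i * M i 0 * det n (setRow r (minor i P r) (minor i M)) ≡ T i (skip i r)
    off i r = cong₂ (λ u v → sg i * u * v)
      (cong (λ b → if b then P (skip i r) 0 else M i 0) (sym (≢ᵇ-skip i r)))
      (det-cong n λ p q → cong (λ b → if b then P (skip i r) (suc q) else M (skip i p) (suc q)) (sym (skip-≡ᵇ i p r)))

  ∂-cong : ∀ n M {P Q} → P ≗₂ Q → ∂ n M P ≡ ∂ n M Q
  ∂-cong zero    M {P} {Q} eq = trans (∂-empty M P) (sym (∂-empty M Q))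
  ∂-cong (suc n) M {P} {Q} eq = trans (∂-suc n M P) (trans (∑-cong (suc n) λ i →
    cong₂ (λ u v → sg i * u * det n (minor i M) + sg i * M i 0 * v)
    (eq i 0) (∂-cong n (minor i M) (λ p q → eq (skip i p) (suc q)))) (sym (∂-suc n M Q)))

  ∂-+ : ∀ n M P Q → ∂ n M (λ i j → P i j + Q i j) ≡ ∂ n M P + ∂ n M Q
  ∂-+ zero    M P Q = trans (∂-empty M _) (sym (cong₂ _+_ (∂-empty M P) (∂-empty M Q)))
  ∂-+ (suc n) M P Q = trans (∂-suc n M _) (trans (trans (∑-cong (suc n) λ i → trans
      (cong (λ u → sg i * (P i 0 + Q i 0) * det n (minor i M) + sg i * M i 0 * u) (∂-+ n (minor i M) (minor i P) (minor i Q)))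
      (solve 7 (λ s p q d m u v → s :* (p :+ q) :* d :+ s :* m :* (u :+ v) := (s :* p :* d :+ s :* m :* u) :+ (s :* q :* d :+ s :* m :* v)) refl
        (sg i) (P i 0) (Q i 0) (det n (minor i M)) (M i 0) (∂ n (minor i M) (minor i P)) (∂ n (minor i M) (minor i Q))))
    (∑-+ (suc n) _ _)) (sym (cong₂ _+_ (∂-suc n M P) (∂-suc n M Q))))

  ∂-zero : ∀ n M → ∂ n M (λ _ _ → 0ℚ) ≡ 0ℚ
  ∂-zero zero    M = ∂-empty M _
  ∂-zero (suc n) M = trans (∂-suc n M _) (∑-zero (suc n) _ λ i → trans
    (cong (λ u → sg i * 0ℚ * det n (minor i M) + sg i * M i 0 * u) (∂-zero n (minor i M)))
    (solve 3 (λ s d m → s :* con 0ℚ :* d :+ s :* m :* con 0ℚ := con 0ℚ) refl (sg i) (det n (minor i M)) (M i 0)))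

  -- Every Leibniz term of det n M is homogeneous of degree ∑ r + ∑ s for the grading deg M i j = r i + s j.
  ∂-euler : ∀ n (r s : ℕ → ℚ) M → ∂ n M (λ i j → (r i + s j) * M i j) ≡ (∑ n r + ∑ n s) * det n M
  ∂-euler zero    r s M = begin
    ∂ 0 M _                     ≡⟨ ∂-empty M _ ⟩
    (0ℚ + 0ℚ) * 1ℚ              ≡⟨ cong₂ _*_ (cong₂ _+_ (∑-empty r) (∑-empty s)) (det-empty M) ⟨
    (∑ 0 r + ∑ 0 s) * det 0 M   ∎
    where open ≡-Reasoning
  ∂-euler (suc n) r s M = trans (∂-suc n M _) (trans (∑-cong< (suc n) λ i i< → begin
    sg i * ((r i + s 0) * M i 0) * det n (minor i M) + sg i * M i 0 * ∂ n (minor i M) (λ p q → (r (skip i p) + s (suc q)) * minor i M p q)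
      ≡⟨ cong (λ u → sg i * ((r i + s 0) * M i 0) * det n (minor i M) + sg i * M i 0 * u) (∂-euler n (r ∘ skip i) (s ∘ suc) (minor i M)) ⟩
    sg i * ((r i + s 0) * M i 0) * det n (minor i M) + sg i * M i 0 * ((∑ n (r ∘ skip i) + ∑ n (s ∘ suc)) * det n (minor i M))
      ≡⟨ solve 7 (λ g r s m R S d → g :* ((r :+ s) :* m) :* d :+ g :* m :* ((R :+ S) :* d) := ((r :+ R) :+ (s :+ S)) :* (g :* m :* d)) refl
           (sg i) (r i) (s 0) (M i 0) (∑ n (r ∘ skip i)) (∑ n (s ∘ suc)) (det n (minor i M)) ⟩
    ((r i + ∑ n (r ∘ skip i)) + (s 0 + ∑ n (s ∘ suc))) * (sg i * M i 0 * det n (minor i M))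
      ≡⟨ cong₂ (λ u v → (u + v) * (sg i * M i 0 * det n (minor i M))) (∑-skip n r i i<) (∑-suc n s) ⟨
    (∑ (suc n) r + ∑ (suc n) s) * (sg i * M i 0 * det n (minor i M)) ∎)
    (trans (∑-*ˡ (suc n) (∑ (suc n) r + ∑ (suc n) s) _) (cong ((∑ (suc n) r + ∑ (suc n) s) *_) (sym (det-col n M)))))
    where open ≡-Reasoning

  skip-< : ∀ n i p → p ℕ.< n → skip i p ℕ.< suc n
  skip-< n       zero    p       p<       = s≤s p<
  skip-< (suc n) (suc i) zero    p<       = s≤s z≤n
  skip-< (suc n) (suc i) (suc p) (s≤s p<) = s≤s (skip-< n i p p<)

  skip-≢ : ∀ i p → skip i p ≢ i
  skip-≢ (suc i) (suc p) eq = skip-≢ i p (ℕ.suc-injective eq)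

  skip-surjective : ∀ n i p → p ≢ i → i ℕ.< suc n → p ℕ.< suc n → ∃ λ q → q ℕ.< n × skip i q ≡ p
  skip-surjective n       zero    zero    p≢i _ _ = ⊥-elim (p≢i refl)
  skip-surjective n       zero    (suc p) p≢i _ (s≤s p<) = p , p< , refl
  skip-surjective (suc n) (suc i) zero    p≢i _ _ = zero , s≤s z≤n , refl
  skip-surjective (suc n) (suc i) (suc p) p≢i (s≤s i<) (s≤s p<) with skip-surjective n i p (p≢i ∘ cong suc) i< p<
  ... | q , q< , eq = suc q , s≤s q< , cong suc eq
  skip-surjective zero    (suc i) p       p≢i (s≤s ()) _

  det-cong< : ∀ n {M N} → (∀ i j → i ℕ.< n → j ℕ.< n → M i j ≡ N i j) → det n M ≡ det n N
  det-cong< zero    {M} {N} eq = trans (det-empty M) (sym (det-empty N))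
  det-cong< (suc n) {M} {N} eq = trans (det-col n M) (trans (∑-cong< (suc n) λ i i< →
    cong₂ _*_ (cong (sg i *_) (eq i 0 i< (s≤s z≤n)))
      (det-cong< n (λ p q p< q< → eq (skip i p) (suc q) (skip-< n i p p<) (s≤s q<)))) (sym (det-col n N)))

  det-zero-col : ∀ n M c → c ℕ.< n → (∀ i → M i c ≡ 0ℚ) → det n M ≡ 0ℚ
  det-zero-col (suc n) M zero    _        eq = trans (det-col n M) (∑-zero (suc n) _ λ i →
    trans (cong (λ u → sg i * u * det n (minor i M)) (eq i))
      (solve 2 (λ s d → s :* con 0ℚ :* d := con 0ℚ) refl (sg i) (det n (minor i M))))
  det-zero-col (suc n) M (suc c) (s≤s c<) eq = trans (det-col n M) (∑-zero (suc n) _ λ i →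
    trans (cong (sg i * M i 0 *_) (det-zero-col n (minor i M) c c< (λ p → eq (skip i p)))) (*-zeroʳ (sg i * M i 0)))

  det-zero-row : ∀ n M r → r ℕ.< n → (∀ j → M r j ≡ 0ℚ) → det n M ≡ 0ℚ
  det-zero-row n M r r< eq = trans (det-transpose n M) (det-zero-col n (flip M) r r< eq)

  -- Subtracting multiples of neighbouring rows

  module _ {X : Set} where
    patch : ℕ → (ℕ → X) → (ℕ → X) → ℕ → X
    patch zero    g f i       = f i
    patch (suc k) g f zero    = g 0
    patch (suc k) g f (suc i) = patch k (g ∘ suc) (f ∘ suc) i

    patch-step : ∀ k g f i → patch k g f i ≡ (if i ≡ᵇ k then f k else patch (suc k) g f i)
    patch-step zero    g f zero    = refl
    patch-step zero    g f (suc i) = refl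
    patch-step (suc k) g f zero    = refl
    patch-step (suc k) g f (suc i) = patch-step k (g ∘ suc) (f ∘ suc) i

    patch-< : ∀ k g f i → i ℕ.< k → patch k g f i ≡ g i
    patch-< (suc k) g f zero    _        = refl
    patch-< (suc k) g f (suc i) (s≤s i<) = patch-< k (g ∘ suc) (f ∘ suc) i i<

  setRow-hit : ∀ r v M j → setRow r v M r j ≡ v j
  setRow-hit r v M j = cong (λ b → if b then v j else M r j) (≡ᵇ-refl r)

  setRow-self : ∀ r v M → (∀ j → v j ≡ M r j) → setRow r v M ≗₂ M
  setRow-self r v M eq i j = go i r (λ k → M k j) (eq j)
    where
    go : ∀ i r (f : ℕ → ℚ) → v j ≡ f r → (if i ≡ᵇ r then v j else f i) ≡ f i
    go zero    zero    f e = e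
    go zero    (suc r) f e = refl
    go (suc i) zero    f e = refl
    go (suc i) (suc r) f e = go i r (f ∘ suc) e

  n≢ᵇsuc : ∀ n → (n ≡ᵇ suc n) ≡ false
  n≢ᵇsuc zero    = refl
  n≢ᵇsuc (suc n) = n≢ᵇsuc n

  module _ (q : ℕ → ℚ) (M : Mat) where
    private
      diff : ℕ → ℕ → ℚ
      diff i j = M (suc i) j + - q i * M i j

      -- Working from the bottom up, row k is still unmodified when it is subtracted from row k + 1.
      partial : ℕ → Mat
      partial k zero    = M 0
      partial k (suc i) = patch k (M ∘ suc) diff i

      partial-row : ∀ k → partial (suc k) k ≡ M k
      partial-row zero    = refl
      partial-row (suc k) = patch-< (suc (suc k)) (M ∘ suc) diff k (ℕ.<-trans (ℕ.n<1+n k) (ℕ.n<1+n (suc k)))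

      partial-row′ : ∀ k → partial (suc k) (suc k) ≡ M (suc k)
      partial-row′ k = patch-< (suc k) (M ∘ suc) diff k (ℕ.n<1+n k)

      partial-step : ∀ k → partial k ≗₂ setRow (suc k) (diff k) (partial (suc k))
      partial-step k zero    j = refl
      partial-step k (suc i) j = trans (cong (λ f → f j) (patch-step k (M ∘ suc) diff i)) (push (i ≡ᵇ k))
        where
        push : ∀ b {f g : ℕ → ℚ} → (if b then f else g) j ≡ (if b then f j else g j)
        push true  = refl
        push false = refl

      det-partial : ∀ n k → suc k ℕ.< n → det n (partial k) ≡ det n (partial (suc k))
      det-partial n k k< = begin
        det n (partial k) ≡⟨ det-cong n (partial-step k) ⟩
        det n (setRow (suc k) (diff k) N)
          ≡⟨ det-setRow-linear n N (suc k) (- q k) (M (suc k)) (M k) k< ⟩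
        det n (setRow (suc k) (M (suc k)) N) + - q k * det n (setRow (suc k) (M k) N)
          ≡⟨ cong₂ (λ u v → u + - q k * v)
               (det-cong n (setRow-self (suc k) (M (suc k)) N λ j → cong (λ f → f j) (sym (partial-row′ k))))
               (det-equal-rows n _ k k< λ j → trans
                 (trans (cong (λ b → if b then M k j else N k j) (n≢ᵇsuc k)) (cong (λ f → f j) (partial-row k)))
                 (sym (setRow-hit (suc k) (M k) N j))) ⟩
        det n N + - q k * 0ℚ ≡⟨ solve 2 (λ x y → x :+ :- y :* con 0ℚ := x) refl (det n N) (q k) ⟩
        det n N ∎
        where
        open ≡-Reasoning
        N = partial (suc k)

      det-partials : ∀ n k → k ℕ.≤ n → det (suc n) (partial 0) ≡ det (suc n) (partial k)
      det-partials n zero    _  = refl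
      det-partials n (suc k) k≤ = trans (det-partials n k (ℕ.<⇒≤ k≤)) (det-partial (suc n) k (s≤s k≤))

      bidiagonal : Mat
      bidiagonal = partial 0

    -- The subtractions are undone one at a time, from `partial 0` to `partial n`. Each step is a
    -- row operation, and `partial n` agrees with `M` on the leading block.
    det-bidiagonal : ∀ n → det (suc n) M ≡ det (suc n) bidiagonal
    det-bidiagonal n = sym (trans (det-partials n n ℕ.≤-refl) (det-cong< (suc n) λ
      { zero    j _        _ → refl
      ; (suc i) j (s≤s i<) _ → cong (λ f → f j) (patch-< n (M ∘ suc) diff i i<) }))

    -- Subtracting q i times row i from row i + 1 clears column p except for its first entry.
    det-pivot : ∀ n p → p ℕ.< suc n → (∀ i → M (suc i) p ≡ q i * M i p) →
      det (suc n) M ≡ sg p * M 0 p * det n (λ i j → M (suc i) (skip p j) + - q i * M i (skip p j))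
    det-pivot n p p< eq = begin
      det (suc n) M ≡⟨ trans (det-bidiagonal n) (det-row n bidiagonal) ⟩
      ∑ (suc n) term ≡⟨ ∑-skip n term p p< ⟩
      term p + ∑ n (term ∘ skip p) ≡⟨ cong (term p +_) (trans (∑-cong< n vanish) (∑-zero n _ (λ _ → refl))) ⟩
      term p + 0ℚ ≡⟨ +-identityʳ (term p) ⟩
      term p ∎
      where
      open ≡-Reasoning
      term : ℕ → ℚ
      term j = sg j * M 0 j * det n (rowMinor j bidiagonal)
      vanish : ∀ j → j ℕ.< n → term (skip p j) ≡ 0ℚ
      -- Deleting column `skip p j` leaves column `p` in the minor, and below row 0 that column has
      -- been cleared.
      vanish j j< with skip-surjective n (skip p j) p (skip-≢ p j ∘ sym) (skip-< n p j j<) p<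
      ... | c , c< , c≡ = trans (cong (sg (skip p j) * M 0 (skip p j) *_)
        (det-zero-col n _ c c< λ i → trans (cong (diff i) c≡) (trans (cong (_+ - q i * M i p) (eq i))
          (solve 2 (λ x y → x :* y :+ :- x :* y := con 0ℚ) refl (q i) (M i p))))) (*-zeroʳ (sg (skip p j) * M 0 (skip p j)))

  -- Bordered Hankel determinants

  module _ {X : Set} where
    app : ℕ → (ℕ → X) → (ℕ → X) → ℕ → X
    app zero    f g i       = g i
    app (suc A) f g zero    = f 0
    app (suc A) f g (suc i) = app A (f ∘ suc) g i

    app-< : ∀ A f g i → i ℕ.< A → app A f g i ≡ f i
    app-< (suc A) f g zero    _        = refl
    app-< (suc A) f g (suc i) (s≤s i<) = app-< A (f ∘ suc) g i i<

    app-+ : ∀ A f g k → app A f g (A ℕ.+ k) ≡ g k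
    app-+ zero    f g k = refl
    app-+ (suc A) f g k = app-+ A (f ∘ suc) g k

    app-at : ∀ A f g → app A f g A ≡ g 0
    app-at zero    f g = refl
    app-at (suc A) f g = app-at A (f ∘ suc) g

    app-skip : ∀ A f g j → app A f g (skip A j) ≡ app A f (g ∘ suc) j
    app-skip zero    f g j       = refl
    app-skip (suc A) f g zero    = refl
    app-skip (suc A) f g (suc j) = app-skip A (f ∘ suc) g j

    app-cong : ∀ A {f f′ g g′ : ℕ → X} → (∀ i → f i ≡ f′ i) → (∀ i → g i ≡ g′ i) → ∀ i → app A f g i ≡ app A f′ g′ i
    app-cong zero    p q i       = q i
    app-cong (suc A) p q zero    = p 0
    app-cong (suc A) p q (suc i) = app-cong A (p ∘ suc) q i

  app-cong₂ : ∀ A {F F′ G G′ : ℕ → ℕ → ℚ} {j j′} → (∀ i → F i j ≡ F′ i j′) → (∀ i → G i j ≡ G′ i j′) →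
    ∀ i → app A F G i j ≡ app A F′ G′ i j′
  app-cong₂ zero    p q i       = q i
  app-cong₂ (suc A) p q zero    = p 0
  app-cong₂ (suc A) p q (suc i) = app-cong₂ A (p ∘ suc) q i

  app-eval : ∀ A (F G : ℕ → ℕ → ℚ) i j → app A F G i j ≡ app A (λ i → F i j) (λ i → G i j) i
  app-eval zero    F G i       j = refl
  app-eval (suc A) F G zero    j = refl
  app-eval (suc A) F G (suc i) j = app-eval A (F ∘ suc) G i j

  app-zip : ∀ {X Y Z : Set} (φ : X → Y → Z) A f g f′ g′ i →
    φ (app A f g i) (app A f′ g′ i) ≡ app A (λ i → φ (f i) (f′ i)) (λ i → φ (g i) (g′ i)) i
  app-zip φ zero    f g f′ g′ i       = refl
  app-zip φ (suc A) f g f′ g′ zero    = refl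
  app-zip φ (suc A) f g f′ g′ (suc i) = app-zip φ A (f ∘ suc) g (f′ ∘ suc) g′ i

  ∏-app : ∀ A b f g → ∏ (A ℕ.+ b) (app A f g) ≡ ∏ A f * ∏ b g
  ∏-app zero    b f g = sym (trans (cong (_* ∏ b g) (∏-empty f)) (*-identityˡ (∏ b g)))
  ∏-app (suc A) b f g = trans (∏-head (A ℕ.+ b) (app (suc A) f g)) (trans (cong (f 0 *_) (∏-app A b (f ∘ suc) g))
    (trans (sym (*-assoc (f 0) _ _)) (cong (_* ∏ b g) (sym (∏-head A f)))))

  ∑-app : ∀ A b f g → ∑ (A ℕ.+ b) (app A f g) ≡ ∑ A f + ∑ b g
  ∑-app zero    b f g = sym (trans (cong (_+ ∑ b g) (∑-empty f)) (+-identityˡ (∑ b g)))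
  ∑-app (suc A) b f g = trans (∑-suc (A ℕ.+ b) (app (suc A) f g)) (trans (cong (f 0 +_) (∑-app A b (f ∘ suc) g))
    (trans (sym (+-assoc (f 0) _ _)) (cong (_+ ∑ b g) (sym (∑-suc A f)))))

  -- The main block depends only on `i + j`, so row differences and column differences both act on
  -- it as `Δ`; one elimination step therefore serves both borders.
  bordered : ℕ → ℕ → (ℕ → ℚ) → (u v : ℕ → ℕ → ℚ) → Mat
  bordered A B H u v = app A (λ i → app B (λ j → H (i ℕ.+ j)) (λ k → u k i)) (λ k → app B (v k) (λ _ → 0ℚ))

  app-app-flip : ∀ A B (h u v : ℕ → ℕ → ℚ) z i j →
    app A (λ i → app B (h i) (λ k → u k i)) (λ k → app B (v k) (λ _ → z)) i j ≡
    app B (λ j → app A (λ i → h i j) (λ k → v k j)) (λ k → app A (u k) (λ _ → z)) j i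
  app-app-flip A zero    h u v z i j       = app-eval A _ _ i j
  app-app-flip A (suc B) h u v z i zero    = app-eval A _ _ i 0
  app-app-flip A (suc B) h u v z i (suc j) = trans
    (app-cong₂ A (λ _ → refl) (λ _ → refl) i) (app-app-flip A B (λ i → h i ∘ suc) u (λ k → v k ∘ suc) z i j)

  bordered-transpose : ∀ A B H u v → flip (bordered A B H u v) ≗₂ bordered B A H v u
  bordered-transpose A B H u v j i = trans (app-app-flip A B (λ i j → H (i ℕ.+ j)) u v 0ℚ i j)
    (app-cong₂ B (λ j → app-cong A (λ i → cong H (ℕ.+-comm i j)) (λ k → refl) i) (λ k → refl) j)

  Δ : (ℕ → ℚ) → ℕ → ℚ
  Δ f i = f (suc i) + - 1ℚ * f i

  Δ^ : ℕ → (ℕ → ℚ) → ℕ → ℚ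
  Δ^ zero    f = f
  Δ^ (suc k) f = Δ^ k (Δ f)

  Δ-cong : ∀ {f g} → (∀ n → f n ≡ g n) → ∀ n → Δ f n ≡ Δ g n
  Δ-cong eq n = cong₂ (λ u v → u + - 1ℚ * v) (eq (suc n)) (eq n)

  Δ^-cong : ∀ k {f g} → (∀ n → f n ≡ g n) → ∀ n → Δ^ k f n ≡ Δ^ k g n
  Δ^-cong zero    eq = eq
  Δ^-cong (suc k) eq = Δ^-cong k (Δ-cong eq)

  -- f is a polynomial sequence of degree at most k whose k-th difference is w.
  Poly : ℕ → ℚ → (ℕ → ℚ) → Set
  Poly k w f = ∀ i → Δ^ k f i ≡ w

  -- Column `B`, the first border column, is constantly `w` on the point rows and 0 on the border
  -- rows. Subtracting from each later point row its predecessor clears it below the top entry,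
  -- replaces `H` by `Δ H`, and differences the remaining border columns.
  det-bordered-step : ∀ n A B H u v w → B ℕ.≤ n → Poly 0 w (u 0) →
    det (suc n) (bordered (suc A) B H u v) ≡ sg B * w * det n (bordered A B (Δ H) (λ k → Δ (u (suc k))) v)
  det-bordered-step n A B H u v w B≤n u₀ = trans
    (det-pivot q (bordered (suc A) B H u v) n B (s≤s B≤n) ratio)
    (cong₂ (λ x y → sg B * x * y) (trans (app-at B _ _) (u₀ 0)) (det-cong n entries))
    where
    q : ℕ → ℚ
    q = app A (λ _ → 1ℚ) (λ _ → 0ℚ)
    row : ℕ → ℕ → ℚ
    row i = app B (λ j → H (i ℕ.+ j)) (λ k → u k i)
    ex : ℕ → ℕ → ℚ
    ex k = app B (v k) (λ _ → 0ℚ)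
    -- Below the point rows the multiplier is 0, so those rows are left alone.
    combine : ∀ A (row : ℕ → ℕ → ℚ) i j → app A (row ∘ suc) ex i j + - app A (λ _ → 1ℚ) (λ _ → 0ℚ) i * app (suc A) row ex i j
      ≡ app A (λ i j → row (suc i) j + - 1ℚ * row i j) ex i j
    combine zero    row i j = solve 2 (λ x y → x :+ :- con 0ℚ :* y := x) refl (ex i j) (app 1 row ex i j)
    combine (suc A) row zero    j = refl
    combine (suc A) row (suc i) j = combine A (row ∘ suc) i j
    ratio : ∀ i → bordered (suc A) B H u v (suc i) B ≡ q i * bordered (suc A) B H u v i B
    ratio i = go A row (λ i → trans (app-at B _ _) (u₀ i)) i
      where
      go : ∀ A row → (∀ i → row i B ≡ w) → ∀ i → app A (row ∘ suc) ex i B ≡ app A (λ _ → 1ℚ) (λ _ → 0ℚ) i * app (suc A) row ex i B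
      go zero    row e i = trans (app-at B (v i) _) (sym (*-zeroˡ (app 1 row ex i B)))
      go (suc A) row e zero = trans (e 1) (trans (sym (e 0)) (sym (*-identityˡ (row 0 B))))
      go (suc A) row e (suc i) = go A (row ∘ suc) (e ∘ suc) i
    entries : (λ i j → bordered (suc A) B H u v (suc i) (skip B j) + - q i * bordered (suc A) B H u v i (skip B j))
      ≗₂ bordered A B (Δ H) (λ k → Δ (u (suc k))) v
    entries i j = trans (combine A row i (skip B j)) (app-cong₂ A
      (λ i → trans (cong₂ (λ x y → x + - 1ℚ * y) (app-skip B _ _ j) (app-skip B _ _ j))
         (app-zip (λ x y → x + - 1ℚ * y) B _ _ _ _ j))
      (λ k → app-skip B _ _ j) i)

  -- Once the pivot column is deleted, the next border column sits at position `B` again, whence the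
  -- same sign each time. It is constant by then, because `Poly (suc k) w f` unfolds to
  -- `Poly k w (Δ f)`.
  det-bordered-cols : ∀ a c B H u v (w : ℕ → ℚ) → (∀ k → Poly k (w k) (u k)) →
    det (a ℕ.+ B) (bordered (a ℕ.+ c) B H u v) ≡
    ∏ a (λ k → sg B * w k) * det B (bordered c B (Δ^ a H) (λ _ _ → 0ℚ) v)
  det-bordered-cols zero c B H u v w poly = trans
    -- A determinant of size `B` reads only the first `B` columns, so the exhausted border may be
    -- replaced by zeros.
    (det-cong< B λ i j _ j< → app-cong₂ c (λ i → trans (app-< B _ _ j j<) (sym (app-< B _ _ j j<))) (λ _ → refl) i)
    (sym (trans (cong (_* det B (bordered c B H (λ _ _ → 0ℚ) v)) (∏-empty _)) (*-identityˡ _)))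
  det-bordered-cols (suc a) c B H u v w poly = begin
    det (suc (a ℕ.+ B)) (bordered (suc (a ℕ.+ c)) B H u v)
      ≡⟨ det-bordered-step (a ℕ.+ B) (a ℕ.+ c) B H u v (w 0) (ℕ.m≤n+m B a) (poly 0) ⟩
    sg B * w 0 * det (a ℕ.+ B) (bordered (a ℕ.+ c) B (Δ H) (λ k → Δ (u (suc k))) v)
      ≡⟨ cong (sg B * w 0 *_) (det-bordered-cols a c B (Δ H) (λ k → Δ (u (suc k))) v (w ∘ suc) (poly ∘ suc)) ⟩
    sg B * w 0 * (∏ a (λ k → sg B * w (suc k)) * D)
      ≡⟨ *-assoc (sg B * w 0) _ D ⟨
    sg B * w 0 * ∏ a (λ k → sg B * w (suc k)) * D
      ≡⟨ cong (_* D) (∏-head a (λ k → sg B * w k)) ⟨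
    ∏ (suc a) (λ k → sg B * w k) * D ∎
    where
    open ≡-Reasoning
    D = det B (bordered c B (Δ^ a (Δ H)) (λ _ _ → 0ℚ) v)

  -- The `a` column steps leave `c` point rows. After transposition the border rows become border
  -- columns behind `c` point columns, so the remaining `b` pivots have sign `sg c`.
  det-bordered : ∀ a b c H u v (w w′ : ℕ → ℚ) → (∀ k → Poly k (w k) (u k)) → (∀ k → Poly k (w′ k) (v k)) →
    det (a ℕ.+ (b ℕ.+ c)) (bordered (a ℕ.+ c) (b ℕ.+ c) H u v) ≡
    ∏ a (λ k → sg (b ℕ.+ c) * w k) * (∏ b (λ k → sg c * w′ k) * det c (λ i j → Δ^ b (Δ^ a H) (i ℕ.+ j)))
  det-bordered a b c H u v w w′ pu pv = trans (det-bordered-cols a c (b ℕ.+ c) H u v w pu)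
    (cong (∏ a (λ k → sg (b ℕ.+ c) * w k) *_) (begin
    det (b ℕ.+ c) (bordered c (b ℕ.+ c) (Δ^ a H) (λ _ _ → 0ℚ) v)
      ≡⟨ trans (det-transpose (b ℕ.+ c) _) (det-cong (b ℕ.+ c) (bordered-transpose c (b ℕ.+ c) (Δ^ a H) (λ _ _ → 0ℚ) v)) ⟩
    det (b ℕ.+ c) (bordered (b ℕ.+ c) c (Δ^ a H) v (λ _ _ → 0ℚ))
      ≡⟨ det-bordered-cols b c c (Δ^ a H) v (λ _ _ → 0ℚ) w′ pv ⟩
    ∏ b (λ k → sg c * w′ k) * det c (bordered c c (Δ^ b (Δ^ a H)) (λ _ _ → 0ℚ) (λ _ _ → 0ℚ))
      ≡⟨ cong (∏ b (λ k → sg c * w′ k) *_) (det-cong< c λ i j i< j< →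
           trans (cong (λ (f : ℕ → ℚ) → f j) (app-< c _ _ i i<)) (app-< c _ _ j j<)) ⟩
    ∏ b (λ k → sg c * w′ k) * det c (λ i j → Δ^ b (Δ^ a H) (i ℕ.+ j)) ∎))
    where open ≡-Reasoning

  -- Differences of polynomial sequences

  Δ^-+ : ∀ k f g n → Δ^ k (λ i → f i + g i) n ≡ Δ^ k f n + Δ^ k g n
  Δ^-+ zero    f g n = refl
  Δ^-+ (suc k) f g n = trans (Δ^-cong k (λ i → solve 4 (λ x y u v → (x :+ y) :+ :- con 1ℚ :* (u :+ v) := (x :+ :- con 1ℚ :* u) :+ (y :+ :- con 1ℚ :* v)) refl
    (f (suc i)) (g (suc i)) (f i) (g i)) n) (Δ^-+ k (Δ f) (Δ g) n)

  Δ^-* : ∀ k q f n → Δ^ k (λ i → q * f i) n ≡ q * Δ^ k f n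
  Δ^-* zero    q f n = refl
  Δ^-* (suc k) q f n = trans (Δ^-cong k (λ i → solve 3 (λ q x u → q :* x :+ :- con 1ℚ :* (q :* u) := q :* (x :+ :- con 1ℚ :* u)) refl
    q (f (suc i)) (f i)) n) (Δ^-* k q (Δ f) n)

  -- The discrete Leibniz rule: `Δ (f l)` at `i` is `Δ f i * l (suc i) + μ * f i`. The first summand
  -- contributes `k` copies of `w μ` by induction on the degree, the second one more.
  Poly-linear : ∀ k {w μ f} {l : ℕ → ℚ} → (∀ i → l (suc i) ≡ l i + μ) → Poly k w f → Poly (suc k) (w * (ι (suc k) * μ)) (λ i → f i * l i)
  Poly-linear zero {w} {μ} {f} {l} lin poly i = begin
    f (suc i) * l (suc i) + - 1ℚ * (f i * l i) ≡⟨ cong₂ (λ u v → u * l (suc i) + - 1ℚ * (v * l i)) (poly (suc i)) (poly i) ⟩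
    w * l (suc i) + - 1ℚ * (w * l i)           ≡⟨ cong (λ u → w * u + - 1ℚ * (w * l i)) (lin i) ⟩
    w * (l i + μ) + - 1ℚ * (w * l i)           ≡⟨ solve 3 (λ w l μ → w :* (l :+ μ) :+ :- con 1ℚ :* (w :* l) := w :* ((con 1ℚ :+ con 0ℚ) :* μ)) refl w (l i) μ ⟩
    w * ((1ℚ + 0ℚ) * μ)                        ≡⟨ cong (λ u → w * (u * μ)) (trans (ι-suc 0) (cong (1ℚ +_) ι-zero)) ⟨
    w * (ι 1 * μ)                              ∎
    where open ≡-Reasoning
  Poly-linear (suc k) {w} {μ} {f} {l} lin poly i = begin
    Δ^ (suc k) (Δ (λ i → f i * l i)) i
      ≡⟨ Δ^-cong (suc k) (λ i → trans (cong (λ u → f (suc i) * u + - 1ℚ * (f i * l i)) (lin i)) (trans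
           (solve 4 (λ g f l μ → g :* (l :+ μ) :+ :- con 1ℚ :* (f :* l) := (g :+ :- con 1ℚ :* f) :* (l :+ μ) :+ μ :* f) refl (f (suc i)) (f i) (l i) μ)
           (cong (λ u → Δ f i * u + μ * f i) (sym (lin i))))) i ⟩
    Δ^ (suc k) (λ i → Δ f i * l (suc i) + μ * f i) i ≡⟨ Δ^-+ (suc k) (λ i → Δ f i * l (suc i)) (λ i → μ * f i) i ⟩
    Δ^ (suc k) (λ i → Δ f i * l (suc i)) i + Δ^ (suc k) (λ i → μ * f i) i
      ≡⟨ cong₂ _+_ (Poly-linear k (lin ∘ suc) poly i) (trans (Δ^-* (suc k) μ f i) (cong (μ *_) (poly i))) ⟩
    w * (ι (suc k) * μ) + μ * w
      ≡⟨ solve 3 (λ w μ k → w :* (k :* μ) :+ μ :* w := w :* ((con 1ℚ :+ k) :* μ)) refl w μ (ι (suc k)) ⟩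
    w * ((1ℚ + ι (suc k)) * μ) ≡⟨ cong (λ u → w * (u * μ)) (ι-suc (suc k)) ⟨
    w * (ι (suc (suc k)) * μ) ∎
    where open ≡-Reasoning

  -- Taken over ℚ, without truncation: at a natural number below `k` one factor is 0, so
  -- `(x)_k / x!` is `1 / (x - k)!` or 0. In this form the border is polynomial once the factorials
  -- are scaled away.
  falling : ℕ → ℚ → ℚ
  falling zero    q = 1ℚ
  falling (suc k) q = falling k q * (q - ι k)

  Poly-falling : ∀ d M k → Poly k (ι (k ! ℕ.* M ^ k)) (λ i → falling k (ι (d ℕ.+ i ℕ.* M)))
  Poly-falling d M zero    i = sym (trans (ι-suc 0) (cong (1ℚ +_) ι-zero))
  Poly-falling d M (suc k) i = trans
    (Poly-linear k {μ = ι M} {f = λ i → falling k (ι (d ℕ.+ i ℕ.* M))} {l = λ i → ι (d ℕ.+ i ℕ.* M) - ι k} lin (Poly-falling d M k) i)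
    (trans (cong (ι (k ! ℕ.* M ^ k) *_) (sym (ι-* (suc k) M))) (trans (sym (ι-* _ (suc k ℕ.* M))) (cong ι (arith (k !) (M ^ k) (suc k) M))))
    where
    arith : ∀ p q r s → p ℕ.* q ℕ.* (r ℕ.* s) ≡ r ℕ.* p ℕ.* (s ℕ.* q)
    arith = ℕ-Solver.solve-∀
    lin : ∀ i → ι (d ℕ.+ suc i ℕ.* M) - ι k ≡ (ι (d ℕ.+ i ℕ.* M) - ι k) + ι M
    lin i = trans (cong (λ n → ι n - ι k) (trans (cong (d ℕ.+_) (ℕ.+-comm M (i ℕ.* M))) (sym (ℕ.+-assoc d (i ℕ.* M) M))))
      (trans (cong (_- ι k) (ι-+ (d ℕ.+ i ℕ.* M) M)) (solve 3 (λ x y z → (x :+ y) :- z := (x :- z) :+ y) refl (ι (d ℕ.+ i ℕ.* M)) (ι M) (ι k)))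

  -- `M` to the power `n (n - 1) / 2`, kept as a product so that it merges factor by factor with
  -- `Φ`.
  V : ℕ → ℕ → ℕ
  V M n = prod n (λ k → M ^ k)

  prod-head : ∀ n (f : ℕ → ℕ) → prod (suc n) f ≡ f 0 ℕ.* prod n (f ∘ suc)
  prod-head zero    f = trans (ℕ.*-identityˡ (f 0)) (sym (ℕ.*-identityʳ (f 0)))
  prod-head (suc n) f = trans (cong (ℕ._* f (suc n)) (prod-head n f)) (ℕ.*-assoc (f 0) _ _)

  ^-distribʳ-* : ∀ n j k → (j ℕ.* k) ^ n ≡ j ^ n ℕ.* k ^ n
  ^-distribʳ-* zero    j k = refl
  ^-distribʳ-* (suc n) j k = trans (cong (j ℕ.* k ℕ.*_) (^-distribʳ-* n j k)) (arith j k (j ^ n) (k ^ n))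
    where
    arith : ∀ j k u v → j ℕ.* k ℕ.* (u ℕ.* v) ≡ j ℕ.* u ℕ.* (k ℕ.* v)
    arith = ℕ-Solver.solve-∀

  prod-cong : ∀ n {f g : ℕ → ℕ} → (∀ i → f i ≡ g i) → prod n f ≡ prod n g
  prod-cong zero    eq = refl
  prod-cong (suc n) eq = cong₂ ℕ._*_ (prod-cong n eq) (eq n)

  ∏-const : ∀ n k → ∏ n (λ _ → ι k) ≡ ι (k ^ n)
  ∏-const zero    k = trans (∏-empty _) (sym (trans (ι-suc 0) (cong (1ℚ +_) ι-zero)))
  ∏-const (suc n) k = trans (∏-head n _) (trans (cong (ι k *_) (∏-const n k)) (sym (ι-* k (k ^ n))))

  ∏-ι : ∀ n f → ∏ n (ι ∘ f) ≡ ι (prod n f)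
  ∏-ι zero    f = trans (∏-empty _) (sym (trans (ι-suc 0) (cong (1ℚ +_) ι-zero)))
  ∏-ι (suc n) f = trans (∏-suc n _) (trans (cong (_* ι (f n)) (∏-ι n f)) (sym (ι-* (prod n f) (f n))))

  prod-suc≡! : ∀ n → prod n suc ≡ n !
  prod-suc≡! zero    = refl
  prod-suc≡! (suc n) = trans (cong (ℕ._* suc n) (prod-suc≡! n)) (ℕ.*-comm (n !) (suc n))

  -- Hankel determinants of reciprocal products of a progression

  module Hankel (T M : ℕ) where

    t : ℕ → ℕ
    t n = suc (T ℕ.+ n ℕ.* M)

    r : ℕ → ℚ
    r n = inv (t n)

    R : ℕ → ℕ → ℚ
    R s n = ∏ s (λ l → r (n ℕ.+ l))

    t-+ : ∀ m n → t (m ℕ.+ n) ≡ t m ℕ.+ n ℕ.* M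
    t-+ = λ m n → cong suc (trans (cong (T ℕ.+_) (ℕ.*-distribʳ-+ M m n)) (sym (ℕ.+-assoc T (m ℕ.* M) (n ℕ.* M))))

    τ-+ : ∀ m n → ι (t (m ℕ.+ n)) ≡ ι (t m) + ι n * ι M
    τ-+ m n = trans (cong ι (t-+ m n)) (trans (ι-+ (t m) (n ℕ.* M)) (cong (ι (t m) +_) (ι-* n M)))

    R-head : ∀ s n → R (suc s) n ≡ r n * R s (suc n)
    R-head s n = trans (∏-head s _) (cong₂ _*_ (cong r (ℕ.+-identityʳ n)) (∏-cong s λ l → cong r (ℕ.+-suc n l)))

    τ-R-head : ∀ s n → ι (t n) * R (suc s) n ≡ R s (suc n)
    τ-R-head s n = trans (cong (ι (t n) *_) (R-head s n)) (trans (sym (*-assoc (ι (t n)) (r n) (R s (suc n))))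
      (trans (cong (_* R s (suc n)) (ι*inv (t n))) (*-identityˡ (R s (suc n)))))

    τ-R-last : ∀ s n → ι (t (n ℕ.+ s)) * R (suc s) n ≡ R s n
    τ-R-last s n = trans (cong (ι (t (n ℕ.+ s)) *_) (∏-suc s _))
      (trans (solve 3 (λ x y z → x :* (y :* z) := (x :* z) :* y) refl (ι (t (n ℕ.+ s))) (R s n) (r (n ℕ.+ s)))
      (trans (cong (_* R s n) (ι*inv (t (n ℕ.+ s)))) (*-identityˡ (R s n))))

    κ : ℕ → ℚ
    κ zero    = 1ℚ
    κ (suc s) = - (ι (suc s) * ι M * κ s)

    -- The `s`-th difference of `r`: up to constants, reciprocals of products of consecutive terms
    -- of a progression are closed under differences.
    K : ℕ → ℕ → ℚ
    K s n = κ s * R (suc s) n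

    -- Over the common denominator of `R (suc (suc s)) n` the numerators are `t n` and
    -- `t (n + suc s)`, which differ by `(s + 1) M`.
    Δ-K : ∀ s n → Δ (K s) n ≡ K (suc s) n
    Δ-K s n = begin
      κ s * R (suc s) (suc n) + - 1ℚ * (κ s * R (suc s) n)
        ≡⟨ cong₂ (λ u v → κ s * u + - 1ℚ * (κ s * v)) (τ-R-head (suc s) n) (τ-R-last (suc s) n) ⟨
      κ s * (ι (t n) * ρ) + - 1ℚ * (κ s * (ι (t (n ℕ.+ suc s)) * ρ))
        ≡⟨ cong (λ u → κ s * (ι (t n) * ρ) + - 1ℚ * (κ s * (u * ρ))) (τ-+ n (suc s)) ⟩
      κ s * (ι (t n) * ρ) + - 1ℚ * (κ s * ((ι (t n) + ι (suc s) * ι M) * ρ))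
        ≡⟨ solve 5 (λ k x y z w → k :* (x :* w) :+ :- con 1ℚ :* (k :* ((x :+ y :* z) :* w)) := :- (y :* z :* k) :* w) refl
             (κ s) (ι (t n)) (ι (suc s)) (ι M) ρ ⟩
      - (ι (suc s) * ι M * κ s) * ρ ∎
      where
      open ≡-Reasoning
      ρ = R (suc (suc s)) n

    Δ^-K : ∀ k s n → Δ^ k (K s) n ≡ K (k ℕ.+ s) n
    Δ^-K zero    s n = refl
    Δ^-K (suc k) s n = trans (Δ^-cong k (Δ-K s) n) (trans (Δ^-K k (suc s) n) (cong (λ u → K u n) (ℕ.+-suc k s)))

    E : ℕ → ℕ → ℕ → ℚ
    E c s o = det c (λ i j → R (suc s) (o ℕ.+ (i ℕ.+ j)))

    -- Clearing the first column leaves at `(i , j)` a row factor times a column factor times an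
    -- entry of the same kind, so the smaller determinant is an `E` with longer products and a
    -- shifted origin.
    E-step : ∀ c s o → E (suc c) s o ≡
      R (suc s) o * (∏ c (λ i → ι (suc s) * ι M * r (o ℕ.+ i ℕ.+ suc s)) * ∏ c (λ j → ι (suc j) * ι M) * E c (suc s) (suc o))
    E-step c s o = begin
      E (suc c) s o
        ≡⟨ det-pivot q (λ i j → R (suc s) (o ℕ.+ (i ℕ.+ j))) c 0 (s≤s z≤n) ratio ⟩
      sg 0 * R (suc s) (o ℕ.+ 0) * det c (λ i j → R (suc s) (o ℕ.+ (suc i ℕ.+ suc j)) + - q i * R (suc s) (o ℕ.+ (i ℕ.+ suc j)))
        ≡⟨ cong₂ _*_ (trans (cong₂ (λ u v → u * R (suc s) v) sg-zero (ℕ.+-identityʳ o)) (*-identityˡ (R (suc s) o)))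
             (trans (det-cong c entry) (det-scale c _ _ _)) ⟩
      R (suc s) o * (∏ c (λ i → ι (suc s) * ι M * r (o ℕ.+ i ℕ.+ suc s)) * ∏ c (λ j → ι (suc j) * ι M) * E c (suc s) (suc o)) ∎
      where
      open ≡-Reasoning
      q : ℕ → ℚ
      -- The ratio of consecutive entries of the first column: the product loses `t (o + i)` at one
      -- end and gains `t (o + i + suc s)` at the other.
      q i = ι (t (o ℕ.+ i)) * r (o ℕ.+ i ℕ.+ suc s)
      qU : ∀ i → q i * ι (t (o ℕ.+ i ℕ.+ suc s)) ≡ ι (t (o ℕ.+ i))
      qU i = trans (solve 3 (λ x y z → x :* y :* z := x :* (z :* y)) refl (ι (t (o ℕ.+ i))) (r (o ℕ.+ i ℕ.+ suc s)) (ι (t (o ℕ.+ i ℕ.+ suc s))))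
        (trans (cong (ι (t (o ℕ.+ i)) *_) (ι*inv (t (o ℕ.+ i ℕ.+ suc s)))) (*-identityʳ _))
      ratio : ∀ i → R (suc s) (o ℕ.+ (suc i ℕ.+ 0)) ≡ q i * R (suc s) (o ℕ.+ (i ℕ.+ 0))
      ratio i = begin
        R (suc s) (o ℕ.+ (suc i ℕ.+ 0)) ≡⟨ cong (R (suc s)) (trans (cong (o ℕ.+_) (ℕ.+-identityʳ (suc i))) (ℕ.+-suc o i)) ⟩
        R (suc s) (suc (o ℕ.+ i))       ≡⟨ τ-R-head (suc s) (o ℕ.+ i) ⟨
        ι (t (o ℕ.+ i)) * ρ             ≡⟨ cong (_* ρ) (qU i) ⟨
        q i * U * ρ                     ≡⟨ *-assoc (q i) U ρ ⟩
        q i * (U * ρ)                   ≡⟨ cong (q i *_) (τ-R-last (suc s) (o ℕ.+ i)) ⟩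
        q i * R (suc s) (o ℕ.+ i)       ≡⟨ cong (λ u → q i * R (suc s) (o ℕ.+ u)) (ℕ.+-identityʳ i) ⟨
        q i * R (suc s) (o ℕ.+ (i ℕ.+ 0)) ∎
        where
        ρ = R (suc (suc s)) (o ℕ.+ i)
        U = ι (t (o ℕ.+ i ℕ.+ suc s))
      entry : (λ i j → R (suc s) (o ℕ.+ (suc i ℕ.+ suc j)) + - q i * R (suc s) (o ℕ.+ (i ℕ.+ suc j)))
        ≗₂ (λ i j → ι (suc s) * ι M * r (o ℕ.+ i ℕ.+ suc s) * (ι (suc j) * ι M) * R (suc (suc s)) (suc o ℕ.+ (i ℕ.+ j)))
      entry i j = begin
        R (suc s) (o ℕ.+ (suc i ℕ.+ suc j)) + - q i * R (suc s) (o ℕ.+ (i ℕ.+ suc j))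
          ≡⟨ cong (λ u → R (suc s) u + - q i * R (suc s) n) (ℕ.+-suc o (i ℕ.+ suc j)) ⟩
        R (suc s) (suc n) + - q i * R (suc s) n
          ≡⟨ cong₂ (λ u v → u + - q i * v) (τ-R-head (suc s) n) (τ-R-last (suc s) n) ⟨
        ι (t n) * R (suc (suc s)) n + - q i * (ι (t (n ℕ.+ suc s)) * R (suc (suc s)) n)
          ≡⟨ cong₂ (λ u v → u * R (suc (suc s)) n + - q i * (v * R (suc (suc s)) n)) (trans (cong (ι ∘ t) n≡) (τ-+ (o ℕ.+ i) (suc j)))
               (trans (cong (ι ∘ t) n+≡) (τ-+ (o ℕ.+ i ℕ.+ suc s) (suc j))) ⟩
        (P + J * m) * ρ + - (P * x) * ((U + J * m) * ρ)
          ≡⟨ cong (λ u → (P + J * m) * ρ + - (P * x) * ((u + J * m) * ρ)) (τ-+ (o ℕ.+ i) (suc s)) ⟩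
        (P + J * m) * ρ + - (P * x) * (((P + S * m) + J * m) * ρ)
          ≡⟨ solve 6 (λ P J m x S ρ → (P :+ J :* m) :* ρ :+ :- (P :* x) :* (((P :+ S :* m) :+ J :* m) :* ρ) :=
                        (P :+ J :* m) :* (con 1ℚ :- (P :+ S :* m) :* x) :* ρ :+ S :* m :* x :* (J :* m) :* ρ) refl P J m x S ρ ⟩
        -- The solver cannot know that `x` inverts `U = P + S * m`, so the expression is arranged
        -- around the factor `1 - U * x`, which then vanishes.
        (P + J * m) * (1ℚ - (P + S * m) * x) * ρ + S * m * x * (J * m) * ρ
          ≡⟨ cong (λ u → (P + J * m) * (1ℚ - u) * ρ + S * m * x * (J * m) * ρ)
               (trans (cong (_* x) (sym (τ-+ (o ℕ.+ i) (suc s)))) (ι*inv (t (o ℕ.+ i ℕ.+ suc s)))) ⟩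
        (P + J * m) * (1ℚ - 1ℚ) * ρ + S * m * x * (J * m) * ρ
          ≡⟨ solve 3 (λ x ρ y → x :* (con 1ℚ :- con 1ℚ) :* ρ :+ y := y) refl (P + J * m) ρ (S * m * x * (J * m) * ρ) ⟩
        S * m * x * (J * m) * ρ
          ≡⟨ cong (λ u → S * m * x * (J * m) * R (suc (suc s)) u) (trans (cong (o ℕ.+_) (ℕ.+-suc i j)) (ℕ.+-suc o (i ℕ.+ j))) ⟩
        S * m * x * (J * m) * R (suc (suc s)) (suc o ℕ.+ (i ℕ.+ j)) ∎
        where
        n = o ℕ.+ (i ℕ.+ suc j)
        P = ι (t (o ℕ.+ i))
        U = ι (t (o ℕ.+ i ℕ.+ suc s))
        x = r (o ℕ.+ i ℕ.+ suc s)
        J = ι (suc j)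
        S = ι (suc s)
        m = ι M
        ρ = R (suc (suc s)) n
        n≡ : n ≡ (o ℕ.+ i) ℕ.+ suc j
        n≡ = sym (ℕ.+-assoc o i (suc j))
        n+≡ : n ℕ.+ suc s ≡ (o ℕ.+ i ℕ.+ suc s) ℕ.+ suc j
        n+≡ = arith o i (suc j) (suc s)
          where
          arith : ∀ o i j s → o ℕ.+ (i ℕ.+ j) ℕ.+ s ≡ o ℕ.+ i ℕ.+ s ℕ.+ j
          arith = ℕ-Solver.solve-∀

    -- The pivot of `E-step` and the reciprocals in its row factors join into one product of length
    -- `suc s + c`.
    R-split : ∀ s c o → R (suc s ℕ.+ c) o ≡ R (suc s) o * ∏ c (λ i → r (o ℕ.+ i ℕ.+ suc s))
    R-split s zero o = trans (cong (λ u → R u o) (ℕ.+-identityʳ (suc s))) (sym (trans (cong (R (suc s) o *_) (∏-empty _)) (*-identityʳ _)))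
    R-split s (suc c) o = trans (cong (λ u → R u o) (ℕ.+-suc (suc s) c)) (trans (∏-suc (suc s ℕ.+ c) _)
      (trans (cong₂ _*_ (R-split s c o) (cong r (arith o s c))) (trans (*-assoc (R (suc s) o) _ _) (cong (R (suc s) o *_) (sym (∏-suc c _))))))
      where
      arith : ∀ o s c → o ℕ.+ (suc s ℕ.+ c) ≡ o ℕ.+ c ℕ.+ suc s
      arith = ℕ-Solver.solve-∀

    -- The steps contribute `(s + 1)^(c - 1) (s + 2)^(c - 2) ...`, which is the product of
    -- `(s + k)! / s!` over `k < c`. Multiplying by `(s !) ^ c` keeps the coefficient a natural
    -- number, and `hankel` has exactly this factor to spare.
    E-closed : ∀ c s o → ι ((s !) ^ c) * E c s o ≡
      ι (prod c (λ k → (s ℕ.+ k) !) ℕ.* Φ c ℕ.* (V M c ℕ.* V M c)) * ∏ c (λ k → R (s ℕ.+ c) (o ℕ.+ k))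
    E-closed zero s o = cong (ι 1 *_) (trans (det-empty _) (sym (∏-empty _)))
    E-closed (suc c) s o = begin
      ι (F ℕ.* F ^ c) * E (suc c) s o
        ≡⟨ cong₂ _*_ (ι-* F (F ^ c)) (trans (E-step c s o) (cong (R (suc s) o *_) (cong₂ (λ u v → u * v * E′)
             (trans (∏-* c _ _) (cong (_* X) (trans (∏-cong c (λ _ → sym (ι-* (suc s) M))) (∏-const c (suc s ℕ.* M)))))
             (trans (∏-* c _ _) (cong₂ _*_ (trans (∏-ι c suc) (cong ι (prod-suc≡! c))) (∏-const c M)))))) ⟩
      ι F * ι (F ^ c) * (R (suc s) o * (ι ((suc s ℕ.* M) ^ c) * X * (ι (c !) * ι (M ^ c)) * E′))
        ≡⟨ solve 8 (λ f g R y X z w e → f :* g :* (R :* (y :* X :* (z :* w) :* e)) := f :* z :* w :* (g :* y) :* e :* (R :* X)) refl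
             (ι F) (ι (F ^ c)) (R (suc s) o) (ι ((suc s ℕ.* M) ^ c)) X (ι (c !)) (ι (M ^ c)) E′ ⟩
      ι F * ι (c !) * ι (M ^ c) * (ι (F ^ c) * ι ((suc s ℕ.* M) ^ c)) * E′ * (R (suc s) o * X)
        ≡⟨ cong₂ (λ u v → ι F * ι (c !) * ι (M ^ c) * u * E′ * v)
             (trans (sym (ι-* (F ^ c) _)) (trans (cong ι powers) (ι-* (((suc s) !) ^ c) (M ^ c)))) (sym (R-split s c o)) ⟩
      ι F * ι (c !) * ι (M ^ c) * (ι (((suc s) !) ^ c) * ι (M ^ c)) * E′ * R (suc s ℕ.+ c) o
        ≡⟨ solve 6 (λ f z w g e R → f :* z :* w :* (g :* w) :* e :* R := f :* z :* w :* w :* (g :* e) :* R) refl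
             (ι F) (ι (c !)) (ι (M ^ c)) (ι (((suc s) !) ^ c)) E′ (R (suc s ℕ.+ c) o) ⟩
      ι F * ι (c !) * ι (M ^ c) * ι (M ^ c) * (ι (((suc s) !) ^ c) * E′) * R (suc s ℕ.+ c) o
        ≡⟨ cong (λ u → ι F * ι (c !) * ι (M ^ c) * ι (M ^ c) * u * R (suc s ℕ.+ c) o) (E-closed c (suc s) (suc o)) ⟩
      ι F * ι (c !) * ι (M ^ c) * ι (M ^ c) * (ι N * Y) * R (suc s ℕ.+ c) o
        ≡⟨ solve 6 (λ f z w n Y R → f :* z :* w :* w :* (n :* Y) :* R := (f :* z :* w :* w :* n) :* (R :* Y)) refl
             (ι F) (ι (c !)) (ι (M ^ c)) (ι N) Y (R (suc s ℕ.+ c) o) ⟩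
      (ι F * ι (c !) * ι (M ^ c) * ι (M ^ c) * ι N) * (R (suc s ℕ.+ c) o * Y)
        ≡⟨ cong₂ _*_ coefficient (sym product) ⟩
      ι (prod (suc c) (λ k → (s ℕ.+ k) !) ℕ.* Φ (suc c) ℕ.* (V M (suc c) ℕ.* V M (suc c))) * ∏ (suc c) (λ k → R (s ℕ.+ suc c) (o ℕ.+ k)) ∎
      where
      open ≡-Reasoning
      F = s !
      E′ = E c (suc s) (suc o)
      X = ∏ c (λ i → r (o ℕ.+ i ℕ.+ suc s))
      N = prod c (λ k → (suc s ℕ.+ k) !) ℕ.* Φ c ℕ.* (V M c ℕ.* V M c)
      Y = ∏ c (λ k → R (suc s ℕ.+ c) (suc o ℕ.+ k))
      powers : F ^ c ℕ.* (suc s ℕ.* M) ^ c ≡ ((suc s) !) ^ c ℕ.* M ^ c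
      powers = trans (sym (^-distribʳ-* c F (suc s ℕ.* M))) (trans
        (cong (_^ c) (trans (sym (ℕ.*-assoc F (suc s) M)) (cong (ℕ._* M) (ℕ.*-comm F (suc s)))))
        (^-distribʳ-* c ((suc s) !) M))
      coefficient : ι F * ι (c !) * ι (M ^ c) * ι (M ^ c) * ι N ≡
        ι (prod (suc c) (λ k → (s ℕ.+ k) !) ℕ.* Φ (suc c) ℕ.* (V M (suc c) ℕ.* V M (suc c)))
      coefficient = trans (sym (trans (ι-* _ N) (cong (_* ι N) (trans (ι-* _ (M ^ c)) (cong (_* ι (M ^ c))
          (trans (ι-* _ (M ^ c)) (cong (_* ι (M ^ c)) (ι-* F (c !)))))))))
        (cong ι (trans (arith F (c !) (M ^ c) _ (Φ c) (V M c)) (cong (λ u → u ℕ.* Φ (suc c) ℕ.* (V M (suc c) ℕ.* V M (suc c)))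
          (sym (trans (prod-head c _) (cong₂ ℕ._*_ (cong _! (ℕ.+-identityʳ s)) (prod-cong c (λ k → cong _! (ℕ.+-suc s k)))))))))
        where
        arith : ∀ f z w p φ v → f ℕ.* z ℕ.* w ℕ.* w ℕ.* (p ℕ.* φ ℕ.* (v ℕ.* v)) ≡ f ℕ.* p ℕ.* (φ ℕ.* z) ℕ.* (v ℕ.* w ℕ.* (v ℕ.* w))
        arith = ℕ-Solver.solve-∀
      product : ∏ (suc c) (λ k → R (s ℕ.+ suc c) (o ℕ.+ k)) ≡ R (suc s ℕ.+ c) o * Y
      product = trans (∏-head c _) (cong₂ _*_ (cong₂ R (ℕ.+-suc s c) (ℕ.+-identityʳ o))
        (∏-cong c λ k → cong₂ R (ℕ.+-suc s c) (ℕ.+-suc o k)))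

  -- The skew Giambelli matrix

  ι-one : ι 1 ≡ 1ℚ
  ι-one = trans (ι-suc 0) (cong (1ℚ +_) ι-zero)

  invFact : ℕ → ℚ
  invFact n = inv (n !)

  ι!*invFact : ∀ n → ι (n !) * invFact n ≡ 1ℚ
  ι!*invFact n = ι*inv (n !) {{n ℕ.!≢0}}

  invFact-zero : invFact 0 ≡ 1ℚ
  invFact-zero = trans (sym (*-identityˡ (invFact 0))) (trans (cong (_* invFact 0) (sym ι-one)) (ι!*invFact 0))

  invFact-suc : ∀ n → invFact n ≡ ι (suc n) * invFact (suc n)
  invFact-suc n = inv-unique (n !) {{n ℕ.!≢0}} _ (trans (sym (*-assoc (ι (n !)) (ι (suc n)) (invFact (suc n))))
    (trans (cong (_* invFact (suc n)) (trans (*-comm (ι (n !)) (ι (suc n))) (sym (ι-* (suc n) (n !))))) (ι!*invFact (suc n))))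

  falling-pred : ∀ k x → ι (suc x) * falling k (ι x) ≡ (ι (suc x) - ι k) * falling k (ι (suc x))
  falling-pred zero    x = cong (_* 1ℚ) (sym (trans (cong (λ u → ι (suc x) - u) ι-zero) (solve 1 (λ x → x :- con 0ℚ := x) refl (ι (suc x)))))
  falling-pred (suc k) x = begin
    ι (suc x) * (f * (ι x - ι k))      ≡⟨ *-assoc (ι (suc x)) f (ι x - ι k) ⟨
    ι (suc x) * f * (ι x - ι k)        ≡⟨ cong (_* (ι x - ι k)) (falling-pred k x) ⟩
    (ι (suc x) - ι k) * F * (ι x - ι k)
      ≡⟨ cong (λ u → (ι (suc x) - ι k) * F * u) (trans (solve 2 (λ x k → x :- k := (con 1ℚ :+ x) :- (con 1ℚ :+ k)) refl (ι x) (ι k))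
           (sym (cong₂ _-_ (ι-suc x) (ι-suc k)))) ⟩
    (ι (suc x) - ι k) * F * (ι (suc x) - ι (suc k))
      ≡⟨ solve 3 (λ u f v → u :* f :* v := v :* (f :* u)) refl (ι (suc x) - ι k) F (ι (suc x) - ι (suc k)) ⟩
    (ι (suc x) - ι (suc k)) * (F * (ι (suc x) - ι k)) ∎
    where
    open ≡-Reasoning
    f = falling k (ι x)
    F = falling k (ι (suc x))

  falling-zero : ∀ k → - ι k * falling k (ι 0) ≡ 0ℚ
  falling-zero zero    = cong (λ u → - u * 1ℚ) ι-zero
  falling-zero (suc k) = trans (cong (- ι (suc k) *_) (trans (solve 3 (λ f x k → f :* (x :- k) := f :* x :+ :- k :* f) refl (falling k (ι 0)) (ι 0) (ι k))
    (cong₂ _+_ (trans (cong (falling k (ι 0) *_) ι-zero) (*-zeroʳ (falling k (ι 0)))) (falling-zero k)))) (*-zeroʳ (- ι (suc k)))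

  -- Rows and columns are labelled pt x for a part x of the strict sequence, and ex k for the k-th border row or column.
  data Label : Set where
    pt ex : ℕ → Label

  -- Tableau counts divided by the factorial of the size: a hook with arm `x` and leg `y` in the
  -- main block, a row of `x - k` or a column of `y - k` cells in the borders (0 if that length is
  -- negative).
  entry : Label → Label → ℚ
  entry (pt x) (pt y) = invFact x * invFact y * inv (suc (x ℕ.+ y))
  entry (pt x) (ex k) = invFact x * falling k (ι x)
  entry (ex k) (pt y) = invFact y * falling k (ι y)
  entry (ex _) (ex _) = 0ℚ

  entry-sym : ∀ l l′ → entry l l′ ≡ entry l′ l
  entry-sym (pt x) (pt y) = cong₂ _*_ (*-comm (invFact x) (invFact y)) (cong (inv ∘ suc) (ℕ.+-comm x y))
  entry-sym (pt x) (ex k) = refl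
  entry-sym (ex k) (pt y) = refl
  entry-sym (ex _) (ex _) = refl

  -- Removal of a cell on the side of the first label: an arm or leg of length 0 allows no such
  -- removal, and border labels never move.
  lower : Label → Label → ℚ
  lower (pt zero)    l = 0ℚ
  lower (pt (suc x)) l = entry (pt x) l
  lower (ex k)       l = 0ℚ

  -- The single-cell hook loses its only cell; the value 1 belongs to the empty shape.
  corner : Label → Label → ℚ
  corner (pt zero)    (pt zero)    = 1ℚ
  corner (pt zero)    (pt (suc y)) = 0ℚ
  corner (pt (suc x)) l            = 0ℚ
  corner (pt zero)    (ex k)       = 0ℚ
  corner (ex k)       l            = 0ℚ

  -- The size of each entry, split into a row part and a column part. The corner cell of a hook is
  -- charged to the row, which explains the different offsets `- ι k` and `- ι (suc k)` of the two
  -- borders.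
  rowDeg colDeg : Label → ℚ
  rowDeg (pt x) = ι (suc x)
  rowDeg (ex k) = - ι k
  colDeg (pt y) = ι y
  colDeg (ex k) = - ι (suc k)

  private
    -- This is `1 / (x - 1 - k)! = (x - k) / (x - k)!`. At `x = 0` both sides vanish: either
    -- `k = 0`, or the falling factorial contains the factor 0.
    lower-ex : ∀ x k → lower (pt x) (ex k) ≡ (ι x - ι k) * (invFact x * falling k (ι x))
    lower-ex zero    k = sym (begin
      (ι 0 - ι k) * (invFact 0 * falling k (ι 0)) ≡⟨ cong (λ u → (u - ι k) * (invFact 0 * falling k (ι 0))) ι-zero ⟩
      (0ℚ - ι k) * (invFact 0 * falling k (ι 0))  ≡⟨ solve 3 (λ k f g → (con 0ℚ :- k) :* (f :* g) := f :* (:- k :* g)) refl (ι k) (invFact 0) (falling k (ι 0)) ⟩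
      invFact 0 * (- ι k * falling k (ι 0))       ≡⟨ cong (invFact 0 *_) (falling-zero k) ⟩
      invFact 0 * 0ℚ                         ≡⟨ *-zeroʳ (invFact 0) ⟩
      0ℚ                                ∎)
      where open ≡-Reasoning
    lower-ex (suc x) k = begin
      invFact x * falling k (ι x)                              ≡⟨ cong (_* falling k (ι x)) (invFact-suc x) ⟩
      ι (suc x) * invFact (suc x) * falling k (ι x)            ≡⟨ solve 3 (λ x f g → x :* f :* g := f :* (x :* g)) refl (ι (suc x)) (invFact (suc x)) (falling k (ι x)) ⟩
      invFact (suc x) * (ι (suc x) * falling k (ι x))          ≡⟨ cong (invFact (suc x) *_) (falling-pred k x) ⟩
      invFact (suc x) * ((ι (suc x) - ι k) * falling k (ι (suc x)))
        ≡⟨ solve 3 (λ f u g → f :* (u :* g) := u :* (f :* g)) refl (invFact (suc x)) (ι (suc x) - ι k) (falling k (ι (suc x))) ⟩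
      (ι (suc x) - ι k) * (invFact (suc x) * falling k (ι (suc x))) ∎
      where open ≡-Reasoning

    deg*inv : ∀ x y → (ι (suc x) + ι y) * (invFact x * invFact y * inv (suc (x ℕ.+ y))) ≡ invFact x * invFact y
    deg*inv x y = begin
      (ι (suc x) + ι y) * (invFact x * invFact y * i)   ≡⟨ cong (_* (invFact x * invFact y * i)) (sym (ι-+ (suc x) y)) ⟩
      ι (suc x ℕ.+ y) * (invFact x * invFact y * i)     ≡⟨ solve 3 (λ n f i → n :* (f :* i) := f :* (n :* i)) refl (ι (suc x ℕ.+ y)) (invFact x * invFact y) i ⟩
      invFact x * invFact y * (ι (suc x ℕ.+ y) * i)     ≡⟨ cong (invFact x * invFact y *_) (ι*inv (suc (x ℕ.+ y))) ⟩
      invFact x * invFact y * 1ℚ                        ≡⟨ *-identityʳ (invFact x * invFact y) ⟩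
      invFact x * invFact y                             ∎
      where
      open ≡-Reasoning
      i = inv (suc (x ℕ.+ y))

    lower-pt₀ : ∀ y → invFact 0 * invFact y * inv (suc (0 ℕ.+ y)) ≡ invFact 0 * invFact (suc y)
    lower-pt₀ y = begin
      invFact 0 * invFact y * inv (suc y)                           ≡⟨ cong (λ u → invFact 0 * u * inv (suc y)) (invFact-suc y) ⟩
      invFact 0 * (ι (suc y) * invFact (suc y)) * inv (suc y)
        ≡⟨ solve 4 (λ f n g i → f :* (n :* g) :* i := f :* g :* (n :* i)) refl (invFact 0) (ι (suc y)) (invFact (suc y)) (inv (suc y)) ⟩
      invFact 0 * invFact (suc y) * (ι (suc y) * inv (suc y))       ≡⟨ cong (invFact 0 * invFact (suc y) *_) (ι*inv (suc y)) ⟩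
      invFact 0 * invFact (suc y) * 1ℚ                              ≡⟨ *-identityʳ _ ⟩
      invFact 0 * invFact (suc y)                                   ∎
      where open ≡-Reasoning

    -- For positive `x` and `y` the two lowered hooks share the reciprocal of `x + y`, and
    -- `x / (x + y) + y / (x + y) = 1`. If exactly one of them is 0, a single removal survives; if
    -- both are, the corner term takes over.
    lower-pt : ∀ x y → lower (pt x) (pt y) + lower (pt y) (pt x) + corner (pt x) (pt y) ≡ invFact x * invFact y
    lower-pt zero    zero    = sym (cong₂ _*_ invFact-zero invFact-zero)
    lower-pt zero    (suc y) = trans (solve 1 (λ u → con 0ℚ :+ u :+ con 0ℚ := u) refl (entry (pt y) (pt 0)))
      (trans (entry-sym (pt y) (pt 0)) (lower-pt₀ y))
    lower-pt (suc x) zero    = trans (solve 1 (λ u → u :+ con 0ℚ :+ con 0ℚ := u) refl (entry (pt x) (pt 0)))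
      (trans (entry-sym (pt x) (pt 0)) (trans (lower-pt₀ x) (*-comm (invFact 0) (invFact (suc x)))))
    lower-pt (suc x) (suc y) = begin
      invFact x * invFact (suc y) * inv (suc (x ℕ.+ suc y)) + invFact y * invFact (suc x) * inv (suc (y ℕ.+ suc x)) + 0ℚ
        ≡⟨ cong₂ (λ u v → invFact x * invFact (suc y) * inv u + invFact y * invFact (suc x) * inv v + 0ℚ)
             (cong suc (ℕ.+-comm x (suc y))) (cong suc (trans (ℕ.+-comm y (suc x)) (trans (cong suc (ℕ.+-comm x y)) refl))) ⟩
      invFact x * invFact (suc y) * i + invFact y * invFact (suc x) * i + 0ℚ
        ≡⟨ cong₂ (λ u v → u * invFact (suc y) * i + v * invFact (suc x) * i + 0ℚ) (invFact-suc x) (invFact-suc y) ⟩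
      ι (suc x) * invFact (suc x) * invFact (suc y) * i + ι (suc y) * invFact (suc y) * invFact (suc x) * i + 0ℚ
        ≡⟨ solve 5 (λ n m f g i → n :* f :* g :* i :+ m :* g :* f :* i :+ con 0ℚ := f :* g :* ((m :+ n) :* i)) refl
             (ι (suc x)) (ι (suc y)) (invFact (suc x)) (invFact (suc y)) i ⟩
      invFact (suc x) * invFact (suc y) * ((ι (suc y) + ι (suc x)) * i)
        ≡⟨ cong (λ u → invFact (suc x) * invFact (suc y) * (u * i)) (trans (sym (ι-+ (suc y) (suc x))) (cong (ι ∘ suc) (ℕ.+-suc y x))) ⟩
      invFact (suc x) * invFact (suc y) * (ι (suc (suc (y ℕ.+ x))) * i)
        ≡⟨ cong (invFact (suc x) * invFact (suc y) *_) (ι*inv (suc (suc (y ℕ.+ x)))) ⟩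
      invFact (suc x) * invFact (suc y) * 1ℚ ≡⟨ *-identityʳ _ ⟩
      invFact (suc x) * invFact (suc y) ∎
      where
      open ≡-Reasoning
      i = inv (suc (suc (y ℕ.+ x)))

  corner-ex : ∀ l k → corner l (ex k) ≡ 0ℚ
  corner-ex (pt zero)    k = refl
  corner-ex (pt (suc x)) k = refl
  corner-ex (ex _)       k = refl

  -- The last entry of a tableau on a hook ends the arm, ends the leg, or fills the only cell.
  -- Through `∂` this entrywise identity becomes the recurrence of the whole determinant.
  entry-rec : ∀ l l′ → (lower l l′ + lower l′ l) + corner l l′ ≡ (rowDeg l + colDeg l′) * entry l l′
  entry-rec (pt x) (pt y) = trans (lower-pt x y) (sym (deg*inv x y))
  entry-rec (pt x) (ex k) = begin
    (lower (pt x) (ex k) + 0ℚ) + corner (pt x) (ex k) ≡⟨ cong ((lower (pt x) (ex k) + 0ℚ) +_) (corner-ex (pt x) k) ⟩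
    (lower (pt x) (ex k) + 0ℚ) + 0ℚ                   ≡⟨ solve 1 (λ u → (u :+ con 0ℚ) :+ con 0ℚ := u) refl (lower (pt x) (ex k)) ⟩
    lower (pt x) (ex k)                               ≡⟨ lower-ex x k ⟩
    (ι x - ι k) * (invFact x * falling k (ι x))
      ≡⟨ cong (_* (invFact x * falling k (ι x))) (trans (solve 2 (λ x k → x :- k := (con 1ℚ :+ x) :+ :- (con 1ℚ :+ k)) refl (ι x) (ι k))
           (sym (cong₂ (λ u v → u + - v) (ι-suc x) (ι-suc k)))) ⟩
    (ι (suc x) + - ι (suc k)) * (invFact x * falling k (ι x)) ∎
    where open ≡-Reasoning
  entry-rec (ex k) (pt y) = begin
    (0ℚ + lower (pt y) (ex k)) + 0ℚ    ≡⟨ solve 1 (λ u → (con 0ℚ :+ u) :+ con 0ℚ := u) refl (lower (pt y) (ex k)) ⟩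
    lower (pt y) (ex k)                ≡⟨ lower-ex y k ⟩
    (ι y - ι k) * (invFact y * falling k (ι y))  ≡⟨ cong (_* (invFact y * falling k (ι y))) (+-comm (ι y) (- ι k)) ⟩
    (- ι k + ι y) * (invFact y * falling k (ι y)) ∎
    where open ≡-Reasoning
  entry-rec (ex k) (ex l) = sym (*-zeroʳ (- ι k + - ι (suc l)))

  -- The removal recurrence for the determinant

  label : ℕ → (ℕ → ℕ) → ℕ → Label
  label A x = app A (pt ∘ x) ex

  giambelli : ℕ → ℕ → (x y : ℕ → ℕ) → Mat
  giambelli A B x y i j = entry (label A x i) (label B y j)

  giambelli-transpose : ∀ A B x y → flip (giambelli A B x y) ≗₂ giambelli B A y x
  giambelli-transpose A B x y i j = entry-sym (label A x j) (label B y i)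

  isPos : ℕ → ℚ
  isPos zero    = 0ℚ
  isPos (suc _) = 1ℚ

  app-update : ∀ {X : Set} A (f g : ℕ → X) p v → p ℕ.< A → ∀ i →
    app A (λ n → if n ≡ᵇ p then v else f n) g i ≡ (if i ≡ᵇ p then v else app A f g i)
  app-update (suc A) f g zero    v _        zero    = refl
  app-update (suc A) f g zero    v _        (suc i) = app-cong A (λ _ → refl) (λ _ → refl) i
  app-update (suc A) f g (suc p) v _        zero    = refl
  app-update (suc A) f g (suc p) v (s≤s p<) (suc i) = app-update A (f ∘ suc) g p v p< i

  label-dec : ∀ A x p → p ℕ.< A → ∀ i → label A (dec p x) i ≡ (if i ≡ᵇ p then pt (x p ℕ.∸ 1) else label A x i)
  label-dec A x p p< i = trans (app-cong A (λ n → push (n ≡ᵇ p)) (λ _ → refl) i) (app-update A (pt ∘ x) ex p (pt (x p ℕ.∸ 1)) p< i)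
    where
    push : ∀ b {u v} → pt (if b then u else v) ≡ (if b then pt u else pt v)
    push true  = refl
    push false = refl

  -- Lowering row `p` alone gives the matrix of `dec p x`, or a zero row when `x p` is 0. A border
  -- row is replaced by zeros and contributes nothing.
  lower-rows : ∀ N A b B x y → N ≡ A ℕ.+ b →
    ∂ N (giambelli A B x y) (λ i j → lower (label A x i) (label B y j)) ≡ ∑ A (λ p → isPos (x p) * det N (giambelli A B (dec p x) y))
  lower-rows N A b B x y refl = begin
    ∂ N M P                                     ≡⟨ ∂-row N M P ⟩
    ∑ N (λ r → det N (setRow r (P r) M))        ≡⟨ ∑-cong< N rows ⟩
    ∑ (A ℕ.+ b) (app A term (λ _ → 0ℚ))         ≡⟨ ∑-app A b term (λ _ → 0ℚ) ⟩
    ∑ A term + ∑ b (λ _ → 0ℚ)                   ≡⟨ cong (∑ A term +_) (∑-zero b _ (λ _ → refl)) ⟩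
    ∑ A term + 0ℚ                               ≡⟨ +-identityʳ (∑ A term) ⟩
    ∑ A term                                    ∎
    where
    open ≡-Reasoning
    M P : Mat
    M = giambelli A B x y
    P i j = lower (label A x i) (label B y j)
    term : ℕ → ℚ
    term p = isPos (x p) * det N (giambelli A B (dec p x) y)
    push : ∀ b {u v l} → entry (if b then u else v) l ≡ (if b then entry u l else entry v l)
    push true  = refl
    push false = refl
    point : ∀ r → r ℕ.< A → ∀ k → x r ≡ k → det N (setRow r (λ j → lower (pt k) (label B y j)) M) ≡ isPos k * det N (giambelli A B (dec r x) y)
    point r r< zero    e = trans (det-zero-row N _ r (ℕ.≤-trans r< (ℕ.m≤m+n A b)) (λ j → setRow-hit r (λ _ → 0ℚ) M j)) (sym (*-zeroˡ (det N (giambelli A B (dec r x) y))))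
    point r r< (suc k) e = trans (det-cong N λ i j → sym (trans (cong (λ l → entry l (label B y j))
        (trans (label-dec A x r r< i) (cong (λ u → if i ≡ᵇ r then pt (u ℕ.∸ 1) else label A x i) e))) (push (i ≡ᵇ r)))) (sym (*-identityˡ _))
    rows : ∀ r → r ℕ.< N → det N (setRow r (P r) M) ≡ app A term (λ _ → 0ℚ) r
    rows r r<N with r ℕ.<? A
    ... | yes r< = trans (cong (λ l → det N (setRow r (λ j → lower l (label B y j)) M)) (app-< A _ _ r r<))
                     (trans (point r r< (x r) refl) (sym (app-< A term _ r r<)))
    ... | no r≮ = subst (λ u → u ℕ.< N → det N (setRow u (P u) M) ≡ app A term (λ _ → 0ℚ) u) (ℕ.m+[n∸m]≡n (ℕ.≮⇒≥ r≮)) extra r<N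
      where
      k = r ℕ.∸ A
      extra : A ℕ.+ k ℕ.< N → det N (setRow (A ℕ.+ k) (P (A ℕ.+ k)) M) ≡ app A term (λ _ → 0ℚ) (A ℕ.+ k)
      extra k< = trans (det-zero-row N _ (A ℕ.+ k) k< (λ j → trans (setRow-hit (A ℕ.+ k) (P (A ℕ.+ k)) M j)
        (cong (λ l → lower l (label B y j)) (app-+ A (pt ∘ x) ex k)))) (sym (app-+ A term (λ _ → 0ℚ) k))

  ∂-transpose : ∀ n M P → ∂ n M P ≡ ∂ n (flip M) (flip P)
  ∂-transpose n M P = trans (∂-col n M P) (trans (∑-cong n (λ c → det-transpose n _)) (sym (∂-row n (flip M) (flip P))))

  ∂-cong-mat : ∀ n {M N} P → M ≗₂ N → ∂ n M P ≡ ∂ n N P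
  ∂-cong-mat n {M} {N} P eq = trans (∂-row n M P) (trans (∑-cong n λ r → det-cong n λ i j → cong (λ u → if i ≡ᵇ r then P r j else u) (eq i j)) (sym (∂-row n N P)))

  lower-cols : ∀ N A B a x y → N ≡ B ℕ.+ a →
    ∂ N (giambelli A B x y) (λ i j → lower (label B y j) (label A x i)) ≡ ∑ B (λ p → isPos (y p) * det N (giambelli A B x (dec p y)))
  lower-cols N A B a x y eq = trans (∂-transpose N _ _) (trans (∂-cong-mat N _ (giambelli-transpose A B x y))
    (trans (lower-rows N B a A y x eq) (∑-cong B λ p → cong (isPos (y p) *_)
      (trans (det-cong N (λ i j → sym (giambelli-transpose A B x (dec p y) i j))) (sym (det-transpose N (giambelli A B x (dec p y))))))))

  -- `∂` is linear in its direction, so `entry-rec` splits it into row moves, column moves and the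
  -- corner, while `∂-euler` evaluates the total. The two equations for `N` express the same size
  -- through rows and through columns.
  giambelli-rec : ∀ N A B a b x y → N ≡ A ℕ.+ b → N ≡ B ℕ.+ a →
    ∑ A (λ p → isPos (x p) * det N (giambelli A B (dec p x) y)) +
    ∑ B (λ p → isPos (y p) * det N (giambelli A B x (dec p y))) +
    ∂ N (giambelli A B x y) (λ i j → corner (label A x i) (label B y j)) ≡
    (∑ N (rowDeg ∘ label A x) + ∑ N (colDeg ∘ label B y)) * det N (giambelli A B x y)
  giambelli-rec N A B a b x y eA eB = begin
    _ ≡⟨ cong₂ (λ u v → u + v + ∂ N M C) (lower-rows N A b B x y eA) (lower-cols N A B a x y eB) ⟨
    ∂ N M P + ∂ N M Q + ∂ N M C ≡⟨ cong (_+ ∂ N M C) (∂-+ N M P Q) ⟨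
    ∂ N M (λ i j → P i j + Q i j) + ∂ N M C ≡⟨ ∂-+ N M _ C ⟨
    ∂ N M (λ i j → (P i j + Q i j) + C i j) ≡⟨ ∂-cong N M (λ i j → entry-rec (label A x i) (label B y j)) ⟩
    ∂ N M (λ i j → (rowDeg (label A x i) + colDeg (label B y j)) * M i j) ≡⟨ ∂-euler N (rowDeg ∘ label A x) (colDeg ∘ label B y) M ⟩
    (∑ N (rowDeg ∘ label A x) + ∑ N (colDeg ∘ label B y)) * det N M ∎
    where
    open ≡-Reasoning
    M P Q C : Mat
    M = giambelli A B x y
    P i j = lower (label A x i) (label B y j)
    Q i j = lower (label B y j) (label A x i)
    C i j = corner (label A x i) (label B y j)

  ∂-corner : ∀ n M C → (∀ i j → C (suc i) j ≡ 0ℚ) → (∀ i j → C i (suc j) ≡ 0ℚ) → ∂ (suc n) M C ≡ C 0 0 * det n (minor 0 M)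
  ∂-corner n M C r₀ c₀ = begin
    ∂ (suc n) M C ≡⟨ trans (∂-suc n M C) (∑-suc n _) ⟩
    sg 0 * C 0 0 * det n (minor 0 M) + sg 0 * M 0 0 * ∂ n (minor 0 M) (minor 0 C) + ∑ n rest
      ≡⟨ cong₂ _+_ (cong₂ (λ s u → s * C 0 0 * det n (minor 0 M) + s * M 0 0 * u) sg-zero (vanish 0)) (∑-zero n rest rest≡0) ⟩
    1ℚ * C 0 0 * det n (minor 0 M) + 1ℚ * M 0 0 * 0ℚ + 0ℚ
      ≡⟨ solve 3 (λ c d m → con 1ℚ :* c :* d :+ con 1ℚ :* m :* con 0ℚ :+ con 0ℚ := c :* d) refl (C 0 0) (det n (minor 0 M)) (M 0 0) ⟩
    C 0 0 * det n (minor 0 M) ∎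
    where
    open ≡-Reasoning
    vanish : ∀ i → ∂ n (minor i M) (minor i C) ≡ 0ℚ
    vanish i = trans (∂-cong n (minor i M) (λ p q → c₀ (skip i p) q)) (∂-zero n (minor i M))
    rest : ℕ → ℚ
    rest i = sg (suc i) * C (suc i) 0 * det n (minor (suc i) M) + sg (suc i) * M (suc i) 0 * ∂ n (minor (suc i) M) (minor (suc i) C)
    rest≡0 : ∀ i → rest i ≡ 0ℚ
    rest≡0 i = trans (cong₂ (λ u v → sg (suc i) * u * det n (minor (suc i) M) + sg (suc i) * M (suc i) 0 * v) (r₀ i 0) (vanish (suc i)))
      (solve 3 (λ s d m → s :* con 0ℚ :* d :+ s :* m :* con 0ℚ := con 0ℚ) refl (sg (suc i)) (det n (minor (suc i) M)) (M (suc i) 0))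

  skip-≥ : ∀ i p → p ℕ.≤ skip i p
  skip-≥ zero    p       = ℕ.n≤1+n p
  skip-≥ (suc i) zero    = z≤n
  skip-≥ (suc i) (suc p) = s≤s (skip-≥ i p)

  -- The easy half of the Frobenius-König theorem: a zero block of `n - A` rows and `n - B` columns
  -- meets every permutation when the two numbers add up to more than `n`.
  det-zero-block : ∀ n A B M → A ℕ.+ B ℕ.< n → (∀ i j → A ℕ.≤ i → B ℕ.≤ j → M i j ≡ 0ℚ) → det n M ≡ 0ℚ
  det-zero-block n       A zero    M lt z = det-zero-row n M A (subst (ℕ._< n) (ℕ.+-identityʳ A) lt) (λ j → z A j ℕ.≤-refl z≤n)
  det-zero-block (suc n) A (suc B) M lt z = trans (det-col n M) (∑-zero (suc n) _ λ i → trans (cong (sg i * M i 0 *_)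
    (det-zero-block n A B (minor i M) (ℕ.≤-pred (subst (ℕ._< suc n) (ℕ.+-suc A B) lt))
      (λ p q A≤p B≤q → z (skip i p) (suc q) (ℕ.≤-trans A≤p (skip-≥ i p)) (s≤s B≤q)))) (*-zeroʳ (sg i * M i 0)))

  corner-pos : ∀ A x → (∀ n → 0 ℕ.< x n) → ∀ i l → corner (label A x i) l ≡ 0ℚ
  corner-pos zero    x pos i       l = refl
  corner-pos (suc A) x pos zero    l with x 0 | pos 0
  ... | suc _ | _ = refl
  corner-pos (suc A) x pos (suc i) l = corner-pos A (x ∘ suc) (pos ∘ suc) i l

  corner-sym : ∀ l l′ → corner l l′ ≡ corner l′ l
  corner-sym (pt zero)    (pt zero)    = refl
  corner-sym (pt zero)    (pt (suc y)) = refl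
  corner-sym (pt (suc x)) (pt zero)    = refl
  corner-sym (pt (suc x)) (pt (suc y)) = refl
  corner-sym (pt zero)    (ex k)       = refl
  corner-sym (pt (suc x)) (ex k)       = refl
  corner-sym (ex k)       (pt zero)    = refl
  corner-sym (ex k)       (pt (suc x)) = refl
  corner-sym (ex k)       (ex k′)      = refl

  -- By strictness only the first parts can be 0, so the corner direction is supported at position
  -- `(0 , 0)`. Deleting row 0 and column 0 of the matrix is the shift of both sequences.
  ∂-corner-giambelli : ∀ n A B x y → Strict x → Strict y →
    ∂ (suc n) (giambelli (suc A) (suc B) x y) (λ i j → corner (label (suc A) x i) (label (suc B) y j)) ≡
    corner (pt (x 0)) (pt (y 0)) * det n (giambelli A B (x ∘ suc) (y ∘ suc))
  ∂-corner-giambelli n A B x y sx sy = ∂-corner n _ _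
    (λ i j → corner-pos A (x ∘ suc) (λ p → ℕ.≤-<-trans z≤n (sx p)) i (label (suc B) y j))
    (λ i j → trans (corner-sym (label (suc A) x i) (label B (y ∘ suc) j)) (corner-pos B (y ∘ suc) (λ p → ℕ.≤-<-trans z≤n (sy p)) j (label (suc A) x i)))

  label-≥ : ∀ A x i → A ℕ.≤ i → label A x i ≡ ex (i ℕ.∸ A)
  label-≥ A x i A≤i = trans (cong (label A x) (sym (ℕ.m+[n∸m]≡n A≤i))) (app-+ A (pt ∘ x) ex (i ℕ.∸ A))

  -- Used for `c = 0`, where there is no inner corner to remove: the minor that would describe the
  -- smaller shape has too large a zero block.
  ∂-corner-degenerate : ∀ N A B x y → A ℕ.+ B ℕ.≤ N → Strict x → Strict y →
    ∂ N (giambelli A B x y) (λ i j → corner (label A x i) (label B y j)) ≡ 0ℚ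
  ∂-corner-degenerate N zero    B       x y le sx sy = ∂-zero N _
  ∂-corner-degenerate N (suc A) zero    x y le sx sy = trans (∂-cong N _ (λ i j → corner-ex (label (suc A) x i) j)) (∂-zero N _)
  ∂-corner-degenerate (suc N) (suc A) (suc B) x y (s≤s le) sx sy = trans (∂-corner-giambelli N A B x y sx sy)
    (trans (cong (corner (pt (x 0)) (pt (y 0)) *_) (det-zero-block N A B _ (subst (ℕ._≤ N) (ℕ.+-suc A B) le)
      (λ i j A≤i B≤j → cong₂ entry (label-≥ A (x ∘ suc) i A≤i) (label-≥ B (y ∘ suc) j B≤j)))) (*-zeroʳ (corner (pt (x 0)) (pt (y 0)))))

  ∑-dec : ∀ A k x p → p ℕ.< A → 0 ℕ.< x p → ∑ A (λ i → ι (k ℕ.+ x i)) ≡ 1ℚ + ∑ A (λ i → ι (k ℕ.+ dec p x i))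
  ∑-dec (suc A) k x zero _ pos = trans (∑-suc A _) (trans (cong (_+ ∑ A (λ i → ι (k ℕ.+ x (suc i)))) (step (x 0) pos))
    (trans (+-assoc 1ℚ (ι (k ℕ.+ (x 0 ℕ.∸ 1))) _) (cong (1ℚ +_) (sym (∑-suc A _)))))
    where
    step : ∀ n → 0 ℕ.< n → ι (k ℕ.+ n) ≡ 1ℚ + ι (k ℕ.+ (n ℕ.∸ 1))
    step (suc n) _ = trans (cong ι (ℕ.+-suc k n)) (ι-suc (k ℕ.+ n))
  ∑-dec (suc A) k x (suc p) (s≤s p<) pos = trans (∑-suc A _) (trans (cong (ι (k ℕ.+ x 0) +_) (∑-dec A k (x ∘ suc) p p< pos))
    (trans (solve 2 (λ u v → u :+ (con 1ℚ :+ v) := con 1ℚ :+ (u :+ v)) refl (ι (k ℕ.+ x 0)) (∑ A (λ i → ι (k ℕ.+ dec p (x ∘ suc) i))))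
    (cong (1ℚ +_) (sym (∑-suc A _)))))

  module Skew (a b : ℕ) where

    G : ℕ → (x y : ℕ → ℕ) → ℚ
    G c x y = det (a ℕ.+ (b ℕ.+ c)) (giambelli (a ℕ.+ c) (b ℕ.+ c) x y)

    -- The Euler degree of the determinant. That it equals the number of cells is proved in `count`,
    -- along with the count itself.
    deg : ℕ → (x y : ℕ → ℕ) → ℚ
    deg c x y = ∑ (a ℕ.+ c) (λ i → ι (1 ℕ.+ x i)) + ∑ b (λ k → - ι k) + (∑ (b ℕ.+ c) (λ j → ι (0 ℕ.+ y j)) + ∑ a (λ k → - ι (suc k)))

    cornerTerm : ℕ → (x y : ℕ → ℕ) → ℚ
    cornerTerm zero    x y = 0ℚ
    cornerTerm (suc c) x y = corner (pt (x 0)) (pt (y 0)) * G c (x ∘ suc) (y ∘ suc)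

    private
      rows≡ : ∀ c → a ℕ.+ (b ℕ.+ c) ≡ (a ℕ.+ c) ℕ.+ b
      rows≡ c = arith a b c
        where
        arith : ∀ a b c → a ℕ.+ (b ℕ.+ c) ≡ (a ℕ.+ c) ℕ.+ b
        arith = ℕ-Solver.solve-∀

      cols≡ : ∀ c → a ℕ.+ (b ℕ.+ c) ≡ (b ℕ.+ c) ℕ.+ a
      cols≡ c = ℕ.+-comm a (b ℕ.+ c)

      ∑-labels : ∀ A b (f : Label → ℚ) x → ∑ (A ℕ.+ b) (f ∘ label A x) ≡ ∑ A (f ∘ pt ∘ x) + ∑ b (f ∘ ex)
      ∑-labels A b f x = trans (∑-cong (A ℕ.+ b) (λ i → app-f A x i)) (∑-app A b (f ∘ pt ∘ x) (f ∘ ex))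
        where
        app-f : ∀ A x i → f (label A x i) ≡ app A (f ∘ pt ∘ x) (f ∘ ex) i
        app-f zero    x i       = refl
        app-f (suc A) x zero    = refl
        app-f (suc A) x (suc i) = app-f A (x ∘ suc) i

    corner-G : ∀ c x y → Strict x → Strict y →
      ∂ (a ℕ.+ (b ℕ.+ c)) (giambelli (a ℕ.+ c) (b ℕ.+ c) x y) (λ i j → corner (label (a ℕ.+ c) x i) (label (b ℕ.+ c) y j)) ≡ cornerTerm c x y
    corner-G zero x y sx sy = ∂-corner-degenerate _ (a ℕ.+ 0) (b ℕ.+ 0) x y (ℕ.≤-reflexive (ℕ.+-assoc a 0 (b ℕ.+ 0))) sx sy
    corner-G (suc c) x y sx sy = subst₂ (λ A B → ∂ (a ℕ.+ B) (giambelli A B x y) (λ i j → corner (label A x i) (label B y j)) ≡ cornerTerm (suc c) x y)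
      (sym (ℕ.+-suc a c)) (sym (ℕ.+-suc b c))
      (subst (λ N → ∂ N (giambelli (suc (a ℕ.+ c)) (suc (b ℕ.+ c)) x y) (λ i j → corner (label (suc (a ℕ.+ c)) x i) (label (suc (b ℕ.+ c)) y j)) ≡ cornerTerm (suc c) x y) (sym (ℕ.+-suc a (b ℕ.+ c)))
        (∂-corner-giambelli (a ℕ.+ (b ℕ.+ c)) (a ℕ.+ c) (b ℕ.+ c) x y sx sy))

    G-rec : ∀ c x y → Strict x → Strict y →
      ∑ (a ℕ.+ c) (λ p → isPos (x p) * G c (dec p x) y) + ∑ (b ℕ.+ c) (λ p → isPos (y p) * G c x (dec p y)) + cornerTerm c x y
        ≡ deg c x y * G c x y
    G-rec c x y sx sy = trans (cong (∑ (a ℕ.+ c) (λ p → isPos (x p) * G c (dec p x) y) + ∑ (b ℕ.+ c) (λ p → isPos (y p) * G c x (dec p y)) +_) (sym (corner-G c x y sx sy))) (trans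
      (giambelli-rec (a ℕ.+ (b ℕ.+ c)) (a ℕ.+ c) (b ℕ.+ c) a b x y (rows≡ c) (cols≡ c))
      (cong (_* G c x y) (cong₂ _+_
        (trans (cong (λ N → ∑ N (rowDeg ∘ label (a ℕ.+ c) x)) (rows≡ c)) (∑-labels (a ℕ.+ c) b rowDeg x))
        (trans (cong (λ N → ∑ N (colDeg ∘ label (b ℕ.+ c) y)) (cols≡ c)) (∑-labels (b ℕ.+ c) a colDeg y)))))

    deg-decˣ : ∀ c x y p → p ℕ.< a ℕ.+ c → 0 ℕ.< x p → deg c x y ≡ 1ℚ + deg c (dec p x) y
    deg-decˣ c x y p p< pos = trans (cong (λ u → u + ∑ b (λ k → - ι k) + Y) (∑-dec (a ℕ.+ c) 1 x p p< pos))
      (solve 3 (λ u v w → (con 1ℚ :+ u) :+ v :+ w := con 1ℚ :+ (u :+ v :+ w)) refl (∑ (a ℕ.+ c) (λ i → ι (1 ℕ.+ dec p x i))) (∑ b (λ k → - ι k)) Y)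
      where Y = ∑ (b ℕ.+ c) (λ j → ι (0 ℕ.+ y j)) + ∑ a (λ k → - ι (suc k))

    deg-decʸ : ∀ c x y p → p ℕ.< b ℕ.+ c → 0 ℕ.< y p → deg c x y ≡ 1ℚ + deg c x (dec p y)
    deg-decʸ c x y p p< pos = trans (cong (λ u → X + (u + ∑ a (λ k → - ι (suc k)))) (∑-dec (b ℕ.+ c) 0 y p p< pos))
      (solve 3 (λ u v w → u :+ ((con 1ℚ :+ v) :+ w) := con 1ℚ :+ (u :+ (v :+ w))) refl X (∑ (b ℕ.+ c) (λ j → ι (0 ℕ.+ dec p y j))) (∑ a (λ k → - ι (suc k))))
      where X = ∑ (a ℕ.+ c) (λ i → ι (1 ℕ.+ x i)) + ∑ b (λ k → - ι k)

    deg-corner : ∀ c x y → x 0 ≡ 0 → y 0 ≡ 0 → deg (suc c) x y ≡ 1ℚ + deg c (x ∘ suc) (y ∘ suc)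
    deg-corner c x y x₀ y₀ = begin
      deg (suc c) x y ≡⟨ cong₂ (λ A B → ∑ A X + u + (∑ B Y + v)) (ℕ.+-suc a c) (ℕ.+-suc b c) ⟩
      ∑ (suc (a ℕ.+ c)) X + u + (∑ (suc (b ℕ.+ c)) Y + v)
        ≡⟨ cong₂ (λ p q → p + u + (q + v)) (trans (∑-suc (a ℕ.+ c) X) (cong (_+ s) (trans (cong (λ n → ι (1 ℕ.+ n)) x₀) ι-one)))
             (trans (∑-suc (b ℕ.+ c) Y) (cong (_+ t) (trans (cong ι y₀) ι-zero))) ⟩
      (1ℚ + s) + u + ((0ℚ + t) + v) ≡⟨ solve 4 (λ s u t v → (con 1ℚ :+ s) :+ u :+ ((con 0ℚ :+ t) :+ v) := con 1ℚ :+ (s :+ u :+ (t :+ v))) refl s u t v ⟩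
      1ℚ + deg c (x ∘ suc) (y ∘ suc) ∎
      where
      open ≡-Reasoning
      X Y : ℕ → ℚ
      X i = ι (1 ℕ.+ x i)
      Y j = ι (0 ℕ.+ y j)
      u = ∑ b (λ k → - ι k)
      v = ∑ a (λ k → - ι (suc k))
      s = ∑ (a ℕ.+ c) (X ∘ suc)
      t = ∑ (b ℕ.+ c) (Y ∘ suc)

    private
      label-repeat : ∀ A x p → suc p ℕ.< A → x (suc p) ≡ suc (x p) → label A (dec (suc p) x) p ≡ label A (dec (suc p) x) (suc p)
      label-repeat A x p p< eq = trans (app-< A _ ex p (ℕ.<-trans (ℕ.n<1+n p) p<)) (trans (cong pt (trans
        (cong (λ b → if b then x (suc p) ℕ.∸ 1 else x p) (n≢ᵇsuc p)) (sym (trans (dec-hit (suc p) x) (cong (ℕ._∸ 1) eq)))))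
        (sym (app-< A _ ex (suc p) p<)))

    -- Lowering a part onto its lower neighbour leaves the strict sequences, but it makes two
    -- adjacent rows equal; illegal moves thus drop out of `G-rec` by themselves.
    G-repeatˣ : ∀ c x y p → suc p ℕ.< a ℕ.+ c → x (suc p) ≡ suc (x p) → G c (dec (suc p) x) y ≡ 0ℚ
    G-repeatˣ c x y p p< eq = det-equal-rows _ _ p (ℕ.<-≤-trans p< (ℕ.≤-trans (ℕ.m≤m+n (a ℕ.+ c) b) (ℕ.≤-reflexive (sym (rows≡ c)))))
      (λ j → cong (λ l → entry l (label (b ℕ.+ c) y j)) (label-repeat (a ℕ.+ c) x p p< eq))

    G-repeatʸ : ∀ c x y p → suc p ℕ.< b ℕ.+ c → y (suc p) ≡ suc (y p) → G c x (dec (suc p) y) ≡ 0ℚ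
    G-repeatʸ c x y p p< eq = det-equal-cols _ _ p (ℕ.<-≤-trans p< (ℕ.m≤n+m (b ℕ.+ c) a))
      (λ i → cong (entry (label (a ℕ.+ c) x i)) (label-repeat (b ℕ.+ c) y p p< eq))

  -- Evaluation on arithmetic progressions

  sg-+ : ∀ m n → sg (m ℕ.+ n) ≡ sg m * sg n
  sg-+ zero    n = sym (trans (cong (_* sg n) sg-zero) (*-identityˡ (sg n)))
  sg-+ (suc m) n = trans (sg-suc (m ℕ.+ n)) (trans (cong -_ (sg-+ m n))
    (trans (solve 2 (λ x y → :- (x :* y) := :- x :* y) refl (sg m) (sg n)) (cong (_* sg n) (sym (sg-suc m)))))

  sg-square : ∀ n → sg n * sg n ≡ 1ℚ
  sg-square zero    = cong₂ _*_ sg-zero sg-zero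
  sg-square (suc n) = trans (cong₂ _*_ (sg-suc n) (sg-suc n)) (trans (solve 1 (λ x → :- x :* :- x := x :* x) refl (sg n)) (sg-square n))

  ∏-sg : ∀ n k → ∏ n (λ _ → sg k) ≡ sg (n ℕ.* k)
  ∏-sg zero    k = trans (∏-empty _) (sym sg-zero)
  ∏-sg (suc n) k = trans (∏-head n _) (trans (cong (sg k *_) (∏-sg n k)) (sym (sg-+ k (n ℕ.* k))))

  scale : Label → ℚ
  scale (pt x) = invFact x
  scale (ex k) = 1ℚ

  -- The entry without its factorials: on progressions the main block becomes Hankel and the borders
  -- become polynomial in the index.
  core : Label → Label → ℚ
  core (pt x) (pt y) = inv (suc (x ℕ.+ y))
  core (pt x) (ex k) = falling k (ι x)
  core (ex k) (pt y) = falling k (ι y)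
  core (ex _) (ex _) = 0ℚ

  entry≡scale*core : ∀ l l′ → entry l l′ ≡ scale l * scale l′ * core l l′
  entry≡scale*core (pt x) (pt y) = refl
  entry≡scale*core (pt x) (ex k) = cong (_* falling k (ι x)) (sym (*-identityʳ (invFact x)))
  entry≡scale*core (ex k) (pt y) = cong (_* falling k (ι y)) (sym (*-identityˡ (invFact y)))
  entry≡scale*core (ex k) (ex l) = refl

  label-map : ∀ {X : Set} (f : Label → X) A x i → f (label A x i) ≡ app A (f ∘ pt ∘ x) (f ∘ ex) i
  label-map f zero    x i       = refl
  label-map f (suc A) x zero    = refl
  label-map f (suc A) x (suc i) = label-map f A (x ∘ suc) i

  ∏-scale : ∀ N A b x → N ≡ A ℕ.+ b → ∏ N (scale ∘ label A x) ≡ ∏ A (invFact ∘ x)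
  ∏-scale N A b x refl = trans (∏-cong N (label-map scale A x)) (trans (∏-app A b (invFact ∘ x) (λ _ → 1ℚ))
    (trans (cong (∏ A (invFact ∘ x) *_) (∏-one b _ (λ _ → refl))) (*-identityʳ _)))

  module Evaluation (a b c d e M : ℕ) where
    open Skew a b
    open Hankel (d ℕ.+ e) M

    x y : ℕ → ℕ
    x i = d ℕ.+ i ℕ.* M
    y j = e ℕ.+ j ℕ.* M

    private
      A = a ℕ.+ c
      B = b ℕ.+ c
      N = a ℕ.+ (b ℕ.+ c)
      u v : ℕ → ℕ → ℚ
      u k i = falling k (ι (x i))
      v k j = falling k (ι (y j))

      W : ℕ → ℕ
      W n = prod n (λ k → k ! ℕ.* M ^ k)

      core-bordered : (λ i j → core (label A x i) (label B y j)) ≗₂ bordered A B r u v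
      core-bordered i j = trans (label-map (λ l → core l (label B y j)) A x i) (trans
        (app-cong A
          (λ i → trans (label-map (core (pt (x i))) B y j) (app-cong B (λ j → cong (inv ∘ suc) (arith d e i j M)) (λ _ → refl) j))
          (λ k → label-map (core (ex k)) B y j) i)
        (sym (app-eval A _ _ i j)))
        where
        arith : ∀ d e i j M → (d ℕ.+ i ℕ.* M) ℕ.+ (e ℕ.+ j ℕ.* M) ≡ d ℕ.+ e ℕ.+ (i ℕ.+ j) ℕ.* M
        arith = ℕ-Solver.solve-∀

      G-scaled : G c x y ≡ ∏ A (invFact ∘ x) * ∏ B (invFact ∘ y) * det N (bordered A B r u v)
      G-scaled = trans (det-cong N λ i j → trans (entry≡scale*core (label A x i) (label B y j))
          (cong (scale (label A x i) * scale (label B y j) *_) (core-bordered i j)))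
        (trans (det-scale N _ _ _) (cong₂ (λ p q → p * q * det N (bordered A B r u v))
          (∏-scale N A b x (arith a b c)) (∏-scale N B a y (ℕ.+-comm a (b ℕ.+ c)))))
        where
        arith : ∀ a b c → a ℕ.+ (b ℕ.+ c) ≡ (a ℕ.+ c) ℕ.+ b
        arith = ℕ-Solver.solve-∀

      κ-closed : ∀ s → κ s ≡ sg s * ι (s ! ℕ.* M ^ s)
      κ-closed zero    = sym (cong₂ _*_ sg-zero ι-one)
      κ-closed (suc s) = begin
        - (ι (suc s) * ι M * κ s) ≡⟨ cong (λ u → - (ι (suc s) * ι M * u)) (κ-closed s) ⟩
        - (ι (suc s) * ι M * (sg s * ι (s ! ℕ.* M ^ s)))
          ≡⟨ solve 4 (λ s m g f → :- (s :* m :* (g :* f)) := :- g :* (s :* m :* f)) refl (ι (suc s)) (ι M) (sg s) _ ⟩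
        - sg s * (ι (suc s) * ι M * ι (s ! ℕ.* M ^ s))
          ≡⟨ cong₂ _*_ (sg-suc s) (trans (ι-* (suc s ℕ.* M) _) (cong (_* ι (s ! ℕ.* M ^ s)) (ι-* (suc s) M))) ⟨
        sg (suc s) * ι (suc s ℕ.* M ℕ.* (s ! ℕ.* M ^ s)) ≡⟨ cong (λ n → sg (suc s) * ι n) (arith (suc s) M (s !) (M ^ s)) ⟩
        sg (suc s) * ι ((suc s) ! ℕ.* M ^ suc s) ∎
        where
        open ≡-Reasoning
        arith : ∀ s m f p → s ℕ.* m ℕ.* (f ℕ.* p) ≡ s ℕ.* f ℕ.* (m ℕ.* p)
        arith = ℕ-Solver.solve-∀

      s = b ℕ.+ a

      Δ-r : ∀ n → Δ^ b (Δ^ a r) n ≡ K s n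
      Δ-r n = trans (Δ^-cong b (λ n → trans (Δ^-cong a (λ n → sym (trans (*-identityˡ (R 1 n)) (trans (R-head 0 n)
          (trans (cong (r n *_) (∏-empty _)) (*-identityʳ (r n)))))) n) (Δ^-K a 0 n)) n)
        (trans (Δ^-K b (a ℕ.+ 0) n) (cong (λ k → K (b ℕ.+ k) n) (ℕ.+-identityʳ a)))

      C = prod c (λ k → (s ℕ.+ k) !) ℕ.* Φ c ℕ.* (V M c ℕ.* V M c)

      -- One factor `κ s` comes out of each of the `c` rows, and the powers of `s !` they contain
      -- supply the left-hand factor of `E-closed`.
      hankel : det c (λ i j → Δ^ b (Δ^ a r) (i ℕ.+ j)) ≡ sg (c ℕ.* s) * ι ((M ^ s) ^ c) * (ι C * ∏ c (λ k → R (s ℕ.+ c) k))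
      hankel = begin
        det c (λ i j → Δ^ b (Δ^ a r) (i ℕ.+ j))
          ≡⟨ det-cong c (λ i j → trans (Δ-r (i ℕ.+ j)) (cong (_* R (suc s) (i ℕ.+ j)) (sym (*-identityʳ (κ s))))) ⟩
        det c (λ i j → κ s * 1ℚ * R (suc s) (i ℕ.+ j)) ≡⟨ det-scale c (λ _ → κ s) (λ _ → 1ℚ) _ ⟩
        ∏ c (λ _ → κ s) * ∏ c (λ _ → 1ℚ) * E c s 0
          ≡⟨ cong₂ (λ p q → p * q * E c s 0) (trans (∏-cong c (λ _ → κ-closed s)) (trans (∏-* c _ _) (cong₂ _*_ (∏-sg c s)
               (trans (∏-const c _) (trans (cong ι (^-distribʳ-* c (s !) (M ^ s))) (ι-* ((s !) ^ c) _)))))) (∏-one c _ (λ _ → refl)) ⟩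
        sg (c ℕ.* s) * (ι ((s !) ^ c) * ι ((M ^ s) ^ c)) * 1ℚ * E c s 0
          ≡⟨ solve 4 (λ g f p e → g :* (f :* p) :* con 1ℚ :* e := g :* p :* (f :* e)) refl (sg (c ℕ.* s)) (ι ((s !) ^ c)) (ι ((M ^ s) ^ c)) (E c s 0) ⟩
        sg (c ℕ.* s) * ι ((M ^ s) ^ c) * (ι ((s !) ^ c) * E c s 0)
          ≡⟨ cong (sg (c ℕ.* s) * ι ((M ^ s) ^ c) *_) (E-closed c s 0) ⟩
        sg (c ℕ.* s) * ι ((M ^ s) ^ c) * (ι C * ∏ c (λ k → R (s ℕ.+ c) k)) ∎
        where open ≡-Reasoning

      -- The other exponents come from `a` pivots at position `B`, from `b` pivots at position `c`,
      -- and from `κ s` in `c` rows; together with `a b` they add up to twice `h`.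
      signs : sg (a ℕ.* b) * (sg (a ℕ.* B) * (sg (b ℕ.* c) * sg (c ℕ.* s))) ≡ 1ℚ
      signs = begin
        sg (a ℕ.* b) * (sg (a ℕ.* B) * (sg (b ℕ.* c) * sg (c ℕ.* s)))
          ≡⟨ cong (sg (a ℕ.* b) *_) (trans (cong (sg (a ℕ.* B) *_) (sym (sg-+ (b ℕ.* c) (c ℕ.* s)))) (sym (sg-+ (a ℕ.* B) _))) ⟩
        sg (a ℕ.* b) * sg (a ℕ.* B ℕ.+ (b ℕ.* c ℕ.+ c ℕ.* s)) ≡⟨ sg-+ (a ℕ.* b) _ ⟨
        sg (a ℕ.* b ℕ.+ (a ℕ.* B ℕ.+ (b ℕ.* c ℕ.+ c ℕ.* s))) ≡⟨ cong sg (arith a b c) ⟩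
        sg (h ℕ.+ h) ≡⟨ trans (sg-+ h h) (sg-square h) ⟩
        1ℚ ∎
        where
        open ≡-Reasoning
        h = a ℕ.* b ℕ.+ a ℕ.* c ℕ.+ b ℕ.* c
        arith : ∀ a b c → a ℕ.* b ℕ.+ (a ℕ.* (b ℕ.+ c) ℕ.+ (b ℕ.* c ℕ.+ c ℕ.* (b ℕ.+ a))) ≡
          (a ℕ.* b ℕ.+ a ℕ.* c ℕ.+ b ℕ.* c) ℕ.+ (a ℕ.* b ℕ.+ a ℕ.* c ℕ.+ b ℕ.* c)
        arith = ℕ-Solver.solve-∀

      ∏-weights : ∀ n k → ∏ n (λ i → sg k * ι (i ! ℕ.* M ^ i)) ≡ sg (n ℕ.* k) * ι (W n)
      ∏-weights n k = trans (∏-* n _ _) (cong₂ _*_ (∏-sg n k) (∏-ι n (λ i → i ! ℕ.* M ^ i)))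

    G-closed : sg (a ℕ.* b) * G c x y ≡
      ∏ (a ℕ.+ c) (invFact ∘ x) * ∏ (b ℕ.+ c) (invFact ∘ y) *
      (ι (prod a (λ k → k ! ℕ.* M ^ k)) * ι (prod b (λ k → k ! ℕ.* M ^ k)) * ι ((M ^ (b ℕ.+ a)) ^ c) *
       ι (prod c (λ k → (b ℕ.+ a ℕ.+ k) !) ℕ.* Φ c ℕ.* (V M c ℕ.* V M c))) * ∏ c (λ k → R (b ℕ.+ a ℕ.+ c) k)
    G-closed = begin
      sg (a ℕ.* b) * G c x y
        ≡⟨ cong (sg (a ℕ.* b) *_) (trans G-scaled (cong (X * Y *_) (trans
             (det-bordered a b c r u v (λ k → ι (k ! ℕ.* M ^ k)) (λ k → ι (k ! ℕ.* M ^ k)) (Poly-falling d M) (Poly-falling e M))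
             (cong₂ _*_ (∏-weights a B) (cong₂ _*_ (∏-weights b c) hankel))))) ⟩
      sg (a ℕ.* b) * (X * Y * (sg (a ℕ.* B) * wa * (sg (b ℕ.* c) * wb * (sg (c ℕ.* s) * p * (q * Z)))))
        ≡⟨ solve 11 (λ g X Y g₁ wa g₂ wb g₃ p q Z → g :* (X :* Y :* (g₁ :* wa :* (g₂ :* wb :* (g₃ :* p :* (q :* Z))))) :=
               (g :* (g₁ :* (g₂ :* g₃))) :* (X :* Y :* (wa :* wb :* p :* q) :* Z)) refl
             (sg (a ℕ.* b)) X Y (sg (a ℕ.* B)) wa (sg (b ℕ.* c)) wb (sg (c ℕ.* s)) p q Z ⟩
      (sg (a ℕ.* b) * (sg (a ℕ.* B) * (sg (b ℕ.* c) * sg (c ℕ.* s)))) * (X * Y * (wa * wb * p * q) * Z)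
        ≡⟨ trans (cong (_* (X * Y * (wa * wb * p * q) * Z)) signs) (*-identityˡ _) ⟩
      X * Y * (wa * wb * p * q) * Z ∎
      where
      open ≡-Reasoning
      X = ∏ A (invFact ∘ x)
      Y = ∏ B (invFact ∘ y)
      wa = ι (W a)
      wb = ι (W b)
      p = ι ((M ^ s) ^ c)
      q = ι C
      Z = ∏ c (λ k → R (s ℕ.+ c) k)

  -- Removing the largest entry

  ∑ˡ : {A : Set} → (A → ℚ) → List A → ℚ
  ∑ˡ f []       = 0ℚ
  ∑ˡ f (x ∷ xs) = f x + ∑ˡ f xs

  ∑ˡ-++ : ∀ {A : Set} (f : A → ℚ) xs ys → ∑ˡ f (xs ++ ys) ≡ ∑ˡ f xs + ∑ˡ f ys
  ∑ˡ-++ f []       ys = sym (+-identityˡ (∑ˡ f ys))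
  ∑ˡ-++ f (x ∷ xs) ys = trans (cong (f x +_) (∑ˡ-++ f xs ys)) (sym (+-assoc (f x) _ _))

  ∑ˡ-map : ∀ {A B : Set} (f : B → ℚ) (g : A → B) xs → ∑ˡ f (map g xs) ≡ ∑ˡ (f ∘ g) xs
  ∑ˡ-map f g []       = refl
  ∑ˡ-map f g (x ∷ xs) = cong (f (g x) +_) (∑ˡ-map f g xs)

  ∑ˡ-concatMap : ∀ {A B : Set} (f : B → ℚ) (g : A → List B) xs → ∑ˡ f (concatMap g xs) ≡ ∑ˡ (λ x → ∑ˡ f (g x)) xs
  ∑ˡ-concatMap f g []       = refl
  ∑ˡ-concatMap f g (x ∷ xs) = trans (∑ˡ-++ f (g x) (concatMap g xs)) (cong (∑ˡ f (g x) +_) (∑ˡ-concatMap f g xs))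

  ∑ˡ-cong : ∀ {A : Set} {f g : A → ℚ} xs → (∀ {x} → x ∈ xs → f x ≡ g x) → ∑ˡ f xs ≡ ∑ˡ g xs
  ∑ˡ-cong []       eq = refl
  ∑ˡ-cong (x ∷ xs) eq = cong₂ _+_ (eq (here refl)) (∑ˡ-cong xs (eq ∘ there))

  ∑ˡ-+ : ∀ {A : Set} (f g : A → ℚ) xs → ∑ˡ (λ x → f x + g x) xs ≡ ∑ˡ f xs + ∑ˡ g xs
  ∑ˡ-+ f g []       = refl
  ∑ˡ-+ f g (x ∷ xs) = trans (cong ((f x + g x) +_) (∑ˡ-+ f g xs))
    (solve 4 (λ x y u v → (x :+ y) :+ (u :+ v) := (x :+ u) :+ (y :+ v)) refl (f x) (g x) (∑ˡ f xs) (∑ˡ g xs))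

  ∑ˡ-*ˡ : ∀ {A : Set} k (f : A → ℚ) xs → ∑ˡ (λ x → k * f x) xs ≡ k * ∑ˡ f xs
  ∑ˡ-*ˡ k f []       = sym (*-zeroʳ k)
  ∑ˡ-*ˡ k f (x ∷ xs) = trans (cong (k * f x +_) (∑ˡ-*ˡ k f xs)) (sym (*-distribˡ-+ k (f x) (∑ˡ f xs)))

  ∑ˡ-↭ : ∀ {A : Set} (f : A → ℚ) {xs ys} → xs ↭ ys → ∑ˡ f xs ≡ ∑ˡ f ys
  ∑ˡ-↭ f ↭.refl = refl
  ∑ˡ-↭ f (↭.prep x p) = cong (f x +_) (∑ˡ-↭ f p)
  ∑ˡ-↭ f (↭.swap {xs} {ys} x y p) = trans (cong (λ u → f x + (f y + u)) (∑ˡ-↭ f p))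
    (solve 3 (λ x y u → x :+ (y :+ u) := y :+ (x :+ u)) refl (f x) (f y) (∑ˡ f ys))
  ∑ˡ-↭ f (↭.trans p q) = trans (∑ˡ-↭ f p) (∑ˡ-↭ f q)

  indicator : ∀ {A : Set} {P : A → Set} → Decidable P → A → ℚ
  indicator P? x = if does (P? x) then 1ℚ else 0ℚ

  ∑ˡ-filter : ∀ {A : Set} {P : A → Set} (P? : Decidable P) (f : A → ℚ) xs → ∑ˡ (λ x → indicator P? x * f x) xs ≡ ∑ˡ f (filter P? xs)
  ∑ˡ-filter P? f []       = refl
  ∑ˡ-filter P? f (x ∷ xs) with does (P? x)
  ... | true  = cong₂ _+_ (*-identityˡ (f x)) (∑ˡ-filter P? f xs)
  ... | false = trans (cong₂ _+_ (*-zeroˡ (f x)) (∑ˡ-filter P? f xs)) (+-identityˡ _)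

  length-filter : ∀ {A : Set} {P : A → Set} (P? : Decidable P) xs → ι (length (filter P? xs)) ≡ ∑ˡ (indicator P?) xs
  length-filter P? []       = ι-zero
  length-filter P? (x ∷ xs) with does (P? x)
  ... | true  = trans (ι-suc (length (filter P? xs))) (cong (1ℚ +_) (length-filter P? xs))
  ... | false = trans (length-filter P? xs) (sym (+-identityˡ _))

  ∑ˡ-insertions-∷ʳ : ∀ {A : Set} (f : List A → ℚ) x w z →
    ∑ˡ f (insertions x (w ∷ʳ z)) ≡ ∑ˡ (λ v → f (v ∷ʳ z)) (insertions x w) + f ((w ∷ʳ z) ∷ʳ x)
  ∑ˡ-insertions-∷ʳ f x []      z = solve 2 (λ u v → u :+ (v :+ con 0ℚ) := (u :+ con 0ℚ) :+ v) refl (f (x ∷ z ∷ [])) (f (z ∷ x ∷ []))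
  ∑ˡ-insertions-∷ʳ f x (y ∷ w) z = trans (cong (f (x ∷ y ∷ w ∷ʳ z) +_) (trans (∑ˡ-map f (y ∷_) (insertions x (w ∷ʳ z)))
      (trans (∑ˡ-insertions-∷ʳ (f ∘ (y ∷_)) x w z) (cong (_+ f (y ∷ (w ∷ʳ z) ∷ʳ x)) (sym (∑ˡ-map (λ v → f (v ∷ʳ z)) (y ∷_) (insertions x w)))))))
    (sym (+-assoc (f (x ∷ y ∷ w ∷ʳ z)) _ _))

  picks : {A : Set} → List A → List (A × List A)
  picks []       = []
  picks (x ∷ xs) = (x , xs) ∷ map (λ zr → proj₁ zr , x ∷ proj₂ zr) (picks xs)

  ∑ˡ-picks : ∀ {A : Set} (f : A → ℚ) xs → ∑ˡ (f ∘ proj₁) (picks xs) ≡ ∑ˡ f xs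
  ∑ˡ-picks f []       = refl
  ∑ˡ-picks f (x ∷ xs) = cong (f x +_) (trans (∑ˡ-map (f ∘ proj₁) _ (picks xs)) (∑ˡ-picks f xs))

  -- `perms` inserts first elements, whereas removing the largest entry needs last ones. Inserting
  -- `x` into a word ending in `z` either keeps `z` last or puts `x` last, and these are the two
  -- kinds of picks from `x ∷ xs`.
  ∑ˡ-perms : ∀ {A : Set} (f : List A → ℚ) x xs →
    ∑ˡ f (perms (x ∷ xs)) ≡ ∑ˡ (λ zr → ∑ˡ (λ w → f (w ∷ʳ proj₁ zr)) (perms (proj₂ zr))) (picks (x ∷ xs))
  ∑ˡ-perms f x []       = solve 1 (λ u → u :+ con 0ℚ := (u :+ con 0ℚ) :+ con 0ℚ) refl (f (x ∷ []))
  ∑ˡ-perms {A} f x (y ∷ ys) = begin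
    ∑ˡ f (concatMap (insertions x) (perms xs))              ≡⟨ ∑ˡ-concatMap f (insertions x) (perms xs) ⟩
    ∑ˡ (λ w → ∑ˡ f (insertions x w)) (perms xs)             ≡⟨ ∑ˡ-perms (λ w → ∑ˡ f (insertions x w)) y ys ⟩
    ∑ˡ (λ zr → ∑ˡ (λ w → ∑ˡ f (insertions x (w ∷ʳ proj₁ zr))) (perms (proj₂ zr))) (picks xs)
      ≡⟨ ∑ˡ-cong (picks xs) (λ {zr} _ → trans (∑ˡ-cong (perms (proj₂ zr)) (λ {w} _ → ∑ˡ-insertions-∷ʳ f x w (proj₁ zr)))
           (trans (∑ˡ-+ _ _ (perms (proj₂ zr))) (cong (_+ last zr) (sym (∑ˡ-concatMap (λ v → f (v ∷ʳ proj₁ zr)) (insertions x) (perms (proj₂ zr))))))) ⟩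
    ∑ˡ (λ zr → front zr + last zr) (picks xs)               ≡⟨ ∑ˡ-+ front last (picks xs) ⟩
    ∑ˡ front (picks xs) + ∑ˡ last (picks xs)
      ≡⟨ cong₂ _+_ (sym (∑ˡ-map picked extend (picks xs)))
           (sym (∑ˡ-perms (λ u → f (u ∷ʳ x)) y ys)) ⟩
    ∑ˡ picked (map extend (picks xs)) + ∑ˡ (λ u → f (u ∷ʳ x)) (perms xs)
      ≡⟨ +-comm (∑ˡ picked (map extend (picks xs))) (∑ˡ (λ u → f (u ∷ʳ x)) (perms xs)) ⟩
    ∑ˡ (λ u → f (u ∷ʳ x)) (perms xs) + ∑ˡ picked (map extend (picks xs)) ∎
    where
    open ≡-Reasoning
    xs = y ∷ ys
    extend : A × List A → A × List A
    extend zr = proj₁ zr , x ∷ proj₂ zr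
    picked front last : A × List A → ℚ
    picked zr = ∑ˡ (λ w → f (w ∷ʳ proj₁ zr)) (perms (proj₂ zr))
    front zr = ∑ˡ (λ v → f (v ∷ʳ proj₁ zr)) (perms (x ∷ proj₂ zr))
    last zr = ∑ˡ (λ w → f ((w ∷ʳ proj₁ zr) ∷ʳ x)) (perms (proj₂ zr))

  insertions-↭ : ∀ {A : Set} x (w : List A) {v} → v ∈ insertions x w → v ↭ x ∷ w
  insertions-↭ x []      (here refl) = ↭-refl
  insertions-↭ x (y ∷ w) (here refl) = ↭-refl
  insertions-↭ x (y ∷ w) (there v∈) with ∈-map⁻ (y ∷_) v∈
  ... | u , u∈ , refl = ↭-trans (↭-prep y (insertions-↭ x w u∈)) (↭.swap y x ↭-refl)

  perms-↭ : ∀ {A : Set} (xs : List A) {w} → w ∈ perms xs → w ↭ xs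
  perms-↭ []       (here refl) = ↭-refl
  perms-↭ (x ∷ xs) w∈ with find (∈-concatMap⁻ (insertions x) {xs = perms xs} w∈)
  ... | u , u∈ , w∈u = ↭-trans (insertions-↭ x u w∈u) (↭-prep x (perms-↭ xs u∈))

  Maximal : List Cell → Cell → Set
  Maximal S z = All (λ y → ¬ StrictlyBefore z y) S

  maximal? : ∀ S → Decidable (Maximal S)
  maximal? S z = all? (λ y → ¬? (StrictlyBefore? z y)) S

  Standard-∷ʳ⁺ : ∀ w z → Standard w → Maximal w z → Standard (w ∷ʳ z)
  Standard-∷ʳ⁺ []      z s       m       = [] , s
  Standard-∷ʳ⁺ (x ∷ w) z (h , s) (n ∷ m) = snoc h , Standard-∷ʳ⁺ w z s m
    where
    snoc : ∀ {w} → All (λ y → ¬ StrictlyBefore y x) w → All (λ y → ¬ StrictlyBefore y x) (w ∷ʳ z)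
    snoc []      = n ∷ []
    snoc (p ∷ h) = p ∷ snoc h

  Standard-∷ʳ⁻ : ∀ w z → Standard (w ∷ʳ z) → Standard w × Maximal w z
  Standard-∷ʳ⁻ []      z _       = _ , []
  Standard-∷ʳ⁻ (x ∷ w) z (h , s) with Standard-∷ʳ⁻ w z s | unsnoc w h
    where
    unsnoc : ∀ w → All (λ y → ¬ StrictlyBefore y x) (w ∷ʳ z) → All (λ y → ¬ StrictlyBefore y x) w × ¬ StrictlyBefore z x
    unsnoc []      (p ∷ []) = [] , p
    unsnoc (y ∷ w) (p ∷ h)  with unsnoc w h
    ... | q , n = p ∷ q , n
  ... | s′ , m | h′ , n = (h′ , s′) , n ∷ m

  indicator-yes : ∀ {A : Set} {P : A → Set} (P? : Decidable P) {x} → P x → indicator P? x ≡ 1ℚ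
  indicator-yes P? {x} px = cong (if_then 1ℚ else 0ℚ) (dec-true (P? x) px)

  indicator-no : ∀ {A : Set} {P : A → Set} (P? : Decidable P) {x} → ¬ P x → indicator P? x ≡ 0ℚ
  indicator-no P? {x} ¬px = cong (if_then 1ℚ else 0ℚ) (dec-false (P? x) ¬px)

  indicator-Standard-∷ʳ : ∀ {r w} z → w ↭ r → indicator Standard? (w ∷ʳ z) ≡ indicator (maximal? r) z * indicator Standard? w
  indicator-Standard-∷ʳ {r} {w} z w↭r with maximal? r z | Standard? w
  ... | yes m | yes s = indicator-yes Standard? (Standard-∷ʳ⁺ w z s (All-resp-↭ (↭-sym w↭r) m))
  ... | yes m | no ¬s = indicator-no Standard? (¬s ∘ proj₁ ∘ Standard-∷ʳ⁻ w z)
  ... | no ¬m | yes s = indicator-no Standard? (¬m ∘ All-resp-↭ w↭r ∘ proj₂ ∘ Standard-∷ʳ⁻ w z)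
  ... | no ¬m | no ¬s = indicator-no Standard? (¬s ∘ proj₁ ∘ Standard-∷ʳ⁻ w z)

  _≟ᶜ_ : (z w : Cell) → Dec (z ≡ w)
  _≟ᶜ_ = ≡-dec ℕ._≟_ ℕ._≟_

  without : Cell → List Cell → List Cell
  without z = filter (λ w → ¬? (z ≟ᶜ w))

  without-fresh : ∀ z S → All (z ≢_) S → without z S ≡ S
  without-fresh z S fresh = filter-all (λ w → ¬? (z ≟ᶜ w)) fresh

  picks-∈ : ∀ {A : Set} (S : List A) {zr} → zr ∈ picks S → proj₁ zr ∈ S
  picks-∈ (x ∷ S) (here refl) = here refl
  picks-∈ (x ∷ S) (there zr∈) with ∈-map⁻ _ zr∈
  ... | zr′ , zr′∈ , refl = there (picks-∈ S zr′∈)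

  picks-without : ∀ S {zr} → Unique S → zr ∈ picks S → proj₂ zr ≡ without (proj₁ zr) S
  picks-without (x ∷ S) (x∉S ∷ _) (here refl) = sym (trans
    (filter-reject (λ w → ¬? (x ≟ᶜ w)) {x = x} {xs = S} (λ n → n refl)) (without-fresh x S x∉S))
  picks-without (x ∷ S) (x∉S ∷ u) (there zr∈) with ∈-map⁻ _ zr∈
  ... | (z , r) , zr′∈ , refl = trans (cong (x ∷_) (picks-without S u zr′∈))
    (sym (filter-accept (λ w → ¬? (z ≟ᶜ w)) {x = x} {xs = S} (λ z≡x → All.lookup x∉S (picks-∈ S zr′∈) (sym z≡x))))

  length-without : ∀ S {z} → Unique S → z ∈ S → length S ≡ suc (length (without z S))
  length-without (x ∷ S) (x∉S ∷ _) (here refl) = cong suc (cong length (sym (trans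
    (filter-reject (λ w → ¬? (x ≟ᶜ w)) {x = x} {xs = S} (λ n → n refl)) (without-fresh x S x∉S))))
  length-without (x ∷ S) {z} (x∉S ∷ u) (there z∈) = cong suc (trans (length-without S u z∈)
    (cong length (sym (filter-accept (λ w → ¬? (z ≟ᶜ w)) {x = x} {xs = S} (λ z≡x → All.lookup x∉S z∈ (sym z≡x))))))

  SB-irrefl : ∀ z → ¬ StrictlyBefore z z
  SB-irrefl z (inj₁ (_ , lt)) = ℕ.<-irrefl refl lt
  SB-irrefl z (inj₂ (_ , lt)) = ℕ.<-irrefl refl lt

  maximal-without : ∀ S z → indicator (maximal? (without z S)) z ≡ indicator (maximal? S) z
  maximal-without S z with maximal? (without z S) z
  ... | yes m = sym (indicator-yes (maximal? S) (All.tabulate λ {y} y∈ → lem y y∈))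
    where
    lem : ∀ y → y ∈ S → ¬ StrictlyBefore z y
    lem y y∈ with z ≟ᶜ y
    ... | yes refl = SB-irrefl z
    ... | no z≢y = All.lookup m (∈-filter⁺ (λ w → ¬? (z ≟ᶜ w)) y∈ z≢y)
  ... | no ¬m = sym (indicator-no (maximal? S) (λ m → ¬m (All.tabulate λ y∈ → All.lookup m (proj₁ (∈-filter⁻ (λ w → ¬? (z ≟ᶜ w)) {xs = S} y∈)))))

  -- The largest entry of a standard tableau sits in a maximal cell; deleting it leaves a standard tableau.
  numSYT-rec : ∀ x xs → let S = x ∷ xs in Unique S →
    ι (numSYT S) ≡ ∑ˡ (λ z → ι (numSYT (without z S))) (filter (maximal? S) S)
  numSYT-rec x xs u = begin
    ι (numSYT S) ≡⟨ length-filter Standard? (perms S) ⟩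
    ∑ˡ (indicator Standard?) (perms S) ≡⟨ ∑ˡ-perms (indicator Standard?) x xs ⟩
    ∑ˡ (λ zr → ∑ˡ (λ w → indicator Standard? (w ∷ʳ proj₁ zr)) (perms (proj₂ zr))) (picks S)
      ≡⟨ ∑ˡ-cong (picks S) (λ {zr} zr∈ → begin
           ∑ˡ (λ w → indicator Standard? (w ∷ʳ proj₁ zr)) (perms (proj₂ zr))
             ≡⟨ ∑ˡ-cong (perms (proj₂ zr)) (λ w∈ → indicator-Standard-∷ʳ (proj₁ zr) (perms-↭ (proj₂ zr) w∈)) ⟩
           ∑ˡ (λ w → indicator (maximal? (proj₂ zr)) (proj₁ zr) * indicator Standard? w) (perms (proj₂ zr))
             ≡⟨ ∑ˡ-*ˡ (indicator (maximal? (proj₂ zr)) (proj₁ zr)) (indicator Standard?) (perms (proj₂ zr)) ⟩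
           indicator (maximal? (proj₂ zr)) (proj₁ zr) * ∑ˡ (indicator Standard?) (perms (proj₂ zr))
             ≡⟨ cong (indicator (maximal? (proj₂ zr)) (proj₁ zr) *_) (length-filter Standard? (perms (proj₂ zr))) ⟨
           indicator (maximal? (proj₂ zr)) (proj₁ zr) * ι (numSYT (proj₂ zr))
             ≡⟨ cong (λ r → indicator (maximal? r) (proj₁ zr) * ι (numSYT r)) (picks-without S u zr∈) ⟩
           indicator (maximal? (without (proj₁ zr) S)) (proj₁ zr) * ι (numSYT (without (proj₁ zr) S))
             ≡⟨ cong (_* ι (numSYT (without (proj₁ zr) S))) (maximal-without S (proj₁ zr)) ⟩
           indicator (maximal? S) (proj₁ zr) * ι (numSYT (without (proj₁ zr) S)) ∎) ⟩
    ∑ˡ (λ zr → indicator (maximal? S) (proj₁ zr) * ι (numSYT (without (proj₁ zr) S))) (picks S)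
      ≡⟨ ∑ˡ-picks (λ z → indicator (maximal? S) z * ι (numSYT (without z S))) S ⟩
    ∑ˡ (λ z → indicator (maximal? S) z * ι (numSYT (without z S))) S ≡⟨ ∑ˡ-filter (maximal? S) (λ z → ι (numSYT (without z S))) S ⟩
    ∑ˡ (λ z → ι (numSYT (without z S))) (filter (maximal? S) S) ∎
    where
    open ≡-Reasoning
    S = x ∷ xs

  -- Moves on shapes

  ∑ˡ-applyUpTo : ∀ {A : Set} (f : A → ℚ) (g : ℕ → A) n → ∑ˡ f (applyUpTo g n) ≡ ∑ n (f ∘ g)
  ∑ˡ-applyUpTo f g zero    = sym (∑-empty _)
  ∑ˡ-applyUpTo f g (suc n) = trans (cong (f (g 0) +_) (∑ˡ-applyUpTo f (g ∘ suc) n)) (sym (∑-suc n _))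

  app-cong-< : ∀ {X : Set} A {f f′ g : ℕ → X} → (∀ i → i ℕ.< A → f i ≡ f′ i) → ∀ i → app A f g i ≡ app A f′ g i
  app-cong-< zero    eq i       = refl
  app-cong-< (suc A) eq zero    = eq 0 (s≤s z≤n)
  app-cong-< (suc A) eq (suc i) = app-cong-< A (λ i i< → eq (suc i) (s≤s i<)) i

  ∏-invFact : ∀ n (x : ℕ → ℕ) → ∏ n (invFact ∘ x) * ι (prod n (λ i → (x i) !)) ≡ 1ℚ
  ∏-invFact n x = trans (cong (∏ n (invFact ∘ x) *_) (sym (∏-ι n _))) (trans (sym (∏-* n _ _))
    (∏-one n _ λ i → trans (*-comm (invFact (x i)) (ι ((x i) !))) (ι!*invFact (x i))))

  -- `StrictlyBefore` increases `i + j` strictly, so a cell with the largest sum will do.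
  exists-maximal : ∀ s S → ∃ λ z → z ∈ s ∷ S × Maximal (s ∷ S) z
  exists-maximal s S = z , z∈ , All.tabulate λ {w} w∈ z<w → ℕ.<⇒≱ (size-mono z w z<w) (All.lookup bound w∈)
    where
    size : Cell → ℕ
    size (i , j) = i ℕ.+ j
    z = argmax size s S
    z∈ : z ∈ s ∷ S
    z∈ with argmax-sel size s S
    ... | inj₁ eq = here eq
    ... | inj₂ z∈S = there z∈S
    bound : All (λ w → size w ℕ.≤ size z) (s ∷ S)
    bound = f[⊥]≤f[argmax] {f = size} s S ∷ f[xs]≤f[argmax] {f = size} s S
    size-mono : ∀ z w → StrictlyBefore z w → size z ℕ.< size w
    size-mono (i , j) (i′ , j′) (inj₁ (refl , lt)) = ℕ.+-monoʳ-< i lt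
    size-mono (i , j) (i′ , j′) (inj₂ (refl , lt)) = ℕ.+-monoˡ-< j lt

  module Count (a b : ℕ) where
    open Skew a b

    InC : ℕ → (x y : ℕ → ℕ) → Cell → Set
    InC c = In a b (a ℕ.+ c) (b ℕ.+ c)

    -- The order of the list is left open, so that deleting a cell from any list for one shape gives
    -- a list for the next shape.
    record Shape (c : ℕ) (x y : ℕ → ℕ) (S : List Cell) : Set where
      field
        unique   : Unique S
        sound    : ∀ {z} → z ∈ S → InC c x y z
        complete : ∀ {z} → InC c x y z → z ∈ S
    open Shape

    -- A common interface for the three kinds of removal, so that a single appeal to the induction
    -- hypothesis covers them all.
    record Next (c : ℕ) (x y : ℕ → ℕ) (z : Cell) (c′ : ℕ) (x′ y′ : ℕ → ℕ) : Set where
      field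
        strictˣ  : Strict x′
        strictʸ  : Strict y′
        member   : InC c x y z
        maximal  : ∀ w → InC c x y w → ¬ StrictlyBefore z w
        keep     : ∀ w → InC c x y w → z ≢ w → InC c′ x′ y′ w
        remain   : ∀ w → InC c′ x′ y′ w → InC c x y w × z ≢ w
        degree   : deg c x y ≡ 1ℚ + deg c′ x′ y′
    open Next

    removed : ∀ {c x y z c′ x′ y′ S} → Next c x y z c′ x′ y′ → Shape c x y S → Shape c′ x′ y′ (without z S)
    removed {z = z} {S = S} next sh = record
      { unique   = Unique.filter⁺ (λ w → ¬? (z ≟ᶜ w)) (unique sh)
      ; sound    = λ {w} w∈ → let w∈S , z≢w = ∈-filter⁻ (λ w → ¬? (z ≟ᶜ w)) {xs = S} w∈ in keep next w (sound sh w∈S) z≢w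
      ; complete = λ {w} inw → let inw′ , z≢w = remain next w inw in ∈-filter⁺ (λ w → ¬? (z ≟ᶜ w)) (complete sh inw′) z≢w
      }

    cellˣ cellʸ : ℕ → (ℕ → ℕ) → ℕ → Cell
    cellˣ c x p = a ℕ.+ c ℕ.∸ p , b ℕ.+ c ℕ.+ x p ℕ.∸ p
    cellʸ c y q = a ℕ.+ c ℕ.+ y q ℕ.∸ q , b ℕ.+ c ℕ.∸ q

    at-cell : ∀ A B x p → p ℕ.< A → p ℕ.≤ x p → At A B x p (A ℕ.∸ p) (B ℕ.+ x p ℕ.∸ p)
    at-cell A B x p p<A p≤xp = ℕ.m∸n+n≡m (ℕ.<⇒≤ p<A) , ℕ.m∸n+n≡m (ℕ.≤-trans p≤xp (ℕ.m≤n+m (x p) B))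

    at-unique : ∀ {A B x p i j} → At A B x p i j → (i ≡ A ℕ.∸ p) × (j ≡ B ℕ.+ x p ℕ.∸ p)
    at-unique {p = p} {i} {j} (refl , eq) = sym (ℕ.m+n∸n≡m i p) , trans (sym (ℕ.m+n∸n≡m j p)) (cong (ℕ._∸ p) eq)

    nextˣ : ∀ {c x y p} → Strict x → Strict y → p ℕ.< a ℕ.+ c → OK x p → Next c x y (cellˣ c x p) c (dec p x) y
    nextˣ {c} {x} {y} {p} sx sy p< ok = record
      { strictˣ = strict-dec p sx ok
      ; strictʸ = sy
      ; member  = At-In {y = y} b≤ sx p< p<xp at
      ; maximal = At-maximal {y = y} b≤ sx ok at
      ; keep    = dec⁺ b≤ sx p<xp at
      ; remain  = dec⁻ b≤ sx p<xp at
      ; degree  = deg-decˣ c x y p p< (ℕ.≤-<-trans z≤n p<xp)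
      }
      where
      b≤ = ℕ.m≤m+n b c
      p<xp = OK-< sx p ok
      at = at-cell (a ℕ.+ c) (b ℕ.+ c) x p p< (ℕ.<⇒≤ p<xp)

    SB-transpose : ∀ {i j i′ j′} → StrictlyBefore (i , j) (i′ , j′) → StrictlyBefore (j , i) (j′ , i′)
    SB-transpose = ⊎-swap

    nextʸ : ∀ {c x y q} → Strict x → Strict y → q ℕ.< b ℕ.+ c → OK y q → Next c x y (cellʸ c y q) c x (dec q y)
    nextʸ {c} {x} {y} {q} sx sy q< ok = record
      { strictˣ = sx
      ; strictʸ = strict-dec q sy ok
      ; member  = In-transpose {x = y} {y = x} _ _ (At-In {y = x} a≤ sy q< q<yq at)
      ; maximal = λ (i , j) inw z<w → At-maximal {y = x} a≤ sy ok at (j , i) (In-transpose {x = x} {y = y} i j inw) (SB-transpose z<w)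
      ; keep    = λ (i , j) inw z≢w → In-transpose {x = dec q y} {y = x} j i
                    (dec⁺ a≤ sy q<yq at (j , i) (In-transpose {x = x} {y = y} i j inw) (λ eq → z≢w (cong swap eq)))
      ; remain  = λ (i , j) inw → let r , ne = dec⁻ a≤ sy q<yq at (j , i) (In-transpose {x = x} {y = dec q y} i j inw)
                    in In-transpose {x = y} {y = x} j i r , λ eq → ne (cong swap eq)
      ; degree  = deg-decʸ c x y q q< (ℕ.≤-<-trans z≤n q<yq)
      }
      where
      a≤ = ℕ.m≤m+n a c
      q<yq = OK-< sy q ok
      at = at-cell (b ℕ.+ c) (a ℕ.+ c) y q q< (ℕ.<⇒≤ q<yq)

    InC-suc : ∀ c x y → In a b (suc (a ℕ.+ c)) (suc (b ℕ.+ c)) x y ≡ InC (suc c) x y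
    InC-suc c x y = sym (cong₂ (λ A B → In a b A B x y) (ℕ.+-suc a c) (ℕ.+-suc b c))

    next-corner : ∀ {c x y} → Strict x → Strict y → x 0 ≡ 0 → y 0 ≡ 0 →
      Next (suc c) x y (suc (a ℕ.+ c) , suc (b ℕ.+ c)) c (x ∘ suc) (y ∘ suc)
    next-corner {c} {x} {y} sx sy x₀ y₀ = record
      { strictˣ = sx ∘ suc
      ; strictʸ = sy ∘ suc
      ; member  = up _ (corner-In {x = x} {y = y} x₀ y₀ (λ (le , _) → ℕ.<⇒≱ (s≤s (ℕ.m≤m+n a c)) le))
      ; maximal = λ w inw → corner-maximal {x = x} {y = y} x₀ y₀ w (down w inw)
      ; keep    = λ w inw → shrink⁺ x₀ y₀ sx sy w (down w inw)
      ; remain  = λ w inw → let r , ne = shrink⁻ {x = x} {y = y} x₀ y₀ sx sy w inw in up w r , ne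
      ; degree  = deg-corner c x y x₀ y₀
      }
      where
      up : ∀ w → In a b (suc (a ℕ.+ c)) (suc (b ℕ.+ c)) x y w → InC (suc c) x y w
      up w = subst (λ P → P w) (InC-suc c x y)
      down : ∀ w → InC (suc c) x y w → In a b (suc (a ℕ.+ c)) (suc (b ℕ.+ c)) x y w
      down w = subst (λ P → P w) (sym (InC-suc c x y))

    ifOrigin : ℕ → ℕ → Cell → List Cell
    ifOrigin zero zero z = z ∷ []
    ifOrigin zero (suc _) z = []
    ifOrigin (suc _) _ z = []

    ∈-ifOrigin⁺ : ∀ {m n} z → m ≡ 0 → n ≡ 0 → z ∈ ifOrigin m n z
    ∈-ifOrigin⁺ z refl refl = here refl

    ∈-ifOrigin⁻ : ∀ m n {z w} → w ∈ ifOrigin m n z → m ≡ 0 × n ≡ 0 × w ≡ z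
    ∈-ifOrigin⁻ zero zero (here eq) = refl , refl , eq

    ifOrigin-unique : ∀ m n z → Unique (ifOrigin m n z)
    ifOrigin-unique zero zero z = [] ∷ []
    ifOrigin-unique zero (suc _) z = []
    ifOrigin-unique (suc _) _ z = []

    -- For `c = 0` the inner corner would be `(a , b)`, which the condition `¬ (i ≤ a × j ≤ b)`
    -- excludes.
    cornerCells : ℕ → (x y : ℕ → ℕ) → List Cell
    cornerCells zero    x y = []
    cornerCells (suc c) x y = ifOrigin (x 0) (y 0) (suc (a ℕ.+ c) , suc (b ℕ.+ c))

    rowCells colCells maximalCells : ℕ → (x y : ℕ → ℕ) → List Cell
    rowCells c x y = map (cellˣ c x) (filter (OK? x) (upTo (a ℕ.+ c)))
    colCells c x y = map (cellʸ c y) (filter (OK? y) (upTo (b ℕ.+ c)))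
    maximalCells c x y = rowCells c x y ++ (colCells c x y ++ cornerCells c x y)

    private
      ∸-≢ : ∀ {A i j} → i ℕ.< j → j ℕ.< A → A ℕ.∸ i ≢ A ℕ.∸ j
      ∸-≢ i<j j<A eq = ℕ.<-irrefl (sym eq) (ℕ.∸-monoʳ-< i<j (ℕ.<⇒≤ j<A))

    ∈-rowCells⁻ : ∀ c x y {z} → z ∈ rowCells c x y → ∃ λ p → p ℕ.< a ℕ.+ c × OK x p × z ≡ cellˣ c x p
    ∈-rowCells⁻ c x y z∈ with ∈-map⁻ (cellˣ c x) z∈
    ... | p , p∈ , eq with ∈-filter⁻ (OK? x) {xs = upTo (a ℕ.+ c)} p∈
    ...   | p∈′ , ok = p , ∈-upTo⁻ p∈′ , ok , eq

    ∈-colCells⁻ : ∀ c x y {z} → z ∈ colCells c x y → ∃ λ q → q ℕ.< b ℕ.+ c × OK y q × z ≡ cellʸ c y q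
    ∈-colCells⁻ c x y z∈ with ∈-map⁻ (cellʸ c y) z∈
    ... | p , p∈ , eq with ∈-filter⁻ (OK? y) {xs = upTo (b ℕ.+ c)} p∈
    ...   | p∈′ , ok = p , ∈-upTo⁻ p∈′ , ok , eq

    ∈-cornerCells⁻ : ∀ c x y {z} → z ∈ cornerCells c x y → ∃ λ c′ → c ≡ suc c′ × x 0 ≡ 0 × y 0 ≡ 0 × z ≡ (suc (a ℕ.+ c′) , suc (b ℕ.+ c′))
    ∈-cornerCells⁻ (suc c) x y z∈ with ∈-ifOrigin⁻ (x 0) (y 0) z∈
    ... | x₀ , y₀ , eq = c , refl , x₀ , y₀ , eq

    -- The three groups are separated by position: beyond column `b + c`, below row `a + c`, or
    -- exactly at the inner corner. Within a group the row or column index tells cells apart.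
    maximalCells-unique : ∀ c x y → Strict x → Strict y → Unique (maximalCells c x y)
    maximalCells-unique c x y sx sy = Unique.++⁺
      (AllPairs.map⁺ (AllPairs.filter⁺ (OK? x) (AllPairs.applyUpTo⁺₁ _ (a ℕ.+ c) (λ i<j j<A eq → ∸-≢ i<j j<A (cong proj₁ eq)))))
      (Unique.++⁺
        (AllPairs.map⁺ (AllPairs.filter⁺ (OK? y) (AllPairs.applyUpTo⁺₁ _ (b ℕ.+ c) (λ i<j j<B eq → ∸-≢ i<j j<B (cong proj₂ eq)))))
        (corners c)
        (λ (z∈ , z∈′) → col-corner z∈ z∈′))
      (λ (z∈ , z∈′) → row-rest z∈ (∈-++⁻ (colCells c x y) z∈′))
      where
      corners : ∀ c → Unique (cornerCells c x y)
      corners zero    = []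
      corners (suc c) = ifOrigin-unique (x 0) (y 0) _
      right : ∀ {p} → p ℕ.< a ℕ.+ c → OK x p → b ℕ.+ c ℕ.< proj₂ (cellˣ c x p)
      right {p} p< ok = At-> {a} {b} {a ℕ.+ c} {b ℕ.+ c} {x} {y} (ℕ.m≤m+n b c) sx {p} (OK-< sx p ok) (at-cell (a ℕ.+ c) (b ℕ.+ c) x p p< (ℕ.<⇒≤ (OK-< sx p ok)))
      low : ∀ {q} → q ℕ.< b ℕ.+ c → OK y q → a ℕ.+ c ℕ.< proj₁ (cellʸ c y q)
      low {q} q< ok = At-> {b} {a} {b ℕ.+ c} {a ℕ.+ c} {y} {x} (ℕ.m≤m+n a c) sy {q} (OK-< sy q ok) (at-cell (b ℕ.+ c) (a ℕ.+ c) y q q< (ℕ.<⇒≤ (OK-< sy q ok)))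
      col-corner : ∀ {z} → z ∈ colCells c x y → z ∈ cornerCells c x y → ⊥
      col-corner z∈ z∈′ with ∈-colCells⁻ c x y z∈ | ∈-cornerCells⁻ c x y z∈′
      ... | q , q< , ok , refl | c′ , refl , _ , _ , eq = ℕ.<-irrefl (trans (ℕ.+-suc a c′) (sym (cong proj₁ eq))) (low q< ok)
      row-rest : ∀ {z} → z ∈ rowCells c x y → z ∈ colCells c x y ⊎ z ∈ cornerCells c x y → ⊥
      row-rest z∈ (inj₁ z∈′) with ∈-rowCells⁻ c x y z∈ | ∈-colCells⁻ c x y z∈′
      ... | p , p< , ok , refl | q , q< , ok′ , eq = ℕ.<⇒≱ (right p< ok) (ℕ.≤-trans (ℕ.≤-reflexive (cong proj₂ eq)) (ℕ.m∸n≤m (b ℕ.+ c) q))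
      row-rest z∈ (inj₂ z∈′) with ∈-rowCells⁻ c x y z∈ | ∈-cornerCells⁻ c x y z∈′
      ... | p , p< , ok , refl | c′ , refl , _ , _ , eq = ℕ.<-irrefl (trans (ℕ.+-suc b c′) (sym (cong proj₂ eq))) (right p< ok)

    maximalCells-next : ∀ {c x y z} → Strict x → Strict y → z ∈ maximalCells c x y → ∃ λ c′ → ∃ λ x′ → ∃ λ y′ → Next c x y z c′ x′ y′
    maximalCells-next {c} {x} {y} sx sy z∈ with ∈-++⁻ (rowCells c x y) z∈
    ... | inj₁ z∈ˣ with ∈-rowCells⁻ c x y z∈ˣ
    ...   | p , p< , ok , refl = c , dec p x , y , nextˣ sx sy p< ok
    maximalCells-next {c} {x} {y} sx sy z∈ | inj₂ z∈′ with ∈-++⁻ (colCells c x y) z∈′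
    ... | inj₁ z∈ʸ with ∈-colCells⁻ c x y z∈ʸ
    ...   | q , q< , ok , refl = c , x , dec q y , nextʸ sx sy q< ok
    maximalCells-next {c} {x} {y} sx sy z∈ | inj₂ z∈′ | inj₂ z∈ᶜ with ∈-cornerCells⁻ c x y z∈ᶜ
    ... | c′ , refl , x₀ , y₀ , refl = c′ , x ∘ suc , y ∘ suc , next-corner sx sy x₀ y₀

    private
      corner-∈ : ∀ c x y {i j} → InC c x y (i , j) → i ≡ a ℕ.+ c → j ≡ b ℕ.+ c → x 0 ≡ 0 → y 0 ≡ 0 → (i , j) ∈ cornerCells c x y
      corner-∈ zero    x y (_ , _ , n) i≡ j≡ x₀ y₀ = ⊥-elim (n (ℕ.≤-reflexive (trans i≡ (ℕ.+-identityʳ a)) , ℕ.≤-reflexive (trans j≡ (ℕ.+-identityʳ b))))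
      corner-∈ (suc c) x y inz i≡ j≡ x₀ y₀ = subst (_∈ cornerCells (suc c) x y)
        (sym (cong₂ _,_ (trans i≡ (ℕ.+-suc a c)) (trans j≡ (ℕ.+-suc b c)))) (∈-ifOrigin⁺ _ x₀ y₀)

    ∈-maximalCells⁺ : ∀ {c x y z} → Strict x → Strict y → InC c x y z → (∀ w → InC c x y w → ¬ StrictlyBefore z w) → z ∈ maximalCells c x y
    ∈-maximalCells⁺ {c} {x} {y} {i , j} sx sy inz@(_ , inj₁ row , _) max with maximal-row {x = x} {y = y} (ℕ.m≤m+n b c) sx inz row max
    ... | inj₁ (p , p< , ok , at) with at-unique {x = x} {p = p} {i = i} {j = j} at
    ...   | refl , refl = ∈-++⁺ˡ (∈-map⁺ (cellˣ c x) (∈-filter⁺ (OK? x) (∈-upTo⁺ p<) ok))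
    ∈-maximalCells⁺ {c} {x} {y} {i , j} sx sy inz@(_ , inj₁ row , _) max | inj₂ ((i≡ , j≡) , x₀ , y₀) =
      ∈-++⁺ʳ (rowCells c x y) (∈-++⁺ʳ (colCells c x y) (corner-∈ c x y inz i≡ j≡ x₀ y₀))
    ∈-maximalCells⁺ {c} {x} {y} {i , j} sx sy inz@(_ , inj₂ col , _) max
      with maximal-row {x = y} {y = x} (ℕ.m≤m+n a c) sy (In-transpose {x = x} {y = y} i j inz) col
             (λ (j′ , i′) inw z<w → max (i′ , j′) (In-transpose {x = y} {y = x} j′ i′ inw) (SB-transpose z<w))
    ... | inj₁ (q , q< , ok , at) with at-unique {x = y} {p = q} {i = j} {j = i} at
    ...   | refl , refl = ∈-++⁺ʳ (rowCells c x y) (∈-++⁺ˡ (∈-map⁺ (cellʸ c y) (∈-filter⁺ (OK? y) (∈-upTo⁺ q<) ok)))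
    ∈-maximalCells⁺ {c} {x} {y} {i , j} sx sy inz@(_ , inj₂ col , _) max | inj₂ ((j≡ , i≡) , y₀ , x₀) =
      ∈-++⁺ʳ (rowCells c x y) (∈-++⁺ʳ (colCells c x y) (corner-∈ c x y inz i≡ j≡ x₀ y₀))

    -- Two duplicate-free lists with the same members. Sums over maximal cells can then be taken
    -- move by move and compared with `G-rec`.
    maximal-↭ : ∀ {c x y S} → Strict x → Strict y → Shape c x y S → filter (maximal? S) S ↭ maximalCells c x y
    maximal-↭ {c} {x} {y} {S} sx sy sh = ∼bag⇒↭ (unique∧set⇒bag (Unique.filter⁺ (maximal? S) (unique sh)) (maximalCells-unique c x y sx sy)
      (mk⇔ to from))
      where
      to : ∀ {z} → z ∈ filter (maximal? S) S → z ∈ maximalCells c x y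
      to z∈ with ∈-filter⁻ (maximal? S) {xs = S} z∈
      ... | z∈S , m = ∈-maximalCells⁺ sx sy (sound sh z∈S) (λ w inw → All.lookup m (complete sh inw))
      from : ∀ {z} → z ∈ maximalCells c x y → z ∈ filter (maximal? S) S
      from z∈ with maximalCells-next sx sy z∈
      ... | _ , _ , _ , next = ∈-filter⁺ (maximal? S) (complete sh (member next)) (All.tabulate λ {w} w∈ → maximal next w (sound sh w∈))

    -- The empty shape

    private
      empty-row : ∀ {a b A B x y} → b ℕ.≤ B → (∀ z → ¬ In a b A B x y z) → Strict x → ∀ p → p ℕ.< A → x p ≡ p
      empty-row {a} {b} {A} {B} {x} {y} b≤B none sx p p<A with p ℕ.<? x p
      ... | no p≮ = ℕ.≤-antisym (ℕ.≮⇒≥ p≮) (strict-≥ sx p)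
      ... | yes p< = ⊥-elim (none (A ℕ.∸ p , suc B) ((ℕ.m<n⇒0<n∸m p<A , s≤s z≤n) ,
              inj₁ (p , ℕ.m∸n+n≡m (ℕ.<⇒≤ p<A) , ℕ.≤-trans (ℕ.≤-reflexive (sym (ℕ.+-suc B p))) (ℕ.+-monoʳ-≤ B p<)) ,
              λ (_ , le) → ℕ.<⇒≱ le b≤B))

      -- For `c > 0` the cell `(a + c , b + c)` belongs to the rectangle but not to `b^a`.
      empty-c : ∀ c x y → (∀ z → ¬ InC c x y z) → c ≡ 0
      empty-c zero    x y none = refl
      empty-c (suc c) x y none = ⊥-elim (none (a ℕ.+ suc c , b ℕ.+ suc c)
        ((pos a , pos b) , inj₁ (0 , ℕ.+-identityʳ _ , ℕ.+-monoʳ-≤ (b ℕ.+ suc c) z≤n) , λ (le , _) → ℕ.<⇒≱ (ℕ.m<m+n a (s≤s z≤n)) le))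
        where
        pos : ∀ n → 1 ℕ.≤ n ℕ.+ suc c
        pos n = ℕ.≤-trans (s≤s z≤n) (ℕ.m≤n+m (suc c) n)

    deg-empty : ∀ x y → (∀ p → p ℕ.< a ℕ.+ 0 → x p ≡ p) → (∀ q → q ℕ.< b ℕ.+ 0 → y q ≡ q) → deg 0 x y ≡ 0ℚ
    deg-empty x y xid yid = begin
      deg 0 x y ≡⟨ cong₂ (λ u v → u + Q′ + (v + P′))
                     (trans (∑-cong< (a ℕ.+ 0) (λ i i< → cong (λ n → ι (1 ℕ.+ n)) (xid i i<))) (cong (λ n → ∑ n (λ i → ι (suc i))) (ℕ.+-identityʳ a)))
                     (trans (∑-cong< (b ℕ.+ 0) (λ i i< → cong ι (yid i i<))) (cong (λ n → ∑ n ι) (ℕ.+-identityʳ b))) ⟩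
      P + Q′ + (Q + P′) ≡⟨ solve 4 (λ p q′ q p′ → p :+ q′ :+ (q :+ p′) := (p :+ p′) :+ (q :+ q′)) refl P Q′ Q P′ ⟩
      (P + P′) + (Q + Q′) ≡⟨ cong₂ _+_ (cancel a (λ k → ι (suc k))) (cancel b ι) ⟩
      0ℚ ∎
      where
      open ≡-Reasoning
      P = ∑ a (λ k → ι (suc k))
      P′ = ∑ a (λ k → - ι (suc k))
      Q = ∑ b ι
      Q′ = ∑ b (λ k → - ι k)
      cancel : ∀ n f → ∑ n f + ∑ n (λ k → - f k) ≡ 0ℚ
      cancel n f = trans (sym (∑-+ n f _)) (∑-zero n _ (λ i → +-inverseʳ (f i)))

    -- The values `x p = p` and `y q = q` form progressions with `d = e = 0` and `M = 1`, so
    -- `Evaluation` applies with `c = 0`; its weights are products of factorials and cancel the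
    -- inverse factorials.
    G-empty : ∀ x y → (∀ p → p ℕ.< a ℕ.+ 0 → x p ≡ p) → (∀ q → q ℕ.< b ℕ.+ 0 → y q ≡ q) → sg (a ℕ.* b) * G 0 x y ≡ 1ℚ
    G-empty x y xid yid = begin
      sg (a ℕ.* b) * G 0 x y
        ≡⟨ cong (sg (a ℕ.* b) *_) (det-cong _ λ i j → cong₂ entry
             (app-cong-< (a ℕ.+ 0) (λ p p< → cong pt (trans (xid p p<) (sym (ℕ.*-identityʳ p)))) i)
             (app-cong-< (b ℕ.+ 0) (λ q q< → cong pt (trans (yid q q<) (sym (ℕ.*-identityʳ q)))) j)) ⟩
      sg (a ℕ.* b) * G 0 Ev.x Ev.y ≡⟨ Ev.G-closed ⟩
      X * Y * (wa * wb * ι 1 * ι 1) * ∏ 0 _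
        ≡⟨ cong₂ (λ u v → X * Y * (wa * wb * u * u) * v) ι-one (∏-empty _) ⟩
      X * Y * (wa * wb * 1ℚ * 1ℚ) * 1ℚ
        ≡⟨ solve 4 (λ x y a b → x :* y :* (a :* b :* con 1ℚ :* con 1ℚ) :* con 1ℚ := (x :* a) :* (y :* b)) refl X Y wa wb ⟩
      (X * wa) * (Y * wb) ≡⟨ cong₂ _*_ (weights a) (weights b) ⟩
      1ℚ ∎
      where
      open ≡-Reasoning
      module Ev = Evaluation a b 0 0 0 1
      X = ∏ (a ℕ.+ 0) (invFact ∘ Ev.x)
      Y = ∏ (b ℕ.+ 0) (invFact ∘ Ev.y)
      wa = ι (prod a (λ k → k ! ℕ.* 1 ^ k))
      wb = ι (prod b (λ k → k ! ℕ.* 1 ^ k))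
      weights : ∀ n → ∏ (n ℕ.+ 0) (λ i → invFact (i ℕ.* 1)) * ι (prod n (λ k → k ! ℕ.* 1 ^ k)) ≡ 1ℚ
      weights n = trans (cong₂ (λ u v → ∏ u (λ i → invFact (i ℕ.* 1)) * ι v) (ℕ.+-identityʳ n)
        (prod-cong n (λ k → trans (trans (cong (k ! ℕ.*_) (ℕ.^-zeroˡ k)) (ℕ.*-identityʳ (k !))) (cong _! (sym (ℕ.*-identityʳ k))))))
        (∏-invFact n (λ i → i ℕ.* 1))

    -- Counting by induction on the number of cells

    private
      sgn = sg (a ℕ.* b)

      isPos-OK : ∀ {x} p → Strict x → OK x p → isPos (x p) ≡ 1ℚ
      isPos-OK {x} p s ok with x p | OK-< s p ok
      ... | suc _ | _ = refl

      -- A move is forbidden for one of two reasons. Either the lowest part is already 0, and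
      -- `isPos` kills the term, or the part would collide with its neighbour, and the repeated row
      -- or column does.
      move-zero : ∀ {x : ℕ → ℕ} {g : ℕ → ℚ} A → Strict x → (∀ p → suc p ℕ.< A → x (suc p) ≡ suc (x p) → g (suc p) ≡ 0ℚ) →
        ∀ p → p ℕ.< A → ¬ OK x p → isPos (x p) * g p ≡ 0ℚ
      move-zero {x} {g} A s rep zero p< ¬ok with x 0
      ... | zero  = *-zeroˡ (g 0)
      ... | suc k = ⊥-elim (¬ok (s≤s z≤n))
      move-zero {x} {g} A s rep (suc p) p< ¬ok = trans (cong (isPos (x (suc p)) *_) (rep p p< (ℕ.≤-antisym (ℕ.≮⇒≥ ¬ok) (s p)))) (*-zeroʳ (isPos (x (suc p))))

      moves : ∀ {x : ℕ → ℕ} {g ψ : ℕ → ℚ} k A → Strict x →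
        (∀ p → suc p ℕ.< A → x (suc p) ≡ suc (x p) → g (suc p) ≡ 0ℚ) →
        (∀ p → p ℕ.< A → OK x p → ψ p ≡ k * g p) →
        ∑ˡ ψ (filter (OK? x) (upTo A)) ≡ k * ∑ A (λ p → isPos (x p) * g p)
      moves {x} {g} {ψ} k A s rep val = begin
        ∑ˡ ψ (filter (OK? x) (upTo A))                        ≡⟨ ∑ˡ-filter (OK? x) ψ (upTo A) ⟨
        ∑ˡ (λ p → indicator (OK? x) p * ψ p) (upTo A)         ≡⟨ ∑ˡ-applyUpTo _ (λ p → p) A ⟩
        ∑ A (λ p → indicator (OK? x) p * ψ p)                 ≡⟨ ∑-cong< A term ⟩
        ∑ A (λ p → k * (isPos (x p) * g p))                   ≡⟨ ∑-*ˡ A k _ ⟩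
        k * ∑ A (λ p → isPos (x p) * g p)                     ∎
        where
        open ≡-Reasoning
        term : ∀ p → p ℕ.< A → indicator (OK? x) p * ψ p ≡ k * (isPos (x p) * g p)
        term p p< with OK? x p
        ... | yes ok = trans (*-identityˡ (ψ p)) (trans (val p p< ok) (cong (k *_) (sym (trans (cong (_* g p) (isPos-OK p s ok)) (*-identityˡ (g p))))))
        ... | no ¬ok = trans (*-zeroˡ (ψ p)) (sym (trans (cong (k *_) (move-zero {x} {g} A s rep p p< ¬ok)) (*-zeroʳ k)))

    -- Both statements travel together: the factor `deg` produced by `G-rec` must be recognised as
    -- `suc n` to turn `n !` into `(suc n) !`. Removing any one maximal cell supplies the degree
    -- equation.
    count : ∀ n {c x y S} → Strict x → Strict y → Shape c x y S → length S ≡ n →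
      ι n ≡ deg c x y × ι (numSYT S) ≡ ι (n !) * (sg (a ℕ.* b) * G c x y)
    count zero {c} {x} {y} {[]} sx sy sh refl = empty c (empty-c c x y none) sh
      where
      none : ∀ z → ¬ InC c x y z
      none z inz with complete sh inz
      ... | ()
      empty : ∀ c → c ≡ 0 → Shape c x y [] → ι 0 ≡ deg c x y × ι 1 ≡ ι 1 * (sg (a ℕ.* b) * G c x y)
      empty .0 refl sh₀ = trans ι-zero (sym (deg-empty x y xid yid)) , sym (trans (cong (ι 1 *_) (G-empty x y xid yid)) (*-identityʳ (ι 1)))
        where
        none₀ : ∀ z → ¬ InC 0 x y z
        none₀ z inz with complete sh₀ inz
        ... | ()
        xid = empty-row {x = x} {y = y} (ℕ.m≤m+n b 0) none₀ sx
        yid = empty-row {x = y} {y = x} (ℕ.m≤m+n a 0) (λ (j , i) inz → none₀ (i , j) (In-transpose {x = y} {y = x} j i inz)) sy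
    count (suc n) {c} {x} {y} {s ∷ S′} sx sy sh len = degree≡ , (begin
      ι (numSYT S)                                          ≡⟨ numSYT-rec s S′ (unique sh) ⟩
      ∑ˡ ψ (filter (maximal? S) S)                          ≡⟨ ∑ˡ-↭ ψ (maximal-↭ sx sy sh) ⟩
      ∑ˡ ψ (maximalCells c x y)                             ≡⟨ trans (∑ˡ-++ ψ (rowCells c x y) _) (cong (∑ˡ ψ (rowCells c x y) +_) (∑ˡ-++ ψ (colCells c x y) _)) ⟩
      ∑ˡ ψ (rowCells c x y) + (∑ˡ ψ (colCells c x y) + ∑ˡ ψ (cornerCells c x y))
        ≡⟨ cong₂ _+_ (trans (∑ˡ-map ψ (cellˣ c x) (filter (OK? x) (upTo (a ℕ.+ c)))) (moves {x} {λ p → G c (dec p x) y} k (a ℕ.+ c) sx (λ p → G-repeatˣ c x y p) (λ p p< ok → ψ-next (nextˣ sx sy p< ok))))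
             (cong₂ _+_ (trans (∑ˡ-map ψ (cellʸ c y) (filter (OK? y) (upTo (b ℕ.+ c)))) (moves {y} {λ q → G c x (dec q y)} k (b ℕ.+ c) sy (λ q → G-repeatʸ c x y q) (λ q q< ok → ψ-next (nextʸ sx sy q< ok))))
               (corners c x y refl refl refl)) ⟩
      k * X + (k * Y + k * Z)                               ≡⟨ solve 4 (λ k x y z → k :* x :+ (k :* y :+ k :* z) := k :* (x :+ y :+ z)) refl k X Y Z ⟩
      k * (X + Y + Z)                                       ≡⟨ cong (k *_) (G-rec c x y sx sy) ⟩
      k * (deg c x y * G c x y)                             ≡⟨ cong (λ u → k * (u * G c x y)) (sym degree≡) ⟩
      ι (n !) * sgn * (ι (suc n) * G c x y)
        ≡⟨ solve 4 (λ f s n g → f :* s :* (n :* g) := (n :* f) :* (s :* g)) refl (ι (n !)) sgn (ι (suc n)) (G c x y) ⟩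
      (ι (suc n) * ι (n !)) * (sgn * G c x y)               ≡⟨ cong (_* (sgn * G c x y)) (ι-* (suc n) (n !)) ⟨
      ι ((suc n) !) * (sgn * G c x y)                       ∎)
      where
      open ≡-Reasoning
      S = s ∷ S′
      ψ : Cell → ℚ
      ψ z = ι (numSYT (without z S))
      k = ι (n !) * sgn
      X = ∑ (a ℕ.+ c) (λ p → isPos (x p) * G c (dec p x) y)
      Y = ∑ (b ℕ.+ c) (λ q → isPos (y q) * G c x (dec q y))
      Z = cornerTerm c x y
      IH : ∀ {z c′ x′ y′} → Next c x y z c′ x′ y′ → ι n ≡ deg c′ x′ y′ × ψ z ≡ ι (n !) * (sgn * G c′ x′ y′)
      IH next = count n (strictˣ next) (strictʸ next) (removed next sh)
        (ℕ.suc-injective (trans (sym (length-without S (unique sh) (complete sh (member next)))) len))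
      ψ-next : ∀ {z c′ x′ y′} → Next c x y z c′ x′ y′ → ψ z ≡ k * G c′ x′ y′
      ψ-next next = trans (proj₂ (IH next)) (sym (*-assoc (ι (n !)) sgn _))
      degree≡ : ι (suc n) ≡ deg c x y
      degree≡ with exists-maximal s S′
      ... | z , z∈ , m with maximalCells-next sx sy (∈-maximalCells⁺ sx sy (sound sh z∈) (λ w inw → All.lookup m (complete sh inw)))
      ...   | _ , _ , _ , next = trans (ι-suc n) (trans (cong (1ℚ +_) (proj₁ (IH next))) (sym (degree next)))
      corners : ∀ c′ x′ y′ → c′ ≡ c → x′ ≡ x → y′ ≡ y → ∑ˡ ψ (cornerCells c′ x′ y′) ≡ k * cornerTerm c′ x′ y′
      corners zero     x′ y′ _ _ _ = sym (*-zeroʳ k)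
      corners (suc c′) x′ y′ refl refl refl = go (x 0) (y 0) refl refl
        where
        go : ∀ p q → x 0 ≡ p → y 0 ≡ q → ∑ˡ ψ (ifOrigin p q (suc (a ℕ.+ c′) , suc (b ℕ.+ c′))) ≡ k * (corner (pt p) (pt q) * G c′ (x ∘ suc) (y ∘ suc))
        go zero    zero    x₀ y₀ = trans (+-identityʳ _) (trans (ψ-next (next-corner sx sy x₀ y₀)) (cong (k *_) (sym (*-identityˡ _))))
        go zero    (suc q) x₀ y₀ = sym (trans (cong (k *_) (*-zeroˡ (G c′ (x ∘ suc) (y ∘ suc)))) (*-zeroʳ k))
        go (suc p) q       x₀ y₀ = sym (trans (cong (k *_) (*-zeroˡ (G c′ (x ∘ suc) (y ∘ suc)))) (*-zeroʳ k))

  -- The product formula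

  fall-! : ∀ m k → fall (m ℕ.+ k) m ℕ.* k ! ≡ (m ℕ.+ k) !
  fall-! zero    k = ℕ.*-identityˡ (k !)
  fall-! (suc m) k = begin
    fall (suc m ℕ.+ k) m ℕ.* (suc m ℕ.+ k ℕ.∸ m) ℕ.* k !
      ≡⟨ cong (λ n → fall n m ℕ.* (n ℕ.∸ m) ℕ.* k !) (sym (ℕ.+-suc m k)) ⟩
    fall (m ℕ.+ suc k) m ℕ.* (m ℕ.+ suc k ℕ.∸ m) ℕ.* k !
      ≡⟨ cong (λ n → fall (m ℕ.+ suc k) m ℕ.* n ℕ.* k !) (ℕ.m+n∸m≡n m (suc k)) ⟩
    fall (m ℕ.+ suc k) m ℕ.* suc k ℕ.* k ! ≡⟨ ℕ.*-assoc (fall (m ℕ.+ suc k) m) (suc k) (k !) ⟩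
    fall (m ℕ.+ suc k) m ℕ.* (suc k) !     ≡⟨ fall-! m (suc k) ⟩
    (m ℕ.+ suc k) !                        ≡⟨ cong _! (ℕ.+-suc m k) ⟩
    (suc m ℕ.+ k) !                        ∎
    where open ≡-Reasoning

  prod-* : ∀ n (f g : ℕ → ℕ) → prod n (λ i → f i ℕ.* g i) ≡ prod n f ℕ.* prod n g
  prod-* zero    f g = refl
  prod-* (suc n) f g = trans (cong (ℕ._* (f n ℕ.* g n)) (prod-* n f g)) (arith (prod n f) (prod n g) (f n) (g n))
    where
    arith : ∀ p q r s → p ℕ.* q ℕ.* (r ℕ.* s) ≡ p ℕ.* r ℕ.* (q ℕ.* s)
    arith = ℕ-Solver.solve-∀

  prod-+ : ∀ m n (f : ℕ → ℕ) → prod (m ℕ.+ n) f ≡ prod m f ℕ.* prod n (λ i → f (m ℕ.+ i))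
  prod-+ m zero    f = trans (cong (λ k → prod k f) (ℕ.+-identityʳ m)) (sym (ℕ.*-identityʳ (prod m f)))
  prod-+ m (suc n) f = trans (cong (λ k → prod k f) (ℕ.+-suc m n)) (trans (cong (ℕ._* f (m ℕ.+ n)) (prod-+ m n f))
    (ℕ.*-assoc (prod m f) _ (f (m ℕ.+ n))))

  prod-one : ∀ n → prod n (λ _ → 1) ≡ 1
  prod-one zero    = refl
  prod-one (suc n) = trans (ℕ.*-identityʳ _) (prod-one n)

  prod-swap : ∀ m n (f : ℕ → ℕ → ℕ) → prod m (λ i → prod n (f i)) ≡ prod n (λ j → prod m (λ i → f i j))
  prod-swap zero    n f = sym (prod-one n)
  prod-swap (suc m) n f = trans (cong (ℕ._* prod n (f m)) (prod-swap m n f)) (sym (prod-* n _ (f m)))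

  prod-const : ∀ n k → prod n (λ _ → k) ≡ k ^ n
  prod-const zero    k = refl
  prod-const (suc n) k = trans (cong (ℕ._* k) (prod-const n k)) (ℕ.*-comm (k ^ n) k)

  Φ≡prod : ∀ n → Φ n ≡ prod n _!
  Φ≡prod zero    = refl
  Φ≡prod (suc n) = cong (ℕ._* n !) (Φ≡prod n)

  Φ-+ : ∀ s c → Φ (s ℕ.+ c) ≡ Φ s ℕ.* prod c (λ k → (s ℕ.+ k) !)
  Φ-+ s c = trans (Φ≡prod (s ℕ.+ c)) (trans (prod-+ s c _!) (cong (ℕ._* prod c (λ k → (s ℕ.+ k) !)) (sym (Φ≡prod s))))

  module _ (m : ℕ) where
    private
      M = m ℕ.+ 1

    -- Cut `(i M)!` into `i` blocks of `M = m + 1` consecutive factors. Block `j` has top factor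
    -- `j M`, and the `m` factors below it form the falling factorial; the tops multiply to
    -- `i ! * M ^ i`.
    Ψ-factor : ∀ i → prod i (λ j → fall (suc j ℕ.* m ℕ.+ suc j ℕ.∸ 1) m) ℕ.* (i ! ℕ.* M ^ i) ≡ (i ℕ.* M) !
    Ψ-factor zero    = refl
    Ψ-factor (suc i) = begin
      P ℕ.* fall (suc i ℕ.* m ℕ.+ suc i ℕ.∸ 1) m ℕ.* ((suc i) ! ℕ.* M ^ suc i)
        ≡⟨ arith P (fall (suc i ℕ.* m ℕ.+ suc i ℕ.∸ 1) m) (suc i) (i !) M (M ^ i) ⟩
      suc i ℕ.* M ℕ.* (fall (suc i ℕ.* m ℕ.+ suc i ℕ.∸ 1) m ℕ.* (P ℕ.* (i ! ℕ.* M ^ i)))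
        ≡⟨ cong₂ (λ u v → suc i ℕ.* M ℕ.* (fall (u ℕ.∸ 1) m ℕ.* v)) (top m i) (Ψ-factor i) ⟩
      suc i ℕ.* M ℕ.* (fall (m ℕ.+ i ℕ.* M) m ℕ.* (i ℕ.* M) !)
        ≡⟨ cong₂ ℕ._*_ (top′ m i) (fall-! m (i ℕ.* M)) ⟩
      (suc (m ℕ.+ i ℕ.* M)) !
        ≡⟨ cong _! (sym (top′ m i)) ⟩
      (suc i ℕ.* M) ! ∎
      where
      open ≡-Reasoning
      P = prod i (λ j → fall (suc j ℕ.* m ℕ.+ suc j ℕ.∸ 1) m)
      arith : ∀ p f s g M q → p ℕ.* f ℕ.* (s ℕ.* g ℕ.* (M ℕ.* q)) ≡ s ℕ.* M ℕ.* (f ℕ.* (p ℕ.* (g ℕ.* q)))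
      arith = ℕ-Solver.solve-∀
      top : ∀ m i → suc i ℕ.* m ℕ.+ suc i ≡ suc (m ℕ.+ i ℕ.* (m ℕ.+ 1))
      top = ℕ-Solver.solve-∀
      top′ : ∀ m i → suc i ℕ.* (m ℕ.+ 1) ≡ suc (m ℕ.+ i ℕ.* (m ℕ.+ 1))
      top′ = ℕ-Solver.solve-∀

    Ψ-closed : ∀ n → Ψ m n ℕ.* (Φ n ℕ.* V M n) ≡ prod n (λ i → (i ℕ.* M) !)
    Ψ-closed n = trans (cong (Ψ m n ℕ.*_) (trans (cong (ℕ._* V M n) (Φ≡prod n)) (sym (prod-* n _! (M ^_))))) (lem n)
      where
      lem : ∀ n → Ψ m n ℕ.* prod n (λ i → i ! ℕ.* M ^ i) ≡ prod n (λ i → (i ℕ.* M) !)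
      lem zero    = refl
      -- The factor for `i = 0` is 1; dropping it matches the bound `n ∸ 1` in `Ψ`.
      lem (suc n) = trans (cong (Ψ m (suc n) ℕ.*_) (trans (prod-head n _) (ℕ.*-identityˡ _)))
        (trans (sym (prod-* n _ _)) (trans (prod-cong n (λ i → Ψ-factor (suc i))) (sym (trans (prod-head n _) (ℕ.*-identityˡ _)))))

  V-+ : ∀ M a c → V M (a ℕ.+ c) ≡ V M a ℕ.* ((M ^ a) ^ c ℕ.* V M c)
  V-+ M a c = trans (prod-+ a c (M ^_)) (cong (V M a ℕ.*_) (trans (prod-cong c (ℕ.^-distribˡ-+-* M a)) (trans (prod-* c _ _)
    (cong (ℕ._* V M c) (prod-const c (M ^ a))))))

  -- Remove the `b` by `a` block whose row indices are shifted by `c`. Since `t` sees only the sum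
  -- of the indices, the `c` leftover columns next to the block can be laid as rows at the end of
  -- the `c` top rows, extending their length from `a + c` to `b + a + c`.
  grid-split : ∀ a b c (t : ℕ → ℕ) → prod (b ℕ.+ c) (λ i → prod (a ℕ.+ c) (λ j → t (i ℕ.+ j))) ≡
    prod b (λ i → prod a (λ j → t (c ℕ.+ i ℕ.+ j))) ℕ.* prod c (λ k → prod (b ℕ.+ a ℕ.+ c) (λ n → t (k ℕ.+ n)))
  grid-split a b c t = begin
    prod (b ℕ.+ c) (λ i → prod (a ℕ.+ c) (λ j → t (i ℕ.+ j)))
      ≡⟨ trans (cong (λ n → prod n (λ i → prod (a ℕ.+ c) (λ j → t (i ℕ.+ j)))) (ℕ.+-comm b c)) (prod-+ c b _) ⟩
    top ℕ.* prod b (λ i → prod (a ℕ.+ c) (λ j → t (c ℕ.+ i ℕ.+ j)))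
      ≡⟨ cong (top ℕ.*_) (trans (prod-cong b (λ i → prod-+ a c _)) (prod-* b _ _)) ⟩
    top ℕ.* (block ℕ.* prod b (λ i → prod c (λ k → t (c ℕ.+ i ℕ.+ (a ℕ.+ k)))))
      ≡⟨ cong (λ u → top ℕ.* (block ℕ.* u)) (trans (prod-swap b c _)
           (prod-cong c (λ k → prod-cong b (λ i → cong t (arith a c i k))))) ⟩
    top ℕ.* (block ℕ.* right) ≡⟨ arith′ top block right ⟩
    block ℕ.* (top ℕ.* right)
      ≡⟨ cong (block ℕ.*_) (trans (sym (prod-* c _ _)) (prod-cong c λ k → trans (sym (prod-+ (a ℕ.+ c) b _))
           (cong (λ n → prod n (λ j → t (k ℕ.+ j))) (arith″ a b c)))) ⟩
    block ℕ.* prod c (λ k → prod (b ℕ.+ a ℕ.+ c) (λ n → t (k ℕ.+ n))) ∎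
    where
    open ≡-Reasoning
    top = prod c (λ k → prod (a ℕ.+ c) (λ j → t (k ℕ.+ j)))
    block = prod b (λ i → prod a (λ j → t (c ℕ.+ i ℕ.+ j)))
    right = prod c (λ k → prod b (λ i → t (k ℕ.+ (a ℕ.+ c ℕ.+ i))))
    arith : ∀ a c i k → c ℕ.+ i ℕ.+ (a ℕ.+ k) ≡ k ℕ.+ (a ℕ.+ c ℕ.+ i)
    arith = ℕ-Solver.solve-∀
    arith′ : ∀ p q r → p ℕ.* (q ℕ.* r) ≡ q ℕ.* (p ℕ.* r)
    arith′ = ℕ-Solver.solve-∀
    arith″ : ∀ a b c → a ℕ.+ c ℕ.+ b ≡ b ℕ.+ a ℕ.+ c
    arith″ = ℕ-Solver.solve-∀

  -- The cells of Λ as a shape given by two progressions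

  ∈-grid : ∀ R C {i j} → i ℕ.< R → j ℕ.< C → (i , j) ∈ grid R C
  ∈-grid R C {i} i< j< = ∈-concatMap⁺ (λ i → map (λ j → (i , j)) (upTo C)) (lose (∈-upTo⁺ i<) (∈-map⁺ (i ,_) (∈-upTo⁺ j<)))

  grid-unique : ∀ R C → Unique (grid R C)
  grid-unique R C = go (upTo R) (Unique.upTo⁺ R)
    where
    row : ℕ → List Cell
    row i = map (λ j → (i , j)) (upTo C)
    clash : ∀ {i is z} → All (i ≢_) is → z ∈ row i → (∃ λ i′ → i′ ∈ is × z ∈ row i′) → ⊥
    clash {i} i∉ z∈ (i′ , i′∈ , z∈′) with ∈-map⁻ (i ,_) z∈ | ∈-map⁻ (i′ ,_) z∈′
    ... | _ , _ , refl | _ , _ , eq = All.lookup i∉ i′∈ (cong proj₁ eq)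
    go : ∀ is → Unique is → Unique (concatMap row is)
    go []       []         = []
    go (i ∷ is) (i∉ ∷ uis) = Unique.++⁺ (Unique.map⁺ (cong proj₂) (Unique.upTo⁺ C)) (go is uis)
      (λ (z∈ , z∈′) → clash i∉ z∈ (find (∈-concatMap⁻ row {xs = is} z∈′)))

  module _ (a b c d e m : ℕ) where
    private
      M = m ℕ.+ 1
    open Evaluation a b c d e M using (x; y; G-closed)
    open Hankel (d ℕ.+ e) M using (t; r; R)
    open Count a b
    open Skew a b using (G)

    strict-AP : ∀ k → Strict (λ i → k ℕ.+ i ℕ.* M)
    strict-AP k i = ℕ.+-monoʳ-< k (ℕ.m<n+m (i ℕ.* M) (ℕ.≤-trans (s≤s z≤n) (ℕ.m≤n+m 1 m)))

    private
      -- ν i = x p - p for p = A - i, written without subtraction.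
      row⁺ : ∀ A B k i j → i ℕ.≤ A → j ℕ.≤ B ℕ.+ (k ℕ.+ (A ℕ.∸ i) ℕ.* m) → Row A B (λ p → k ℕ.+ p ℕ.* M) i j
      row⁺ A B k i j i≤A j≤ = A ℕ.∸ i , ℕ.m+[n∸m]≡n i≤A ,
        ℕ.≤-trans (ℕ.+-monoˡ-≤ (A ℕ.∸ i) j≤) (ℕ.≤-reflexive (arith B k (A ℕ.∸ i) m))
        where
        arith : ∀ B k p m → B ℕ.+ (k ℕ.+ p ℕ.* m) ℕ.+ p ≡ B ℕ.+ (k ℕ.+ p ℕ.* (m ℕ.+ 1))
        arith = ℕ-Solver.solve-∀

      row⁻ : ∀ A B k i j → Row A B (λ p → k ℕ.+ p ℕ.* M) i j → i ℕ.≤ A × j ℕ.≤ B ℕ.+ (k ℕ.+ (A ℕ.∸ i) ℕ.* m)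
      row⁻ A B k i j (p , refl , le) = ℕ.m≤m+n i p , ℕ.+-cancelʳ-≤ p j _ (ℕ.≤-trans le (ℕ.≤-reflexive
        (trans (arith B k p m) (cong (λ u → B ℕ.+ (k ℕ.+ u ℕ.* m) ℕ.+ p) (sym (ℕ.m+n∸m≡n i p))))))
        where
        arith : ∀ B k p m → B ℕ.+ (k ℕ.+ p ℕ.* (m ℕ.+ 1)) ≡ B ℕ.+ (k ℕ.+ p ℕ.* m) ℕ.+ p
        arith = ℕ-Solver.solve-∀

    InΛ⇒In : ∀ z → InΛ a b c d e m z → In a b (a ℕ.+ c) (b ℕ.+ c) x y z
    InΛ⇒In (i , j) (pos , inj₁ (i≤ , j≤) , n) = pos , inj₁ (row⁺ (a ℕ.+ c) (b ℕ.+ c) d i j i≤ j≤) , n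
    InΛ⇒In (i , j) (pos , inj₂ (j≤ , i≤) , n) = pos , inj₂ (row⁺ (b ℕ.+ c) (a ℕ.+ c) e j i j≤ i≤) , n

    In⇒InΛ : ∀ z → In a b (a ℕ.+ c) (b ℕ.+ c) x y z → InΛ a b c d e m z
    In⇒InΛ (i , j) (pos , inj₁ r , n) = pos , inj₁ (row⁻ (a ℕ.+ c) (b ℕ.+ c) d i j r) , n
    In⇒InΛ (i , j) (pos , inj₂ r , n) = pos , inj₂ (row⁻ (b ℕ.+ c) (a ℕ.+ c) e j i r) , n

    private
      rows = suc (a ℕ.+ c ℕ.+ e ℕ.+ (b ℕ.+ c) ℕ.* m)
      cols = suc (b ℕ.+ c ℕ.+ d ℕ.+ (a ℕ.+ c) ℕ.* m)

      inside : ∀ p q r → p ℕ.≤ p ℕ.+ q ℕ.+ r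
      inside p q r = ℕ.≤-trans (ℕ.m≤m+n p q) (ℕ.m≤m+n (p ℕ.+ q) r)

      outside : ∀ B k A i j → j ℕ.≤ B ℕ.+ (k ℕ.+ (A ℕ.∸ i) ℕ.* m) → j ℕ.≤ B ℕ.+ k ℕ.+ A ℕ.* m
      outside B k A i j le = ℕ.≤-trans le (ℕ.≤-trans (ℕ.≤-reflexive (sym (ℕ.+-assoc B k _)))
        (ℕ.+-monoʳ-≤ (B ℕ.+ k) (ℕ.*-monoˡ-≤ m (ℕ.m∸n≤m A i))))

    InΛ-bounded : ∀ i j → InΛ a b c d e m (i , j) → i ℕ.< rows × j ℕ.< cols
    InΛ-bounded i j (_ , inj₁ (i≤ , j≤) , _) = s≤s (ℕ.≤-trans i≤ (inside (a ℕ.+ c) e _)) , s≤s (outside (b ℕ.+ c) d (a ℕ.+ c) i j j≤)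
    InΛ-bounded i j (_ , inj₂ (j≤ , i≤) , _) = s≤s (outside (a ℕ.+ c) e (b ℕ.+ c) j i i≤) , s≤s (ℕ.≤-trans j≤ (inside (b ℕ.+ c) d _))

    cellsΛ-shape : Shape c x y (cellsΛ a b c d e m)
    cellsΛ-shape = record
      { unique   = Unique.filter⁺ (InΛ? a b c d e m) (grid-unique rows cols)
      ; sound    = λ {z} z∈ → InΛ⇒In z (proj₂ (∈-filter⁻ (InΛ? a b c d e m) {xs = grid rows cols} z∈))
      ; complete = λ { {i , j} inz → let inΛ = In⇒InΛ (i , j) inz ; i< , j< = InΛ-bounded i j inΛ in
                     ∈-filter⁺ (InΛ? a b c d e m) (∈-grid rows cols i< j<) inΛ }
      }

    -- Clearing denominators and collecting factors

    private
      n = length (cellsΛ a b c d e m)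
      f = numSYT (cellsΛ a b c d e m)
      A = a ℕ.+ c
      B = b ℕ.+ c
      F₁ = prod A (λ i → (d ℕ.+ i ℕ.* M) !)
      F₂ = prod B (λ i → (e ℕ.+ i ℕ.* M) !)
      block = prod b (λ i → prod a (λ j → t (c ℕ.+ i ℕ.+ j)))
      strip = prod c (λ k → prod (b ℕ.+ a ℕ.+ c) (λ n → t (k ℕ.+ n)))
      coeff = prod a (λ k → k ! ℕ.* M ^ k) ℕ.* prod b (λ k → k ! ℕ.* M ^ k) ℕ.* (M ^ (b ℕ.+ a)) ^ c ℕ.*
        (prod c (λ k → (b ℕ.+ a ℕ.+ k) !) ℕ.* Φ c ℕ.* (V M c ℕ.* V M c))

      strip-inverse : ∏ c (λ k → R (b ℕ.+ a ℕ.+ c) k) * ι strip ≡ 1ℚ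
      strip-inverse = trans (cong (∏ c (λ k → R (b ℕ.+ a ℕ.+ c) k) *_) (sym (trans (∏-cong c (λ k → ∏-ι (b ℕ.+ a ℕ.+ c) _)) (∏-ι c _))))
        (trans (sym (∏-* c _ _)) (∏-one c _ λ k → trans (sym (∏-* (b ℕ.+ a ℕ.+ c) _ _))
          (∏-one (b ℕ.+ a ℕ.+ c) _ λ n → trans (*-comm (r (k ℕ.+ n)) (ι (t (k ℕ.+ n)))) (ι*inv (t (k ℕ.+ n))))))

    -- Every denominator is cleared before leaving ℚ: `F₁` and `F₂` cancel the inverse factorials,
    -- and `strip` cancels the reciprocals left by the Hankel determinant.
    numSYT-closed : f ℕ.* F₁ ℕ.* F₂ ℕ.* strip ≡ n ! ℕ.* coeff
    numSYT-closed = ι-injective _ _ (begin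
      ι (f ℕ.* F₁ ℕ.* F₂ ℕ.* strip)
        ≡⟨ trans (ι-* (f ℕ.* F₁ ℕ.* F₂) strip) (cong (_* ι strip) (trans (ι-* (f ℕ.* F₁) F₂) (cong (_* ι F₂) (ι-* f F₁)))) ⟩
      ι f * ι F₁ * ι F₂ * ι strip
        ≡⟨ cong (λ u → u * ι F₁ * ι F₂ * ι strip) (trans (proj₂ (count n (strict-AP d) (strict-AP e) cellsΛ-shape refl)) (cong (ι (n !) *_) G-closed)) ⟩
      ι (n !) * (X * Y * (wa * wb * p * q) * Z) * ι F₁ * ι F₂ * ι strip
        ≡⟨ solve 11 (λ n x y a b p q z f g s → n :* (x :* y :* (a :* b :* p :* q) :* z) :* f :* g :* s :=
               n :* (a :* b :* p :* q) :* ((x :* f) :* (y :* g) :* (z :* s))) refl (ι (n !)) X Y wa wb p q Z (ι F₁) (ι F₂) (ι strip) ⟩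
      ι (n !) * (wa * wb * p * q) * ((X * ι F₁) * (Y * ι F₂) * (Z * ι strip))
        ≡⟨ cong (ι (n !) * (wa * wb * p * q) *_) (cong₂ _*_ (cong₂ _*_ (∏-invFact A x) (∏-invFact B y)) strip-inverse) ⟩
      ι (n !) * (wa * wb * p * q) * (1ℚ * 1ℚ * 1ℚ) ≡⟨ *-identityʳ _ ⟩
      ι (n !) * (wa * wb * p * q)
        ≡⟨ cong (ι (n !) *_) (trans (ι-* _ _) (cong (_* q) (trans (ι-* _ _) (cong (_* p) (ι-* _ _))))) ⟨
      ι (n !) * ι coeff ≡⟨ ι-* (n !) coeff ⟨
      ι (n ! ℕ.* coeff) ∎)
      where
      open ≡-Reasoning
      X = ∏ A (invFact ∘ x)
      Y = ∏ B (invFact ∘ y)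
      wa = ι (prod a (λ k → k ! ℕ.* M ^ k))
      wb = ι (prod b (λ k → k ! ℕ.* M ^ k))
      p = ι ((M ^ (b ℕ.+ a)) ^ c)
      q = ι (prod c (λ k → (b ℕ.+ a ℕ.+ k) !) ℕ.* Φ c ℕ.* (V M c ℕ.* V M c))
      Z = ∏ c (λ k → R (b ℕ.+ a ℕ.+ c) k)

    private
      -- By `V-+`, the powers of `M` in `coeff` regroup into one `V` for `A` and one for `B`.
      -- `Ψ-closed` then absorbs each of them together with `Φ` and `Ψ`, and the remaining
      -- factorials extend `Φ (a + b)` to `Φ (a + b + c)`.
      coeff-closed : coeff ℕ.* (Φ (a ℕ.+ b) ℕ.* Φ B ℕ.* Φ A ℕ.* Ψ m A ℕ.* Ψ m B) ≡
        (Φ (a ℕ.+ b ℕ.+ c) ℕ.* Φ a ℕ.* Φ b ℕ.* Φ c) ℕ.* prod A (λ i → (i ℕ.* M) !) ℕ.* prod B (λ i → (i ℕ.* M) !)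
      coeff-closed = begin
        coeff ℕ.* (Φ (a ℕ.+ b) ℕ.* Φ B ℕ.* Φ A ℕ.* Ψ m A ℕ.* Ψ m B)
          ≡⟨ cong (ℕ._* (Φ (a ℕ.+ b) ℕ.* Φ B ℕ.* Φ A ℕ.* Ψ m A ℕ.* Ψ m B)) (cong₂ (λ u v → u ℕ.* v ℕ.* (Q ℕ.* Φ c ℕ.* (V M c ℕ.* V M c)))
               (cong₂ ℕ._*_ (weights a) (weights b)) (trans (cong (_^ c) (ℕ.^-distribˡ-+-* M b a)) (^-distribʳ-* c (M ^ b) (M ^ a)))) ⟩
        Φ a ℕ.* V M a ℕ.* (Φ b ℕ.* V M b) ℕ.* ((M ^ b) ^ c ℕ.* (M ^ a) ^ c) ℕ.* (Q ℕ.* Φ c ℕ.* (V M c ℕ.* V M c)) ℕ.*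
          (Φ (a ℕ.+ b) ℕ.* Φ B ℕ.* Φ A ℕ.* Ψ m A ℕ.* Ψ m B)
          ≡⟨ arith (Φ a) (V M a) (Φ b) (V M b) ((M ^ b) ^ c) ((M ^ a) ^ c) Q (Φ c) (V M c) (Φ (a ℕ.+ b)) (Φ B) (Φ A) (Ψ m A) (Ψ m B) ⟩
        (Φ (a ℕ.+ b) ℕ.* Q ℕ.* Φ a ℕ.* Φ b ℕ.* Φ c) ℕ.* (Ψ m A ℕ.* (Φ A ℕ.* (V M a ℕ.* ((M ^ a) ^ c ℕ.* V M c)))) ℕ.*
          (Ψ m B ℕ.* (Φ B ℕ.* (V M b ℕ.* ((M ^ b) ^ c ℕ.* V M c))))
          ≡⟨ cong₂ ℕ._*_ (cong₂ ℕ._*_ (cong (λ u → u ℕ.* Φ a ℕ.* Φ b ℕ.* Φ c) (sym Φ-split)) (product a)) (product b) ⟩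
        (Φ (a ℕ.+ b ℕ.+ c) ℕ.* Φ a ℕ.* Φ b ℕ.* Φ c) ℕ.* prod A (λ i → (i ℕ.* M) !) ℕ.* prod B (λ i → (i ℕ.* M) !) ∎
        where
        open ≡-Reasoning
        Q = prod c (λ k → (b ℕ.+ a ℕ.+ k) !)
        weights : ∀ n → prod n (λ k → k ! ℕ.* M ^ k) ≡ Φ n ℕ.* V M n
        weights n = trans (prod-* n _! (M ^_)) (cong (ℕ._* V M n) (sym (Φ≡prod n)))
        Φ-split : Φ (a ℕ.+ b ℕ.+ c) ≡ Φ (a ℕ.+ b) ℕ.* Q
        Φ-split = trans (Φ-+ (a ℕ.+ b) c) (cong (λ u → Φ (a ℕ.+ b) ℕ.* prod c (λ k → (u ℕ.+ k) !)) (ℕ.+-comm a b))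
        product : ∀ n → Ψ m (n ℕ.+ c) ℕ.* (Φ (n ℕ.+ c) ℕ.* (V M n ℕ.* ((M ^ n) ^ c ℕ.* V M c))) ≡ prod (n ℕ.+ c) (λ i → (i ℕ.* M) !)
        product n = trans (cong (λ u → Ψ m (n ℕ.+ c) ℕ.* (Φ (n ℕ.+ c) ℕ.* u)) (sym (V-+ M n c))) (Ψ-closed m (n ℕ.+ c))
        arith : ∀ φa va φb vb pb pa q φc vc φab φB φA ψA ψB →
          φa ℕ.* va ℕ.* (φb ℕ.* vb) ℕ.* (pb ℕ.* pa) ℕ.* (q ℕ.* φc ℕ.* (vc ℕ.* vc)) ℕ.* (φab ℕ.* φB ℕ.* φA ℕ.* ψA ℕ.* ψB) ≡
          (φab ℕ.* q ℕ.* φa ℕ.* φb ℕ.* φc) ℕ.* (ψA ℕ.* (φA ℕ.* (va ℕ.* (pa ℕ.* vc)))) ℕ.* (ψB ℕ.* (φB ℕ.* (vb ℕ.* (pb ℕ.* vc))))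
        arith = ℕ-Solver.solve-∀

    product-formula : f ℕ.* (Φ (a ℕ.+ b) ℕ.* Φ B ℕ.* Φ A ℕ.* Ψ m A ℕ.* Ψ m B) ℕ.* F₁ ℕ.* F₂ ℕ.*
        prod B (λ i → prod A (λ j → t (i ℕ.+ j))) ≡
      n ! ℕ.* (Φ (a ℕ.+ b ℕ.+ c) ℕ.* Φ a ℕ.* Φ b ℕ.* Φ c) ℕ.* prod A (λ i → (i ℕ.* M) !) ℕ.* prod B (λ i → (i ℕ.* M) !) ℕ.* block
    product-formula = begin
      f ℕ.* Z ℕ.* F₁ ℕ.* F₂ ℕ.* prod B (λ i → prod A (λ j → t (i ℕ.+ j))) ≡⟨ cong (f ℕ.* Z ℕ.* F₁ ℕ.* F₂ ℕ.*_) (grid-split a b c t) ⟩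
      f ℕ.* Z ℕ.* F₁ ℕ.* F₂ ℕ.* (block ℕ.* strip) ≡⟨ arith f Z F₁ F₂ block strip ⟩
      f ℕ.* F₁ ℕ.* F₂ ℕ.* strip ℕ.* (Z ℕ.* block) ≡⟨ cong (ℕ._* (Z ℕ.* block)) numSYT-closed ⟩
      n ! ℕ.* coeff ℕ.* (Z ℕ.* block) ≡⟨ arith′ (n !) coeff Z block ⟩
      n ! ℕ.* (coeff ℕ.* Z) ℕ.* block ≡⟨ cong (λ u → n ! ℕ.* u ℕ.* block) coeff-closed ⟩
      n ! ℕ.* (Φs ℕ.* P₁ ℕ.* P₂) ℕ.* block ≡⟨ arith″ (n !) Φs P₁ P₂ block ⟩
      n ! ℕ.* Φs ℕ.* P₁ ℕ.* P₂ ℕ.* block ∎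
      where
      open ≡-Reasoning
      Z = Φ (a ℕ.+ b) ℕ.* Φ B ℕ.* Φ A ℕ.* Ψ m A ℕ.* Ψ m B
      Φs = Φ (a ℕ.+ b ℕ.+ c) ℕ.* Φ a ℕ.* Φ b ℕ.* Φ c
      P₁ = prod A (λ i → (i ℕ.* M) !)
      P₂ = prod B (λ i → (i ℕ.* M) !)
      arith : ∀ f z p q g s → f ℕ.* z ℕ.* p ℕ.* q ℕ.* (g ℕ.* s) ≡ f ℕ.* p ℕ.* q ℕ.* s ℕ.* (z ℕ.* g)
      arith = ℕ-Solver.solve-∀
      arith′ : ∀ n k z g → n ℕ.* k ℕ.* (z ℕ.* g) ≡ n ℕ.* (k ℕ.* z) ℕ.* g
      arith′ = ℕ-Solver.solve-∀
      arith″ : ∀ n s p q g → n ℕ.* (s ℕ.* p ℕ.* q) ℕ.* g ≡ n ℕ.* s ℕ.* p ℕ.* q ℕ.* g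
      arith″ = ℕ-Solver.solve-∀

open import Data.Nat using (ℕ; _+_; _*_; _!)
open import Data.List using (length)

theorem4p1 : (a b c d e m : ℕ) →
    let π = cellsΛ a b c d e m
        n = length π
        M = m + 1
    in numSYT π
         * (Φ (a + b) * Φ (b + c) * Φ (a + c) * Ψ m (a + c) * Ψ m (b + c))
         * prod (a + c) (λ i → (d + i * M) !)
         * prod (b + c) (λ i → (e + i * M) !)
         * prod (b + c) (λ i → prod (a + c) (λ j → 1 + d + e + (i + j) * M))
       ≡ n !
         * (Φ (a + b + c) * Φ a * Φ b * Φ c)
         * prod (a + c) (λ i → (i * M) !)
         * prod (b + c) (λ i → (i * M) !)
         * prod b (λ i → prod a (λ j → 1 + d + e + (c + i + j) * M))
theorem4p1 = Tableaux.product-formula
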